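{- Let $\alpha\in(0,1)$ and $\gamma>0$ be fixed constants. There exists a constant $c=c(\alpha,\gamma)>0$ such that, with probability $1-o(1)$ as $n\to\infty$ over the random graph $G\sim\mathcal{G}(n,\frac12,k=\lfloor n^\alpha\rfloor)$ with planted clique $\mathcal{PC}$, the following holds. For every $h:[n]\to\mathbb{R}$, every $m\in\mathbb{N}$ with $m\ge1$, all inverse temperatures $\beta_1<\beta_2<\dots<\beta_m$, and all estimates $\widehat Z(\beta_i)>0$, $i=1,\dots,m$, there is an initial pair of clique and temperature such that the simulated tempering (ST) dynamics $\{(X_t,I_t)\}$ started from this pair requires, with probability at least $1-\exp(-c\log^2 n)$, at least $\exp(c\log^2 n)$ steps to reach a pair whose clique $X_t$ satisfies $|X_t\cap\mathcal{PC}|\ge\gamma\log n$. In particular, under worst-case initialization the ST dynamics fail to recover the planted clique in polynomial time.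
   Context: Conventions: $\log$ is the base-2 logarithm; $[n]=\{0,1,\dots,n\}$. Planted clique model: $\mathcal{G}(n,\frac12,k)$ is the random graph on an $n$-element vertex set $V$ obtained by sampling $\mathcal{G}(n,\frac12)$ (each pair is an edge independently with probability $1/2$), choosing a uniformly random $k$-subset $\mathcal{PC}\subseteq V$ (the planted clique), and adding all edges between vertices of $\mathcal{PC}$. $\Omega(G)$ denotes the set of all cliques of $G$, i.e. vertex subsets (including $\emptyset$) whose vertices are pairwise adjacent. ST dynamics: given $h:[n]\to\mathbb{R}$ (written $h_q=h(q)$), inverse temperatures $\beta_1<\dots<\beta_m$, positive numbers $\widehat Z(\beta_i)$ (thought of as estimates of the partition functions $Z(\beta_i)=\sum_{C\in\Omega(G)}\exp(\beta_i h_{|C|})$) and a parameter $a\in(0,1)$, this is the Markov chain $\{(X_t,I_t)\}$ on $\Omega(G)\times\{1,\dots,m\}$ with transition probabilities: (level move) for $C,C'\in\Omega(G)$ differing in exactly one vertex, $P((C,i),(C',i))=\frac{a}{n}\min\{1,\exp[\beta_i(h_{|C'|}-h_{|C|})]\}$; (temperature move) for $|i-i'|=1$, $P((C,i),(C,i'))=\frac{1-a}{2}\min\{1,\frac{\widehat Z(\beta_i)}{\widehat Z(\beta_{i'})}\exp[(\beta_{i'}-\beta_i)h_{|C|}]\}$; and the remaining probability is put on staying at the current state. Recovering the planted clique means reaching a state with $X_t=\mathcal{PC}$. -}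

module Defs where

open import Level using (Level; _⊔_) renaming (suc to lsuc)
open import Algebra.Bundles using (CommutativeRing)
import Algebra.Definitions.RawMonoid as RawMonoid
open import Algebra.Morphism.Structures using (module MonoidMorphisms)
open import Data.Bool.Base using (Bool; T; if_then_else_)
import Data.Bool.Properties as Bool
open import Data.Empty using (⊥; ⊥-elim)
open import Data.Fin.Base using (Fin; zero; suc; toℕ; fromℕ<)
import Data.Fin.Base as Fin
import Data.Fin.Properties as Fin
open import Data.Fin.Subset using (Subset; inside; outside; _∈_; _∩_; _∪_; _─_; ∣_∣)
open import Data.Fin.Subset.Properties using (_∈?_; ∣p∣≤n)
open import Data.List.Base using (List; []; _∷_; foldr; filter; length; allFin; cartesianProduct; cartesianProductWith)
open import Data.Nat.Base using (ℕ; NonZero; s≤s; _^_) renaming (∣_-_∣ to dist; zero to zeroℕ; suc to sucℕ; _≤_ to _≤ℕ_)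
import Data.Nat.Properties as ℕ
open import Data.Product.Base using (Σ-syntax; ∃-syntax; _×_; _,_)
import Data.Product.Properties as Product
open import Data.Sum.Base using (inj₁; inj₂)
open import Data.Vec.Base as Vec using (Vec; []; _∷_)
import Data.Vec.Properties as Vec
open import Data.Vec.Relation.Unary.All using (All)
open import Relation.Binary.Core using (Rel)
open import Relation.Binary.Definitions using (Decidable; DecidableEquality; Cotransitive)
open import Relation.Binary.Lattice.Definitions using (Infimum)
open import Relation.Binary.PropositionalEquality.Core using (_≢_)
open import Relation.Binary.Structures using (IsStrictPartialOrder)
open import Relation.Nullary.Decidable using (Dec; does; no; ¬?; _×-dec_; _→-dec_)
open import Relation.Nullary.Negation using (¬_)

-- The real numbers, as a Cauchy-complete Archimedean ordered field with its
-- exponential.  These axioms determine ℝ up to unique isomorphism; they are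
-- phrased constructively (setoid equality, cotransitive _<_, x ≤ y := ¬ y < x),
-- so that the Cauchy reals satisfy them without excluded middle, while
-- classically they are those of the complete ordered field.

record RealField (c ℓ : Level) : Set (lsuc (c ⊔ ℓ)) where
  infix 4 _<_ _≤_
  infixl 7 _⊓_

  field
    commutativeRing : CommutativeRing c ℓ

  open CommutativeRing commutativeRing public

  fromℕ : ℕ → Carrier
  fromℕ n = RawMonoid._×_ +-rawMonoid n 1#

  field
    _<_                  : Rel Carrier ℓ
    isStrictPartialOrder : IsStrictPartialOrder _≈_ _<_
    cotransitive         : Cotransitive _<_

  _≤_ : Rel Carrier ℓ
  x ≤ y = ¬ (y < x)

  IsCauchy : (ℕ → Carrier) → Set (c ⊔ ℓ)
  IsCauchy x = ∀ ε → 0# < ε → ∃[ N ] ∀ i j → N ≤ℕ i → N ≤ℕ j → x i < x j + ε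

  _ConvergesTo_ : (ℕ → Carrier) → Carrier → Set (c ⊔ ℓ)
  x ConvergesTo l = ∀ ε → 0# < ε → ∃[ N ] ∀ i → N ≤ℕ i → (x i < l + ε) × (l < x i + ε)

  field
    ≤-antisym   : ∀ {x y} → x ≤ y → y ≤ x → x ≈ y
    0<1         : 0# < 1#
    +-monoˡ-<   : ∀ z {x y} → x < y → x + z < y + z
    *-pos       : ∀ {x y} → 0# < x → 0# < y → 0# < x * y
    _⁻¹⟨_⟩      : ∀ x → 0# < x → Carrier
    *-inverseʳ  : ∀ x (0<x : 0# < x) → x * (x ⁻¹⟨ 0<x ⟩) ≈ 1#
    archimedean : ∀ x → ∃[ n ] x < fromℕ n
    complete    : ∀ x → IsCauchy x → ∃[ l ] x ConvergesTo l
    _⊓_         : Carrier → Carrier → Carrier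
    ⊓-infimum   : Infimum _≤_ _⊓_

  -- The only homomorphism (ℝ , +) → (ℝ , ·) with 1 + x ≤ exp x is x ↦ eˣ, since
  -- (1 + x/n)ⁿ ≤ exp x ≤ (1 - x/n)⁻ⁿ for large n.
  field
    exp                  : Carrier → Carrier
    exp-isHomomorphism   : MonoidMorphisms.IsMonoidHomomorphism +-rawMonoid *-rawMonoid exp
    1+x≤exp              : ∀ x → 1# + x ≤ exp x
    ln                   : ∀ x → 0# < x → Carrier
    exp-ln               : ∀ x (0<x : 0# < x) → exp (ln x 0<x) ≈ x

  private
    module < = IsStrictPartialOrder isStrictPartialOrder
    module exp = MonoidMorphisms.IsMonoidHomomorphism exp-isHomomorphism

    +-monoʳ-< : ∀ z {x y} → x < y → z + x < z + y
    +-monoʳ-< z {x} {y} x<y =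
      <.<-respʳ-≈ (+-comm y z) (<.<-respˡ-≈ (+-comm x z) (+-monoˡ-< z x<y))

    x+y-y : ∀ x y → (x + y) - y ≈ x
    x+y-y x y = trans (+-assoc x y (- y)) (trans (+-congˡ (-‿inverseʳ y)) (+-identityʳ x))

    +-cancelʳ-< : ∀ z {x y} → x + z < y + z → x < y
    +-cancelʳ-< z {x} {y} lt =
      <.<-respʳ-≈ (x+y-y y z) (<.<-respˡ-≈ (x+y-y x z) (+-monoˡ-< (- z) lt))

    double-cancel-< : ∀ {x y} → x + x < y + y → x < y
    double-cancel-< {x} {y} lt with cotransitive lt (y + x)
    ... | inj₁ p = +-cancelʳ-< x p
    ... | inj₂ p = +-cancelʳ-< y (<.<-respˡ-≈ (+-comm y x) p)

  0<fromℕ : ∀ n .{{_ : NonZero n}} → 0# < fromℕ n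
  0<fromℕ (sucℕ zeroℕ) = <.<-respʳ-≈ (sym (+-identityʳ 1#)) 0<1
  0<fromℕ (sucℕ n@(sucℕ _)) =
    <.trans 0<1 (<.<-respˡ-≈ (+-identityʳ 1#) (+-monoʳ-< 1# (0<fromℕ n)))

  ln2 : Carrier
  ln2 = ln (fromℕ 2) (0<fromℕ 2)

  0<ln2 : 0# < ln2
  0<ln2 with cotransitive 0<1 (ln2 + ln2)
  ... | inj₁ 0<2l = double-cancel-< (<.<-respˡ-≈ (sym (+-identityʳ 0#)) 0<2l)
  ... | inj₂ 2l<1 = ⊥-elim (1+x≤exp (- ln2) (double-cancel-< e+e<d+d))
    where
    e d : Carrier
    e = exp (- ln2)
    d = 1# - ln2

    e+e≈1 : e + e ≈ 1#
    e+e≈1 =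
      trans (sym (+-cong (*-identityʳ e) (trans (+-identityʳ (e * 1#)) (*-identityʳ e))))
      (trans (+-congˡ (+-congˡ (sym (zeroʳ e))))
      (trans (+-congˡ (sym (distribˡ e 1# 0#)))
      (trans (sym (distribˡ e 1# (1# + 0#)))
      (trans (*-congˡ (sym (exp-ln (fromℕ 2) (0<fromℕ 2))))
      (trans (sym (exp.homo (- ln2) ln2))
      (trans (exp.⟦⟧-cong (-‿inverseˡ ln2)) exp.ε-homo))))))

    d+l≈1 : d + ln2 ≈ 1#
    d+l≈1 = trans (+-assoc 1# (- ln2) ln2) (trans (+-congˡ (-‿inverseˡ ln2)) (+-identityʳ 1#))

    d+d+2l≈1+1 : (d + d) + (ln2 + ln2) ≈ 1# + 1#
    d+d+2l≈1+1 =
      trans (+-assoc d d (ln2 + ln2))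
      (trans (+-congˡ (trans (sym (+-assoc d ln2 ln2)) (trans (+-congʳ d+l≈1) (+-comm 1# ln2))))
      (trans (sym (+-assoc d ln2 1#)) (+-congʳ d+l≈1)))

    e+e<d+d : e + e < d + d
    e+e<d+d = +-cancelʳ-< (ln2 + ln2)
      (<.<-respʳ-≈ (sym d+d+2l≈1+1)
      (<.<-respˡ-≈ (+-congʳ (sym e+e≈1)) (+-monoʳ-< 1# 2l<1)))

  lnℕ : ∀ n → .{{NonZero n}} → Carrier
  lnℕ n = ln (fromℕ n) (0<fromℕ n)

  -- base 2
  log : ∀ n → .{{NonZero n}} → Carrier
  log n = lnℕ n * (ln2 ⁻¹⟨ 0<ln2 ⟩)

  log² : ∀ n → .{{NonZero n}} → Carrier
  log² n = log n * log n

  _^ℝ_ : ∀ n → .{{NonZero n}} → Carrier → Carrier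
  n ^ℝ α = exp (α * lnℕ n)

  IsFloor : ℕ → Carrier → Set ℓ
  IsFloor k x = (fromℕ k ≤ x) × (x < fromℕ (sucℕ k))

  ∑ : ∀ {a} {A : Set a} → List A → (A → Carrier) → Carrier
  ∑ xs f = foldr (λ x s → f x + s) 0# xs

-- Simple graphs on the vertex set Fin n.  In N ∷ G, the set N consists of the
-- neighbours of vertex 0 among the remaining vertices, so each simple graph
-- is represented exactly once and the uniform distribution on Graph n is
-- the distribution of 𝒢(n,½).

data Graph : ℕ → Set where
  []  : Graph 0
  _∷_ : ∀ {n} → Subset n → Graph n → Graph (sucℕ n)

Adj : ∀ {n} → Graph n → Fin n → Fin n → Set
Adj (N ∷ G) zero    zero    = ⊥
Adj (N ∷ G) zero    (suc v) = v ∈ N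
Adj (N ∷ G) (suc u) zero    = u ∈ N
Adj (N ∷ G) (suc u) (suc v) = Adj G u v

adj? : ∀ {n} (G : Graph n) → Decidable (Adj G)
adj? (N ∷ G) zero    zero    = no λ ()
adj? (N ∷ G) zero    (suc v) = v ∈? N
adj? (N ∷ G) (suc u) zero    = u ∈? N
adj? (N ∷ G) (suc u) (suc v) = adj? G u v

-- Adds all edges between vertices of the given subset.
plant : ∀ {n} → Graph n → Subset n → Graph n
plant []      []            = []
plant (N ∷ G) (inside ∷ S)  = (N ∪ S) ∷ plant G S
plant (N ∷ G) (outside ∷ S) = N ∷ plant G S

IsClique : ∀ {n} → Graph n → Subset n → Set
IsClique {n} G C = ∀ (u v : Fin n) → u ∈ C → v ∈ C → u ≢ v → Adj G u v

isClique? : ∀ {n} (G : Graph n) (C : Subset n) → Dec (IsClique G C)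
isClique? G C = Fin.all? λ u → Fin.all? λ v →
  (u ∈? C) →-dec ((v ∈? C) →-dec (¬? (u Fin.≟ v) →-dec adj? G u v))

vectors : ∀ {a} {A : Set a} → List A → ∀ n → List (Vec A n)
vectors xs zeroℕ    = [] ∷ []
vectors xs (sucℕ n) = cartesianProductWith Vec._∷_ xs (vectors xs n)

subsets : ∀ n → List (Subset n)
subsets = vectors (outside ∷ inside ∷ [])

subsetsOfSize : ∀ n → ℕ → List (Subset n)
subsetsOfSize n k = filter (λ S → ∣ S ∣ ℕ.≟ k) (subsets n)

graphs : ∀ n → List (Graph n)
graphs zeroℕ    = [] ∷ []
graphs (sucℕ n) = cartesianProductWith _∷_ (subsets n) (graphs n)

cliques : ∀ {n} → Graph n → List (Subset n)
cliques {n} G = filter (isClique? G) (subsets n)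

_∆_ : ∀ {n} → Subset n → Subset n → Subset n
C ∆ C′ = (C ─ C′) ∪ (C′ ─ C)

module _ {c ℓ} (ℝ : RealField c ℓ) where
  open RealField ℝ

  -- MassAtLeast xs w E p: the event E has mass at least p under the weights w on
  -- xs.  As E need not be decidable, this asks for a decidable subevent of
  -- mass at least p; classically the two are equivalent.
  MassAtLeast : ∀ {a e} {A : Set a} → List A → (A → Carrier) → (A → Set e) → Carrier → Set (a ⊔ e ⊔ ℓ)
  MassAtLeast {A = A} xs w E p =
    Σ[ χ ∈ (A → Bool) ] (∀ x → T (χ x) → E x) × p ≤ ∑ xs (λ x → if χ x then w x else 0#)

  UniformProbAtLeast : ∀ {a e} {A : Set a} → List A → (A → Set e) → Carrier → Set (a ⊔ e ⊔ ℓ)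
  UniformProbAtLeast xs E p = MassAtLeast xs (λ _ → 1#) E (p * fromℕ (length xs))

  -- E holds with probability 1 - o(1) as n → ∞ for G ~ 𝒢(n,½,⌊nᵅ⌋) with planted
  -- clique PC.  The sample space consists of the 𝒢(n,½) graph before planting
  -- and of PC; E receives the graph after planting.
  WithHighProbability : ∀ {e} → Carrier →
    (∀ n → .{{NonZero n}} → Graph n → Subset n → Set e) → Set (c ⊔ ℓ ⊔ e)
  WithHighProbability α E =
    ∀ ε → 0# < ε → ∃[ n₀ ] ∀ n → .{{_ : NonZero n}} → n₀ ≤ℕ n →
    ∀ k → IsFloor k (n ^ℝ α) →
    UniformProbAtLeast (cartesianProduct (graphs n) (subsetsOfSize n k))
      (λ (G₀ , PC) → E n (plant G₀ PC) PC) (1# - ε)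

  record SimulatedTempering (n : ℕ) : Set (c ⊔ ℓ) where
    field
      h            : Fin (sucℕ n) → Carrier
      m            : ℕ
      1≤m          : 1 ≤ℕ m
      β            : Fin m → Carrier
      β-increasing : ∀ {i j} → i Fin.< j → β i < β j
      Ẑ            : Fin m → Carrier
      Ẑ-positive   : ∀ i → 0# < Ẑ i
      a            : Carrier
      0<a          : 0# < a
      a<1          : a < 1#

    State : Set
    State = Subset n × Fin m

    _≟ₛ_ : DecidableEquality (Subset n)
    _≟ₛ_ = Vec.≡-dec Bool._≟_

    _≟_ : DecidableEquality State
    _≟_ = Product.≡-dec _≟ₛ_ Fin._≟_

    h∣_∣ : Subset n → Carrier
    h∣ C ∣ = h (fromℕ< (s≤s (∣p∣≤n C)))

    module Dynamics .{{_ : NonZero n}} (G : Graph n) where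

      states : List State
      states = cartesianProduct (cliques G) (allFin m)

      levelMove : Subset n → Subset n → Fin m → Carrier
      levelMove C C′ i =
        a * (fromℕ n ⁻¹⟨ 0<fromℕ n ⟩) * (1# ⊓ exp (β i * (h∣ C′ ∣ - h∣ C ∣)))

      temperatureMove : Subset n → Fin m → Fin m → Carrier
      temperatureMove C i i′ =
        (1# - a) * (fromℕ 2 ⁻¹⟨ 0<fromℕ 2 ⟩) *
        (1# ⊓ (Ẑ i * (Ẑ i′ ⁻¹⟨ Ẑ-positive i′ ⟩) * exp ((β i′ - β i) * h∣ C ∣)))

      move : State → State → Carrier
      move (C , i) (C′ , i′) =
        if does ((i Fin.≟ i′) ×-dec (∣ C ∆ C′ ∣ ℕ.≟ 1)) then levelMove C C′ i
        else if does ((C ≟ₛ C′) ×-dec (dist (toℕ i) (toℕ i′) ℕ.≟ 1)) then temperatureMove C i i′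
        else 0#

      -- Here move s s is 0#.
      P : State → State → Carrier
      P s s′ = if does (s ≟ s′) then 1# - ∑ states (move s) else move s s′

      -- The probability that the chain started at s visits the given states in
      -- its next t steps.
      pathProbability : ∀ {t} → State → Vec State t → Carrier
      pathProbability s []        = 1#
      pathProbability s (s′ ∷ ss) = P s s′ * pathProbability s′ ss

      -- For E a property of (X₀ , I₀) , … , (Xₜ , Iₜ).
      TrajectoryProbAtLeast : ∀ {e} → State → (t : ℕ) → (Vec State (sucℕ t) → Set e) → Carrier → Set (e ⊔ ℓ)
      TrajectoryProbAtLeast s t E =
        MassAtLeast (vectors states t) (pathProbability s) (λ ss → E (s ∷ ss))

  -- From some initial pair, with probability at least 1 - exp(-κ log² n) the
  -- dynamics need at least exp(κ log² n) steps to reach |X ∩ PC| ≥ γ log n.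
  SlowToReachOverlap : (γ κ : Carrier) → ∀ n → .{{NonZero n}} → Graph n → Subset n →
    SimulatedTempering n → Set ℓ
  SlowToReachOverlap γ κ n G PC S =
    Σ[ C ∈ Subset n ] Σ[ i ∈ Fin m ] IsClique G C ×
    (∀ t → fromℕ t < exp (κ * log² n) →
      TrajectoryProbAtLeast (C , i) t
        (All λ (X , _) → ¬ (γ * log n ≤ fromℕ ∣ X ∩ PC ∣))
        (1# - exp (- (κ * log² n))))
    where
    open SimulatedTempering S
    open Dynamics G

  -- From some initial pair, with probability at least 1 - exp(-κ log² n) the
  -- planted clique is not recovered within nᵈ steps.
  FailsToRecoverWithin : (d : ℕ) (κ : Carrier) → ∀ n → .{{NonZero n}} → Graph n → Subset n →
    SimulatedTempering n → Set ℓ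
  FailsToRecoverWithin d κ n G PC S =
    Σ[ C ∈ Subset n ] Σ[ i ∈ Fin m ] IsClique G C ×
    TrajectoryProbAtLeast (C , i) (n ^ d)
      (All λ (X , _) → X ≢ PC)
      (1# - exp (- (κ * log² n)))
    where
    open SimulatedTempering S
    open Dynamics G

{-# OPTIONS --safe #-}
-- Fix PC and scale n as 2^(2R²e) ≤ n < 2^(2R²(e+1)) with R a large constant, and
-- put r = 2Re.  Let W_{q,s} be the number of q-cliques that meet PC in exactly s
-- vertices.  With high probability 2^(r²) W_{q,r} ≤ W_{q,0} for every q: up to
-- q = 2h, slightly below 2 log n, the second moment method bounds W_{q,0} below
-- by half its mean while W_{q,r} is small by the first moment, because
-- k 2^(4r) ≤ n; the first moment also gives W_{2h+1,r} = 0, and then W_{q,r} = 0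
-- for all q > 2h, since vertices outside PC can be deleted from a clique.
--
-- The dynamics are reversible for the weights e^{β_i h_|C|} / Ẑ(β_i), and a weight
-- depends on C only through its size.  Hence, for every h, β and Ẑ, the states
-- with |C ∩ PC| = r weigh 2^(r²) times less than those with |C ∩ PC| < r, and
-- every path out of the latter passes through the former.  By stationarity the
-- chain started from the weights on |C ∩ PC| < r escapes within T steps with
-- probability at most T 2^(-r²), so some initial pair does no worse.

module Submission where

open import Defs
open import Level using (Level; _⊔_)
open import Algebra.Bundles using (CommutativeSemiring)
import Data.Nat.Properties as ℕ
open import Data.Nat.Base as ℕ using (ℕ; NonZero)
open import Data.Product.Base using (Σ-syntax; _×_; _,_)

-- The function `h` may concentrate the stationary weight on cliques of a single size, so `W_(q,r)`
-- and `W_(q,0)` must be compared size by size, including sizes beyond the reach of the second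
-- moment. The scale reconciles two demands there. Let `w = 2R²`, so that `log n ≈ we` and
-- `h = we - e`. The second moment up to `2h` needs the slack `e` below `log n`, because `2^e` has
-- to beat polynomials in `log n`. The first moment at `2h + 1` then loses a factor of about
-- `2^(2we²)`, to be paid by the factor `2^(4r²)` that `k 2^(4r) ≤ n` gains. In units of `log n` the
-- slack is of order `1/R²` and `r` of order `1/R`, which gives `r² = 2we²` and settles the balance.
-- `R` is four times an integer `D` with `1/D` at most `1 - α`, `α` and `γ`. The horizon `T`
-- satisfies `T² < 2^(r²)`, so the escape probability is below `1/T` and one number controls both
-- time and failure. Probabilities over graphs appear as counts with denominators multiplied out,
-- which keeps the combinatorial half in the natural numbers.

-- Finite sums over a commutative semiring.

module ListSum {c ℓ} (S : CommutativeSemiring c ℓ) where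
  open import Data.Bool.Base using (Bool; true; false; if_then_else_; _∧_)
  open import Data.List.Base using (List; []; _∷_; foldr; filter; map; _++_; cartesianProductWith)
  open import Data.List.Membership.Propositional using (_∈_)
  open import Data.List.Relation.Unary.Any using (here; there)
  open import Data.List.Relation.Unary.All as All using ([]; _∷_)
  open import Data.List.Relation.Unary.AllPairs using ([]; _∷_)
  open import Data.List.Relation.Unary.Unique.Propositional using (Unique)
  open import Data.Nat.Base using (suc)
  open import Data.Fin.Subset using (Subset; inside; outside)
  open import Data.Vec.Base using (_∷_)
  open import Relation.Binary.PropositionalEquality.Core as ≡ using (_≡_; _≢_)
  open import Relation.Nullary.Decidable using (does; dec-true; dec-false)
  open import Relation.Unary using (Pred; Decidable)
  open import Relation.Binary.Definitions using (DecidableEquality)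
  open CommutativeSemiring S

  private
    variable
      a b : Level
      A : Set a
      B : Set b

  -- Stated for an arbitrary commutative semiring so that the same lemmas serve counts in `ℕ` and
  -- masses in `ℝ`; over `ℝ` it unfolds to the sum used in the statement of the theorem.
  ∑ : ∀ {a} {A : Set a} → List A → (A → Carrier) → Carrier
  ∑ xs f = foldr (λ x s → f x + s) 0# xs

  +-interchange : ∀ x y z w → (x + y) + (z + w) ≈ (x + z) + (y + w)
  +-interchange x y z w =
    trans (+-assoc x y _) (trans (+-congˡ (trans (sym (+-assoc y z w))
    (trans (+-congʳ (+-comm y z)) (+-assoc z y w)))) (sym (+-assoc x z _)))

  ∑-cong : ∀ (xs : List A) {f g} → (∀ x → f x ≈ g x) → ∑ xs f ≈ ∑ xs g
  ∑-cong []       f≈g = refl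
  ∑-cong (x ∷ xs) f≈g = +-cong (f≈g x) (∑-cong xs f≈g)

  ∑-+ : ∀ (xs : List A) f g → ∑ xs (λ x → f x + g x) ≈ ∑ xs f + ∑ xs g
  ∑-+ []       f g = sym (+-identityˡ 0#)
  ∑-+ (x ∷ xs) f g = trans (+-congˡ (∑-+ xs f g)) (+-interchange _ _ _ _)

  ∑-0 : ∀ (xs : List A) → ∑ xs (λ _ → 0#) ≈ 0#
  ∑-0 []       = refl
  ∑-0 (x ∷ xs) = trans (+-identityˡ _) (∑-0 xs)

  ∑-*ˡ : ∀ (xs : List A) c f → ∑ xs (λ x → c * f x) ≈ c * ∑ xs f
  ∑-*ˡ []       c f = sym (zeroʳ c)
  ∑-*ˡ (x ∷ xs) c f = trans (+-congˡ (∑-*ˡ xs c f)) (sym (distribˡ c _ _))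

  ∑-*ʳ : ∀ (xs : List A) c f → ∑ xs (λ x → f x * c) ≈ ∑ xs f * c
  ∑-*ʳ xs c f = trans (∑-cong xs (λ x → *-comm (f x) c)) (trans (∑-*ˡ xs c f) (*-comm c _))

  ∑-swap : ∀ (xs : List A) (ys : List B) (f : A → B → Carrier) →
    ∑ xs (λ x → ∑ ys (f x)) ≈ ∑ ys (λ y → ∑ xs (λ x → f x y))
  ∑-swap []       ys f = sym (∑-0 ys)
  ∑-swap (x ∷ xs) ys f = trans (+-congˡ (∑-swap xs ys f)) (sym (∑-+ ys (f x) _))

  ∑-++ : ∀ (xs ys : List A) f → ∑ (xs ++ ys) f ≈ ∑ xs f + ∑ ys f
  ∑-++ []       ys f = sym (+-identityˡ _)
  ∑-++ (x ∷ xs) ys f = trans (+-congˡ (∑-++ xs ys f)) (sym (+-assoc _ _ _))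

  ∑-map : ∀ (g : A → B) xs f → ∑ (map g xs) f ≈ ∑ xs (λ x → f (g x))
  ∑-map g []       f = refl
  ∑-map g (x ∷ xs) f = +-congˡ (∑-map g xs f)

  ∑-cartesianProductWith : ∀ {d} {D : Set d} (g : A → B → D) xs ys f →
    ∑ (cartesianProductWith g xs ys) f ≈ ∑ xs (λ x → ∑ ys (λ y → f (g x y)))
  ∑-cartesianProductWith g []       ys f = refl
  ∑-cartesianProductWith g (x ∷ xs) ys f =
    trans (∑-++ (map (g x) ys) _ f) (+-cong (∑-map (g x) ys f) (∑-cartesianProductWith g xs ys f))

  ∑-filter : ∀ {p} {P : Pred A p} (P? : Decidable P) xs f →
    ∑ (filter P? xs) f ≈ ∑ xs (λ x → if does (P? x) then f x else 0#)
  ∑-filter P? []       f = refl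
  ∑-filter P? (x ∷ xs) f with does (P? x)
  ... | true  = +-congˡ (∑-filter P? xs f)
  ... | false = trans (∑-filter P? xs f) (sym (+-identityˡ _))

  ∑-cong-∈ : ∀ (xs : List A) {f g} → (∀ x → x ∈ xs → f x ≈ g x) → ∑ xs f ≈ ∑ xs g
  ∑-cong-∈ []       f≈g = refl
  ∑-cong-∈ (x ∷ xs) f≈g = +-cong (f≈g x (here ≡.refl)) (∑-cong-∈ xs (λ y y∈ → f≈g y (there y∈)))

  if-cong : ∀ (b : Bool) {x y} → x ≈ y → (if b then x else 0#) ≈ (if b then y else 0#)
  if-cong true  x≈y = x≈y
  if-cong false _   = refl

  if-*ʳ : ∀ (b : Bool) x y → (if b then x else 0#) * y ≈ (if b then x * y else 0#)
  if-*ʳ true  x y = refl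
  if-*ʳ false x y = zeroˡ y

  if-*ˡ : ∀ (b : Bool) x y → y * (if b then x else 0#) ≈ (if b then y * x else 0#)
  if-*ˡ true  x y = refl
  if-*ˡ false x y = zeroʳ y

  if-∑ : ∀ (b : Bool) (xs : List A) f →
    (if b then ∑ xs f else 0#) ≈ ∑ xs (λ x → if b then f x else 0#)
  if-∑ true  xs f = refl
  if-∑ false xs f = sym (∑-0 xs)

  if-∧ : ∀ (b b′ : Bool) x → (if b then (if b′ then x else 0#) else 0#) ≡ (if b ∧ b′ then x else 0#)
  if-∧ true  b′ x = ≡.refl
  if-∧ false b′ x = ≡.refl

  ∑-if-≢ : ∀ (_≟_ : DecidableEquality A) (x : A) (xs : List A) (f : A → Carrier) → All.All (x ≢_) xs →
    ∑ xs (λ y → if does (x ≟ y) then f y else 0#) ≈ 0#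
  ∑-if-≢ _≟_ x []       f [] = refl
  ∑-if-≢ _≟_ x (y ∷ ys) f (x≢y ∷ x∉ys) rewrite dec-false (x ≟ y) x≢y =
    trans (+-identityˡ _) (∑-if-≢ _≟_ x ys f x∉ys)

  ∑-if-≡ : ∀ (_≟_ : DecidableEquality A) (x : A) (xs : List A) (f : A → Carrier) → Unique xs → x ∈ xs →
    ∑ xs (λ y → if does (x ≟ y) then f y else 0#) ≈ f x
  ∑-if-≡ _≟_ x (.x ∷ xs) f (x∉xs ∷ _) (here ≡.refl) rewrite dec-true (x ≟ x) ≡.refl =
    trans (+-congˡ (∑-if-≢ _≟_ x xs f x∉xs)) (+-identityʳ _)
  ∑-if-≡ _≟_ x (y ∷ ys) f (y∉ys ∷ uniq) (there x∈ys)
    rewrite dec-false (x ≟ y) (λ x≡y → All.lookup y∉ys x∈ys (≡.sym x≡y)) =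
    trans (+-identityˡ _) (∑-if-≡ _≟_ x ys f uniq x∈ys)

  ∑-subsets-suc : ∀ n (f : Subset (suc n) → Carrier) →
    ∑ (subsets (suc n)) f ≈ ∑ (subsets n) (λ C → f (outside ∷ C)) + ∑ (subsets n) (λ C → f (inside ∷ C))
  ∑-subsets-suc n f =
    trans (∑-cartesianProductWith _∷_ (outside ∷ inside ∷ []) (subsets n) f) (+-congˡ (+-identityʳ _))

-- Binomial coefficients, powers and integer logarithms.

module Arithmetic where
  open import Data.Nat.Base
  open import Data.Nat.Properties hiding (_≟_)
  open import Data.Nat.Combinatorics using (_C_; nC1≡n; nCk+nC[k+1]≡[n+1]C[k+1]; nCk≡nC[n∸k]; nCn≡1)
  open import Data.Nat.Solver using (module +-*-Solver)
  open import Data.Product.Base using (∃-syntax; _×_; _,_)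
  open import Relation.Binary.PropositionalEquality
  open import Relation.Nullary.Decidable using (yes; no)
  open import Relation.Nullary.Negation using (contradiction)
  open +-*-Solver using (solve; _:=_; _:+_; _:*_; con)

  nC0≡1 : ∀ n → n C 0 ≡ 1
  nC0≡1 n = trans (nCk≡nC[n∸k] {0} {n} z≤n) (nCn≡1 n)

  pascal : ∀ n k → suc n C suc k ≡ n C k + n C suc k
  pascal n k = sym (nCk+nC[k+1]≡[n+1]C[k+1] n k)

  -- The recurrence `(k + 1) C(n, k + 1) = (n - k) C(n, k)` with the subtracted term moved to the
  -- left, which makes it valid for all `k`.
  C-absorb : ∀ n k → (n C suc k) * suc k + (n C k) * k ≡ (n C k) * n
  C-absorb zero    zero    = refl
  C-absorb zero    (suc k) = refl
  C-absorb (suc n) zero    rewrite nC1≡n (suc n) | nC0≡1 (suc n) =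
    solve 1 (λ n → (con 1 :+ n) :* con 1 :+ con 0 := con 1 :+ n :+ con 0) refl n
  C-absorb (suc n) (suc k) rewrite pascal n (suc k) | pascal n k = begin-equality
    (b + c) * suc (suc k) + (a + b) * suc k
      ≡⟨ solve 4 (λ a b c k → (b :+ c) :* (con 2 :+ k) :+ (a :+ b) :* (con 1 :+ k)
             := (c :* (con 2 :+ k) :+ b :* (con 1 :+ k)) :+ (b :* (con 1 :+ k) :+ a :* k) :+ (a :+ b)) refl a b c k ⟩
    (c * suc (suc k) + b * suc k) + (b * suc k + a * k) + (a + b)
      ≡⟨ cong₂ (λ x y → x + y + (a + b)) (C-absorb n (suc k)) (C-absorb n k) ⟩
    b * n + a * n + (a + b)
      ≡⟨ solve 3 (λ a b n → b :* n :+ a :* n :+ (a :+ b) := (a :+ b) :* (con 1 :+ n)) refl a b n ⟩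
    (a + b) * suc n ∎
    where
    open ≤-Reasoning
    a = n C k
    b = n C suc k
    c = n C suc (suc k)

  C-suc-≤ : ∀ n k → n C suc k ≤ n * (n C k)
  C-suc-≤ n k = begin
    n C suc k                           ≤⟨ m≤m*n (n C suc k) (suc k) ⟩
    (n C suc k) * suc k                 ≤⟨ m≤m+n _ ((n C k) * k) ⟩
    (n C suc k) * suc k + (n C k) * k   ≡⟨ C-absorb n k ⟩
    (n C k) * n                         ≡⟨ *-comm (n C k) n ⟩
    n * (n C k)                         ∎
    where open ≤-Reasoning

  C≤^ : ∀ n k → n C k ≤ n ^ k
  C≤^ n zero    = ≤-reflexive (nC0≡1 n)
  C≤^ n (suc k) = ≤-trans (C-suc-≤ n k) (*-monoʳ-≤ n (C≤^ n k))

  C-monoˡ-≤ : ∀ k {m n} → m ≤ n → m C k ≤ n C k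
  C-monoˡ-≤ zero    {m} {n} m≤n = ≤-reflexive (trans (nC0≡1 m) (sym (nC0≡1 n)))
  C-monoˡ-≤ (suc k) z≤n = z≤n
  C-monoˡ-≤ (suc k) (s≤s {m} {n} m≤n) rewrite pascal m k | pascal n k =
    +-mono-≤ (C-monoˡ-≤ k m≤n) (C-monoˡ-≤ (suc k) m≤n)

  -- Consecutive coefficients have ratio `(p + q - j) / (j + 1)`; for `j < q` the numerator exceeds
  -- `p` and the denominator is at most `q`.
  C-step : ∀ p q j → suc j ≤ q → ((p + q) C j) * p ≤ q * ((p + q) C suc j)
  C-step p q j j<q = +-cancelʳ-≤ (x * q) (x * p) (q * y) (begin
    x * p + x * q       ≡⟨ *-distribˡ-+ x p q ⟨
    x * (p + q)         ≡⟨ C-absorb (p + q) j ⟨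
    y * suc j + x * j   ≤⟨ +-mono-≤ (*-monoʳ-≤ y j<q) (*-monoʳ-≤ x (<⇒≤ j<q)) ⟩
    y * q + x * q       ≡⟨ cong (_+ x * q) (*-comm y q) ⟩
    q * y + x * q       ∎)
    where
    open ≤-Reasoning
    x = (p + q) C j
    y = (p + q) C suc j

  -- The ratio bound iterated `l` times. It makes prescribing `l` vertices of a small clique
  -- expensive, both for overlaps of two cliques and for vertices taken from the planted one.
  C-steps : ∀ p q l j → l + j ≤ q → ((p + q) C j) * p ^ l ≤ q ^ l * ((p + q) C (l + j))
  C-steps p q zero    j l+j≤q = ≤-reflexive (*-comm ((p + q) C j) 1)
  C-steps p q (suc l) j l+j<q = begin
    x * (p * p ^ l)             ≡⟨ solve 3 (λ x p s → x :* (p :* s) := x :* s :* p) refl x p (p ^ l) ⟩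
    x * p ^ l * p               ≤⟨ *-monoˡ-≤ p (C-steps p q l j (<⇒≤ l+j<q)) ⟩
    q ^ l * y * p               ≡⟨ *-assoc (q ^ l) y p ⟩
    q ^ l * (y * p)             ≤⟨ *-monoʳ-≤ (q ^ l) (C-step p q (l + j) l+j<q) ⟩
    q ^ l * (q * z)             ≡⟨ solve 3 (λ s q z → s :* (q :* z) := q :* s :* z) refl (q ^ l) q z ⟩
    q * q ^ l * z               ∎
    where
    open ≤-Reasoning
    x = (p + q) C j
    y = (p + q) C (l + j)
    z = (p + q) C suc (l + j)

  2*nC2 : ∀ n → 2 * (suc n C 2) ≡ suc n * n
  2*nC2 n = begin-equality
    2 * (suc n C 2)                         ≡⟨ *-comm 2 (suc n C 2) ⟩
    (suc n C 2) * 2                         ≡⟨ +-cancelʳ-≡ ((suc n C 1) * 1) _ _ (trans (C-absorb (suc n) 1) (trans (cong (_* suc n) (nC1≡n (suc n)))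
      (trans (solve 1 (λ n → (con 1 :+ n) :* (con 1 :+ n) := (con 1 :+ n) :* n :+ (con 1 :+ n) :* con 1) refl n)
      (cong (λ x → suc n * n + x * 1) (sym (nC1≡n (suc n))))))) ⟩
    suc n * n                               ∎
    where open ≤-Reasoning

  -- A clique on at most `2h + 1` vertices has at most `h` edges per vertex, so `2 ^ (l choose 2)`
  -- is dominated by the `l`-th power of `2 ^ h` and can be compared with other `l`-th powers.
  nC2≤n*h : ∀ n h → n ≤ suc (2 * h) → n C 2 ≤ n * h
  nC2≤n*h zero    h _ = z≤n
  nC2≤n*h (suc n) h (s≤s n≤2h) = *-cancelˡ-≤ 2 (begin
    2 * (suc n C 2)   ≡⟨ 2*nC2 n ⟩
    suc n * n         ≤⟨ *-monoʳ-≤ (suc n) n≤2h ⟩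
    suc n * (2 * h)   ≡⟨ solve 2 (λ n h → n :* (con 2 :* h) := con 2 :* (n :* h)) refl (suc n) h ⟩
    2 * (suc n * h)   ∎)
    where open ≤-Reasoning

  [1+2h]C2 : ∀ h → suc (2 * h) C 2 ≡ suc (2 * h) * h
  [1+2h]C2 h = *-cancelˡ-≡ _ _ 2 (trans (2*nC2 (2 * h))
    (solve 1 (λ h → (con 1 :+ con 2 :* h) :* (con 2 :* h) := con 2 :* ((con 1 :+ con 2 :* h) :* h)) refl h))

  nC2≤n*n : ∀ n → n C 2 ≤ n * n
  nC2≤n*n n = nC2≤n*h n n (≤-trans (m≤n*m n 2) (n≤1+n _))

  ^-cancelʳ-≤ : ∀ d m n → .{{_ : NonZero d}} → m ^ d ≤ n ^ d → m ≤ n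
  ^-cancelʳ-≤ d m n mᵈ≤nᵈ with m ≤? n
  ... | yes m≤n = m≤n
  ... | no  m≰n = contradiction (^-monoˡ-< d (≰⇒> m≰n)) (≤⇒≯ mᵈ≤nᵈ)

  ^-distribʳ-* : ∀ m n o → (m * n) ^ o ≡ m ^ o * n ^ o
  ^-distribʳ-* m n zero    = refl
  ^-distribʳ-* m n (suc o) = trans (cong (m * n *_) (^-distribʳ-* m n o))
    (solve 4 (λ m n x y → m :* n :* (x :* y) := m :* x :* (n :* y)) refl m n (m ^ o) (n ^ o))

  2^≢0 : ∀ n → NonZero (2 ^ n)
  2^≢0 n = m^n≢0 2 n

  n<2^n : ∀ n → n < 2 ^ n
  n<2^n zero    = s≤s z≤n
  n<2^n (suc n) = begin-strict
    suc n             ≤⟨ n<2^n n ⟩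
    2 ^ n             <⟨ m<m+n (2 ^ n) (m^n>0 2 n) ⟩
    2 ^ n + 2 ^ n     ≡⟨ cong (2 ^ n +_) (+-identityʳ (2 ^ n)) ⟨
    2 ^ suc n         ∎
    where open ≤-Reasoning

  floor-log : ∀ b → 1 < b → ∀ n → .{{NonZero n}} → ∃[ e ] b ^ e ≤ n × n < b ^ suc e
  floor-log b 1<b (suc zero) = 0 , ≤-refl , subst (1 <_) (sym (*-identityʳ b)) 1<b
  floor-log b 1<b (suc (suc n)) with floor-log b 1<b (suc n)
  ... | e , lo , hi with suc (suc n) <? b ^ suc e
  ... | yes hi′ = e , ≤-trans lo (n≤1+n _) , hi′
  ... | no  ¬hi = suc e , ≮⇒≥ ¬hi ,
    (begin-strict
      suc (suc n)      ≤⟨ hi ⟩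
      b ^ suc e        <⟨ m<m*n (b ^ suc e) b 1<b ⟩
      b ^ suc e * b    ≡⟨ *-comm (b ^ suc e) b ⟩
      b * b ^ suc e    ∎)
    where
    open ≤-Reasoning
    instance
      b^≢0 : NonZero (b ^ suc e)
      b^≢0 = m^n≢0 b (suc e) {{>-nonZero (<-trans z<s 1<b)}}

  floor-log-≥ : ∀ b {e₀ e n} → .{{NonZero b}} → b ^ e₀ ≤ n → n < b ^ suc e → e₀ ≤ e
  floor-log-≥ b {e₀} {e} lo hi with e₀ ≤? e
  ... | yes e₀≤e = e₀≤e
  ... | no  e₀≰e = contradiction (<-≤-trans hi (≤-trans (^-monoʳ-≤ b (≰⇒> e₀≰e)) lo)) (<-irrefl refl)

  -- With 2ᵃ ≤ n < 2ᵃ⁺¹ it suffices that j (a + 1) ≤ 2ᵃ.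
  n^j≤2^n : ∀ j → ∃[ n₀ ] ∀ n → n₀ ≤ n → n ^ j ≤ 2 ^ n
  n^j≤2^n j = 2 ^ a₀ , λ n n₀≤n → bound n n₀≤n {{>-nonZero (≤-trans (m^n>0 2 a₀) n₀≤n)}}
    where
    open ≤-Reasoning
    a₀ = suc j + suc j

    step : ∀ d → j * suc (d + a₀) ≤ 2 ^ (d + a₀)
    step zero = begin
      j * suc (suc j + suc j)       ≤⟨ m≤m+n _ (j + 4) ⟩
      j * suc (suc j + suc j) + (j + 4) ≡⟨ solve 1 (λ j → j :* (con 1 :+ ((con 1 :+ j) :+ (con 1 :+ j))) :+ (j :+ con 4) := con 2 :* ((con 1 :+ j) :* (con 1 :+ j)) :+ con 2) refl j ⟩
      2 * (suc j * suc j) + 2       ≤⟨ +-monoʳ-≤ (2 * (suc j * suc j)) (*-monoʳ-≤ 2 (m≤m*n 1 (suc j * suc j))) ⟩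
      2 * (suc j * suc j) + 2 * (1 * (suc j * suc j)) ≡⟨ solve 1 (λ x → con 2 :* (x :* x) :+ con 2 :* (con 1 :* (x :* x)) := (con 2 :* x) :* (con 2 :* x)) refl (suc j) ⟩
      (2 * suc j) * (2 * suc j)     ≤⟨ *-mono-≤ lem lem ⟩
      2 ^ suc j * 2 ^ suc j         ≡⟨ ^-distribˡ-+-* 2 (suc j) (suc j) ⟨
      2 ^ (suc j + suc j)           ∎
      where
      lem : 2 * suc j ≤ 2 ^ suc j
      lem = *-monoʳ-≤ 2 (n<2^n j)
    step (suc d) = begin
      j * suc (suc (d + a₀))                    ≤⟨ *-monoʳ-≤ j (s≤s (m≤m+n (suc (d + a₀)) (d + a₀))) ⟩
      j * suc (suc (d + a₀) + (d + a₀))         ≡⟨ solve 2 (λ j x → j :* (con 1 :+ (con 1 :+ x :+ x)) := con 2 :* (j :* (con 1 :+ x))) refl j (d + a₀) ⟩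
      2 * (j * suc (d + a₀))                    ≤⟨ *-monoʳ-≤ 2 (step d) ⟩
      2 ^ suc (d + a₀)                          ∎

    bound : ∀ n → 2 ^ a₀ ≤ n → .{{NonZero n}} → n ^ j ≤ 2 ^ n
    bound n n₀≤n with floor-log 2 ≤-refl n
    ... | a , lo , hi = begin
      n ^ j               ≤⟨ ^-monoˡ-≤ j (<⇒≤ hi) ⟩
      (2 ^ suc a) ^ j     ≡⟨ ^-*-assoc 2 (suc a) j ⟩
      2 ^ (suc a * j)     ≡⟨ cong (2 ^_) (*-comm (suc a) j) ⟩
      2 ^ (j * suc a)     ≤⟨ ^-monoʳ-≤ 2 (subst (λ a → j * suc a ≤ 2 ^ a) (m∸n+n≡m (floor-log-≥ 2 n₀≤n hi)) (step (a ∸ a₀))) ⟩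
      2 ^ (2 ^ a)         ≤⟨ ^-monoʳ-≤ 2 lo ⟩
      2 ^ n               ∎

-- Cliques as contained subgraphs, and the number of graphs containing them.

module CliqueCount where
  open Arithmetic
  open ListSum ℕ.+-*-commutativeSemiring
  open import Data.Bool.Base using (Bool; true; false; if_then_else_; _∧_; T)
  import Data.Fin.Properties as Fin
  open import Data.Fin.Base using (Fin; zero; suc)
  open import Data.Fin.Subset
  open import Data.Fin.Subset.Properties
  open import Data.List.Base using (List; []; _∷_)
  open import Data.Nat.Base
  open import Data.Nat.Properties hiding (_≟_)
  open import Data.Nat.Combinatorics using (nC1≡n) renaming (_C_ to infixl 8 _choose_)
  open import Data.Nat.Solver using (module +-*-Solver)
  open import Data.Product.Base using (_×_; _,_; ∃-syntax; proj₁; proj₂)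
  open import Data.Sum.Base using (inj₁; inj₂)
  open import Data.Unit.Base using (tt) renaming (⊤ to Unit)
  open import Data.Vec.Base using ([]; _∷_; here; there)
  open import Function.Base using (_∘_; id)
  open import Function.Bundles using (_⇔_; mk⇔; module Equivalence)
  open import Relation.Binary.PropositionalEquality
  open import Relation.Nullary.Decidable using (Dec; yes; no; does; _×-dec_; does-⇔)
  open import Relation.Nullary.Negation using (contradiction; ¬_)
  open import Data.Empty using (⊥-elim)
  open import Data.Fin.Base as Fin using (Fin)
  open import Data.Nat.Properties
  open +-*-Solver using (solve; _:=_; _:+_; _:*_; con)

  𝟙 : Bool → ℕ
  𝟙 b = if b then 1 else 0

  𝟙-∧ : ∀ b b′ → 𝟙 (b ∧ b′) ≡ 𝟙 b * 𝟙 b′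
  𝟙-∧ true  b′ = sym (+-identityʳ _)
  𝟙-∧ false b′ = refl

  ∑-mono : ∀ {a} {A : Set a} (xs : List A) {f g : A → ℕ} → (∀ x → f x ≤ g x) → ∑ xs f ≤ ∑ xs g
  ∑-mono []       f≤g = z≤n
  ∑-mono (x ∷ xs) f≤g = +-mono-≤ (f≤g x) (∑-mono xs f≤g)

  count-⊆ : ∀ {n} (A : Subset n) → ∑ (subsets n) (λ N → 𝟙 (does (A ⊆? N))) * 2 ^ ∣ A ∣ ≡ 2 ^ n
  count-⊆ [] = refl
  count-⊆ {suc n} (outside ∷ A) = begin
    ∑ (subsets (suc n)) (λ N → 𝟙 (does ((outside ∷ A) ⊆? N))) * 2 ^ ∣ A ∣
      ≡⟨ cong (_* 2 ^ ∣ A ∣) (∑-subsets-suc n _) ⟩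
    (c + c) * 2 ^ ∣ A ∣
      ≡⟨ solve 2 (λ c p → (c :+ c) :* p := con 2 :* (c :* p)) refl c (2 ^ ∣ A ∣) ⟩
    2 * (c * 2 ^ ∣ A ∣)
      ≡⟨ cong (2 *_) (count-⊆ A) ⟩
    2 ^ suc n ∎
    where
    open ≡-Reasoning
    c = ∑ (subsets n) (λ N → 𝟙 (does (A ⊆? N)))
  count-⊆ {suc n} (inside ∷ A) = begin
    ∑ (subsets (suc n)) (λ N → 𝟙 (does ((inside ∷ A) ⊆? N))) * (2 * 2 ^ ∣ A ∣)
      ≡⟨ cong (_* (2 * 2 ^ ∣ A ∣)) (trans (∑-subsets-suc n _) (cong (_+ c) (∑-0 (subsets n)))) ⟩
    c * (2 * 2 ^ ∣ A ∣)
      ≡⟨ solve 2 (λ c p → c :* (con 2 :* p) := con 2 :* (c :* p)) refl c (2 ^ ∣ A ∣) ⟩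
    2 * (c * 2 ^ ∣ A ∣)
      ≡⟨ cong (2 *_) (count-⊆ A) ⟩
    2 ^ suc n ∎
    where
    open ≡-Reasoning
    c = ∑ (subsets n) (λ N → 𝟙 (does (A ⊆? N)))

  _⊑_ : ∀ {n} → Graph n → Graph n → Set
  []      ⊑ []      = Unit
  (N ∷ H) ⊑ (M ∷ G) = N ⊆ M × H ⊑ G

  _⊑?_ : ∀ {n} (H G : Graph n) → Dec (H ⊑ G)
  []      ⊑? []      = yes tt
  (N ∷ H) ⊑? (M ∷ G) = (N ⊆? M) ×-dec (H ⊑? G)

  zipᴳ : (∀ {n} → Subset n → Subset n → Subset n) → ∀ {n} → Graph n → Graph n → Graph n
  zipᴳ _∙_ []      []      = []
  zipᴳ _∙_ (N ∷ G) (M ∷ H) = (N ∙ M) ∷ zipᴳ _∙_ G H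

  _∪ᴳ_ _∩ᴳ_ _─ᴳ_ : ∀ {n} → Graph n → Graph n → Graph n
  _∪ᴳ_ = zipᴳ _∪_
  _∩ᴳ_ = zipᴳ _∩_
  _─ᴳ_ = zipᴳ _─_

  edges : ∀ {n} → Graph n → ℕ
  edges []      = 0
  edges (N ∷ G) = ∣ N ∣ + edges G

  complete : ∀ {n} → Subset n → Graph n
  complete []      = []
  complete (s ∷ S) = (if s then S else ⊥) ∷ complete S

  #graphs : ℕ → ℕ
  #graphs n = ∑ (graphs n) (λ _ → 1)

  -- The rows of a uniform graph are independent uniform subsets, so `H` is contained in it with
  -- probability `2^(- edges H)`; the denominators are multiplied out.
  count-⊑ : ∀ {n} (H : Graph n) → ∑ (graphs n) (λ G → 𝟙 (does (H ⊑? G))) * 2 ^ edges H ≡ #graphs n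
  count-⊑ [] = refl
  count-⊑ {suc n} (N ∷ H) = begin
    ∑ (graphs (suc n)) (λ G → 𝟙 (does ((N ∷ H) ⊑? G))) * 2 ^ (∣ N ∣ + edges H)
      ≡⟨ cong₂ _*_ (trans (∑-cartesianProductWith _∷_ (subsets n) (graphs n) _)
          (∑-cong (subsets n) (λ M → trans (∑-cong (graphs n) (λ G → 𝟙-∧ (does (N ⊆? M)) _)) (∑-*ˡ (graphs n) (𝟙 (does (N ⊆? M))) _))))
          (^-distribˡ-+-* 2 ∣ N ∣ (edges H)) ⟩
    ∑ (subsets n) (λ M → 𝟙 (does (N ⊆? M)) * h) * (2 ^ ∣ N ∣ * 2 ^ edges H)
      ≡⟨ cong (_* (2 ^ ∣ N ∣ * 2 ^ edges H)) (∑-*ʳ (subsets n) h _) ⟩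
    s * h * (2 ^ ∣ N ∣ * 2 ^ edges H)
      ≡⟨ solve 4 (λ s h p q → s :* h :* (p :* q) := (s :* p) :* (h :* q)) refl s h (2 ^ ∣ N ∣) (2 ^ edges H) ⟩
    (s * 2 ^ ∣ N ∣) * (h * 2 ^ edges H)
      -- `2 ^ n` is recognised as the number of subsets by applying `count-⊆` to the empty set.
      ≡⟨ cong₂ _*_ (trans (count-⊆ N) (sym (trans (cong (∑ (subsets n) (λ M → 𝟙 (does (⊥ ⊆? M))) *_) (cong (2 ^_) (sym (∣⊥∣≡0 n)))) (count-⊆ (⊥ {n}))))) (count-⊑ H) ⟩
    (∑ (subsets n) (λ M → 𝟙 (does (⊥ ⊆? M))) * 1) * #graphs n
      ≡⟨ cong (_* #graphs n) (trans (*-identityʳ _) (∑-cong (subsets n) (λ M → cong 𝟙 (⊥⊆? M)))) ⟩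
    ∑ (subsets n) (λ _ → 1) * #graphs n
      ≡⟨ ∑-*ʳ (subsets n) (#graphs n) _ ⟨
    ∑ (subsets n) (λ _ → 1 * #graphs n)
      ≡⟨ ∑-cong (subsets n) (λ _ → +-identityʳ _) ⟩
    ∑ (subsets n) (λ _ → #graphs n)
      ≡⟨ ∑-cartesianProductWith _∷_ (subsets n) (graphs n) _ ⟨
    #graphs (suc n) ∎
    where
    open ≡-Reasoning
    s = ∑ (subsets n) (λ M → 𝟙 (does (N ⊆? M)))
    h = ∑ (graphs n) (λ G → 𝟙 (does (H ⊑? G)))
    ⊥⊆? : ∀ {n} (M : Subset n) → does (⊥ ⊆? M) ≡ true
    ⊥⊆? []      = refl
    ⊥⊆? (_ ∷ M) = ⊥⊆? M

  ∣p∪q∣+∣p∩q∣ : ∀ {n} (p q : Subset n) → ∣ p ∪ q ∣ + ∣ p ∩ q ∣ ≡ ∣ p ∣ + ∣ q ∣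
  ∣p∪q∣+∣p∩q∣ [] [] = refl
  ∣p∪q∣+∣p∩q∣ (inside  ∷ p) (inside  ∷ q) = cong suc (trans (+-suc _ _) (trans (cong suc (∣p∪q∣+∣p∩q∣ p q)) (sym (+-suc _ _))))
  ∣p∪q∣+∣p∩q∣ (inside  ∷ p) (outside ∷ q) = cong suc (∣p∪q∣+∣p∩q∣ p q)
  ∣p∪q∣+∣p∩q∣ (outside ∷ p) (inside  ∷ q) = trans (cong suc (∣p∪q∣+∣p∩q∣ p q)) (sym (+-suc _ _))
  ∣p∪q∣+∣p∩q∣ (outside ∷ p) (outside ∷ q) = ∣p∪q∣+∣p∩q∣ p q

  ∣p─q∣+∣p∩q∣ : ∀ {n} (p q : Subset n) → ∣ p ─ q ∣ + ∣ p ∩ q ∣ ≡ ∣ p ∣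
  ∣p─q∣+∣p∩q∣ [] [] = refl
  ∣p─q∣+∣p∩q∣ (inside  ∷ p) (inside  ∷ q) = trans (+-suc _ _) (cong suc (∣p─q∣+∣p∩q∣ p q))
  ∣p─q∣+∣p∩q∣ (inside  ∷ p) (outside ∷ q) = cong suc (∣p─q∣+∣p∩q∣ p q)
  ∣p─q∣+∣p∩q∣ (outside ∷ p) (inside  ∷ q) = ∣p─q∣+∣p∩q∣ p q
  ∣p─q∣+∣p∩q∣ (outside ∷ p) (outside ∷ q) = ∣p─q∣+∣p∩q∣ p q

  edges-∪+∩ : ∀ {n} (G H : Graph n) → edges (G ∪ᴳ H) + edges (G ∩ᴳ H) ≡ edges G + edges H
  edges-∪+∩ [] [] = refl
  edges-∪+∩ (N ∷ G) (M ∷ H) = trans (+-interchange (∣ N ∪ M ∣) (edges (G ∪ᴳ H)) (∣ N ∩ M ∣) (edges (G ∩ᴳ H)))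
    (trans (cong₂ _+_ (∣p∪q∣+∣p∩q∣ N M) (edges-∪+∩ G H)) (+-interchange (∣ N ∣) (∣ M ∣) (edges G) (edges H)))

  edges-─+∩ : ∀ {n} (G H : Graph n) → edges (G ─ᴳ H) + edges (G ∩ᴳ H) ≡ edges G
  edges-─+∩ [] [] = refl
  edges-─+∩ (N ∷ G) (M ∷ H) = trans (+-interchange (∣ N ─ M ∣) (edges (G ─ᴳ H)) (∣ N ∩ M ∣) (edges (G ∩ᴳ H)))
    (cong₂ _+_ (∣p─q∣+∣p∩q∣ N M) (edges-─+∩ G H))

  edges-complete : ∀ {n} (S : Subset n) → edges (complete S) ≡ ∣ S ∣ choose 2
  edges-complete [] = refl
  edges-complete (inside ∷ S) =
    sym (trans (pascal ∣ S ∣ 1) (cong₂ _+_ (nC1≡n ∣ S ∣) (sym (edges-complete S))))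
  edges-complete {suc n} (outside ∷ S) = cong₂ _+_ (∣⊥∣≡0 n) (edges-complete S)

  complete-∩ : ∀ {n} (S S′ : Subset n) → complete S ∩ᴳ complete S′ ≡ complete (S ∩ S′)
  complete-∩ [] [] = refl
  complete-∩ (inside  ∷ S) (inside  ∷ S′) = cong ((S ∩ S′) ∷_) (complete-∩ S S′)
  complete-∩ (inside  ∷ S) (outside ∷ S′) = cong₂ _∷_ (∩-zeroʳ S) (complete-∩ S S′)
  complete-∩ (outside ∷ S) (s       ∷ S′) = cong₂ _∷_ (∩-zeroˡ _) (complete-∩ S S′)

  plant≡∪complete : ∀ {n} (G : Graph n) S → plant G S ≡ G ∪ᴳ complete S
  plant≡∪complete []      []            = refl
  plant≡∪complete (N ∷ G) (inside  ∷ S) = cong (_ ∷_) (plant≡∪complete G S)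
  plant≡∪complete (N ∷ G) (outside ∷ S) = cong₂ _∷_ (sym (∪-identityʳ N)) (plant≡∪complete G S)

  p─r⊆q⇔p⊆q∪r : ∀ {n} (p q r : Subset n) → p ─ r ⊆ q ⇔ p ⊆ q ∪ r
  p─r⊆q⇔p⊆q∪r p q r = mk⇔ to from
    where
    to : p ─ r ⊆ q → p ⊆ q ∪ r
    to ⊆q {x} x∈p with x ∈? r
    ... | yes x∈r = x∈p∪q⁺ (inj₂ x∈r)
    ... | no  x∉r = x∈p∪q⁺ (inj₁ (⊆q (x∈p∧x∉q⇒x∈p─q x∈p x∉r)))
    from : p ⊆ q ∪ r → p ─ r ⊆ q
    from ⊆q∪r {x} x∈p─r with x∈p∪q⁻ q r (⊆q∪r (p─q⊆p p r x∈p─r))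
    ... | inj₁ x∈q = x∈q
    ... | inj₂ x∈r = contradiction (x∈r) (x∈p─q⇒x∉q p r x∈p─r)
      where
      x∈p─q⇒x∉q : ∀ {n} {x : Fin n} (p q : Subset n) → x ∈ p ─ q → x ∉ q
      x∈p─q⇒x∉q (_ ∷ p) (outside ∷ q) (there x∈) (there x∈q) = x∈p─q⇒x∉q p q x∈ x∈q
      x∈p─q⇒x∉q (_ ∷ p) (inside  ∷ q) (there x∈) (there x∈q) = x∈p─q⇒x∉q p q x∈ x∈q

  -- Deleting `K` is left adjoint to adding it. This moves the planted edges from the random graph
  -- to the pattern sought in it, so that the random graph remains uniform.
  ─⊑⇔⊑∪ : ∀ {n} (H G K : Graph n) → (H ─ᴳ K) ⊑ G ⇔ H ⊑ (G ∪ᴳ K)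
  ─⊑⇔⊑∪ [] [] [] = mk⇔ id id
  ─⊑⇔⊑∪ (N ∷ H) (M ∷ G) (L ∷ K) = mk⇔
    (λ (N⊆ , H⊑) → Equivalence.to (p─r⊆q⇔p⊆q∪r N M L) N⊆ , Equivalence.to (─⊑⇔⊑∪ H G K) H⊑)
    (λ (N⊆ , H⊑) → Equivalence.from (p─r⊆q⇔p⊆q∪r N M L) N⊆ , Equivalence.from (─⊑⇔⊑∪ H G K) H⊑)

  isClique⇔complete⊑ : ∀ {n} (G : Graph n) C → IsClique G C ⇔ complete C ⊑ G
  isClique⇔complete⊑ G C = mk⇔ (to G C) (from G C)
    where
    to : ∀ {n} (G : Graph n) C → IsClique G C → complete C ⊑ G
    to []      []            _  = tt
    to (N ∷ G) (inside ∷ C)  cl =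
      (λ {x} x∈C → cl zero (suc x) here (there x∈C) λ ()) ,
      to G C (λ u v u∈ v∈ u≢v → cl (suc u) (suc v) (there u∈) (there v∈) (u≢v ∘ Fin.suc-injective))
    to (N ∷ G) (outside ∷ C) cl =
      (λ x∈⊥ → contradiction x∈⊥ ∉⊥) ,
      to G C (λ u v u∈ v∈ u≢v → cl (suc u) (suc v) (there u∈) (there v∈) (u≢v ∘ Fin.suc-injective))
    from : ∀ {n} (G : Graph n) C → complete C ⊑ G → IsClique G C
    from (N ∷ G) (s ∷ C) (C⊆N , ⊑G) zero    zero    _ _ u≢u = contradiction refl u≢u
    from (N ∷ G) (.inside ∷ C) (C⊆N , ⊑G) zero    (suc v) here (there v∈) _ = C⊆N v∈
    from (N ∷ G) (.inside ∷ C) (C⊆N , ⊑G) (suc u) zero    (there u∈) here _ = C⊆N u∈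
    from (N ∷ G) (s ∷ C) (C⊆N , ⊑G) (suc u) (suc v) (there u∈) (there v∈) u≢v =
      from G C ⊑G u v u∈ v∈ (u≢v ∘ cong suc)

  -- The edges that `C` still needs from the unplanted graph once `S` has been planted. Being a
  -- clique after planting becomes containment of this fixed graph.
  required : ∀ {n} → Subset n → Subset n → Graph n
  required S C = complete C ─ᴳ complete S

  does-isClique-plant : ∀ {n} (G : Graph n) S C →
    does (isClique? (plant G S) C) ≡ does (required S C ⊑? G)
  does-isClique-plant G S C = does-⇔ (mk⇔
    (λ cl → Equivalence.from (─⊑⇔⊑∪ _ G _) (subst (complete C ⊑_) (plant≡∪complete G S) (Equivalence.to (isClique⇔complete⊑ _ C) cl)))
    (λ ⊑G → Equivalence.from (isClique⇔complete⊑ _ C) (subst (complete C ⊑_) (sym (plant≡∪complete G S)) (Equivalence.to (─⊑⇔⊑∪ _ G _) ⊑G))))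
    (isClique? (plant G S) C) (required S C ⊑? G)

  edges-required : ∀ {n} (S C : Subset n) → edges (required S C) + (∣ C ∩ S ∣ choose 2) ≡ ∣ C ∣ choose 2
  edges-required S C = trans (cong (edges (required S C) +_)
    (trans (sym (edges-complete (C ∩ S))) (cong edges (sym (complete-∩ C S)))))
    (trans (edges-─+∩ (complete C) (complete S)) (edges-complete C))

  ⊑-edges : ∀ {n} (H G : Graph n) → H ⊑ G → edges H ≤ edges G
  ⊑-edges [] [] _ = z≤n
  ⊑-edges (N ∷ H) (M ∷ G) (N⊆M , H⊑G) = +-mono-≤ (p⊆q⇒∣p∣≤∣q∣ N⊆M) (⊑-edges H G H⊑G)

  ─∩─⊑∩ : ∀ {n} (G H K : Graph n) → ((G ─ᴳ K) ∩ᴳ (H ─ᴳ K)) ⊑ (G ∩ᴳ H)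
  ─∩─⊑∩ [] [] [] = tt
  ─∩─⊑∩ (N ∷ G) (M ∷ H) (L ∷ K) =
    (λ x∈ → let (x∈N , x∈M) = x∈p∩q⁻ (N ─ L) (M ─ L) x∈ in x∈p∩q⁺ (p─q⊆p N L x∈N , p─q⊆p M L x∈M)) ,
    ─∩─⊑∩ G H K

  -- Inclusion and exclusion for edges: an edge required by both cliques joins two vertices of
  -- `C ∩ C′`. An upper bound on the number of shared edges is what the second moment asks for.
  edges-required-∪ : ∀ {n} (S C C′ : Subset n) →
    edges (required S C) + edges (required S C′) ≤ edges (required S C ∪ᴳ required S C′) + (∣ C ∩ C′ ∣ choose 2)
  edges-required-∪ S C C′ = begin
    edges (required S C) + edges (required S C′)
      ≡⟨ edges-∪+∩ (required S C) (required S C′) ⟨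
    edges (required S C ∪ᴳ required S C′) + edges (required S C ∩ᴳ required S C′)
      ≤⟨ +-monoʳ-≤ _ (⊑-edges _ _ (─∩─⊑∩ (complete C) (complete C′) (complete S))) ⟩
    edges (required S C ∪ᴳ required S C′) + edges (complete C ∩ᴳ complete C′)
      ≡⟨ cong (edges (required S C ∪ᴳ required S C′) +_) (trans (cong edges (complete-∩ C C′)) (edges-complete (C ∩ C′))) ⟩
    edges (required S C ∪ᴳ required S C′) + (∣ C ∩ C′ ∣ choose 2) ∎
    where open ≤-Reasoning

  ∪⊑⇔ : ∀ {n} (H K G : Graph n) → (H ∪ᴳ K) ⊑ G ⇔ (H ⊑ G × K ⊑ G)
  ∪⊑⇔ [] [] [] = mk⇔ (λ _ → tt , tt) (λ _ → tt)
  ∪⊑⇔ (N ∷ H) (M ∷ K) (L ∷ G) = mk⇔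
    (λ (⊆L , ⊑G) → let (H⊑ , K⊑) = Equivalence.to (∪⊑⇔ H K G) ⊑G in
      ((λ x∈ → ⊆L (x∈p∪q⁺ (inj₁ x∈))) , H⊑) , ((λ x∈ → ⊆L (x∈p∪q⁺ (inj₂ x∈))) , K⊑))
    (λ ((N⊆ , H⊑) , (M⊆ , K⊑)) →
      (λ x∈ → Data.Sum.Base.[ N⊆ , M⊆ ] (x∈p∪q⁻ N M x∈)) , Equivalence.from (∪⊑⇔ H K G) (H⊑ , K⊑))
    where import Data.Sum.Base

  𝟙-∪⊑ : ∀ {n} (H K G : Graph n) → 𝟙 (does (H ⊑? G)) * 𝟙 (does (K ⊑? G)) ≡ 𝟙 (does ((H ∪ᴳ K) ⊑? G))
  𝟙-∪⊑ H K G = trans (sym (𝟙-∧ (does (H ⊑? G)) _)) (cong 𝟙 (sym (does-⇔ (∪⊑⇔ H K G) ((H ∪ᴳ K) ⊑? G) ((H ⊑? G) ×-dec (K ⊑? G)))))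

  -- Subsets with prescribed traces on given sets.

  #[_] : ∀ {n} → (Subset n → Bool) → ℕ
  #[_] {n} Q = ∑ (subsets n) (λ D → 𝟙 (Q D))

  #-suc : ∀ {n} (Q : Subset (suc n) → Bool) → #[ Q ] ≡ #[ Q ∘ (outside ∷_) ] + #[ Q ∘ (inside ∷_) ]
  #-suc {n} Q = ∑-subsets-suc n (𝟙 ∘ Q)

  #-empty : ∀ {n} (Q : Subset n → Bool) → (∀ D → ¬ T (Q D)) → #[ Q ] ≡ 0
  #-empty {n} Q ¬Q = trans (∑-cong (subsets n) (λ D → zero′ (Q D) (¬Q D))) (∑-0 (subsets n))
    where
    zero′ : ∀ b → ¬ T b → 𝟙 b ≡ 0
    zero′ true  ¬b = ⊥-elim (¬b tt)
    zero′ false _  = refl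

  #-outside : ∀ {n} (Q : Subset (suc n) → Bool) → (∀ D → ¬ T (Q (inside ∷ D))) → #[ Q ] ≡ #[ Q ∘ (outside ∷_) ]
  #-outside Q ¬Q = trans (#-suc Q) (trans (cong (#[ Q ∘ (outside ∷_) ] +_) (#-empty (Q ∘ (inside ∷_)) ¬Q)) (+-identityʳ _))

  -- The predicate `Q` is kept abstract, so that fixing the first vertex leaves a predicate of the
  -- same kind on one vertex fewer and the counting bound can recurse. This is the branch in which
  -- that vertex is left out.
  skip-first : ∀ {n u w l b} {U W : Subset n} (Q : Subset (suc n) → Bool) →
    (∀ D → T (Q D) → ∣ D ∩ (u ∷ U) ∣ ≡ l × ∣ D ∩ (w ∷ W) ∣ ≡ b × D ⊆ (u ∷ U) ∪ (w ∷ W)) →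
    ∀ D → T (Q (outside ∷ D)) → ∣ D ∩ U ∣ ≡ l × ∣ D ∩ W ∣ ≡ b × D ⊆ U ∪ W
  skip-first Q sound D q = let (∣D∩U∣ , ∣D∩W∣ , D⊆) = sound (outside ∷ D) q in ∣D∩U∣ , ∣D∩W∣ , drop-∷-⊆ D⊆

  #-split-≤ : ∀ {n} (U W : Subset n) l b (Q : Subset n → Bool) →
    (∀ D → T (Q D) → ∣ D ∩ U ∣ ≡ l × ∣ D ∩ W ∣ ≡ b × D ⊆ U ∪ W) →
    #[ Q ] ≤ (∣ U ∣ choose l) * (∣ W ∣ choose b)
  #-split-≤ [] [] zero zero Q sound with Q []
  ... | true  = ≤-refl
  ... | false = z≤n
  #-split-≤ [] [] zero (suc b) Q sound = ≤-reflexive (#-empty Q λ { [] q → contradiction (proj₁ (proj₂ (sound [] q))) λ () })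
  #-split-≤ [] [] (suc l) b Q sound = ≤-reflexive (#-empty Q λ { [] q → contradiction (proj₁ (sound [] q)) λ () })
  #-split-≤ (outside ∷ U) (outside ∷ W) l b Q sound = begin
    #[ Q ]
      ≡⟨ #-outside Q (λ D q → case-in (proj₂ (proj₂ (sound (inside ∷ D) q)) here)) ⟩
    #[ Q ∘ (outside ∷_) ]
      ≤⟨ #-split-≤ U W l b (Q ∘ (outside ∷_)) (skip-first Q sound) ⟩
    (∣ U ∣ choose l) * (∣ W ∣ choose b)                 ∎
    where
    open ≤-Reasoning
    case-in : ∀ {n} {p : Subset n} → ¬ (Fin.zero ∈ outside ∷ p)
    case-in ()
  #-split-≤ (inside ∷ U) (outside ∷ W) zero b Q sound = begin
    #[ Q ]
      ≡⟨ #-outside Q (λ D q → contradiction (proj₁ (sound (inside ∷ D) q)) λ ()) ⟩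
    #[ Q ∘ (outside ∷_) ]
      ≤⟨ #-split-≤ U W 0 b (Q ∘ (outside ∷_)) (skip-first Q sound) ⟩
    (∣ U ∣ choose 0) * (∣ W ∣ choose b)
      ≡⟨ cong (_* (∣ W ∣ choose b)) (trans (nC0≡1 ∣ U ∣) (sym (nC0≡1 (suc ∣ U ∣)))) ⟩
    (suc ∣ U ∣ choose 0) * (∣ W ∣ choose b)             ∎
    where open ≤-Reasoning
  #-split-≤ (inside ∷ U) (outside ∷ W) (suc l) b Q sound = begin
    #[ Q ]                                              ≡⟨ #-suc Q ⟩
    #[ Q ∘ (outside ∷_) ] + #[ Q ∘ (inside ∷_) ]
      ≤⟨ +-mono-≤
          (#-split-≤ U W (suc l) b (Q ∘ (outside ∷_)) (skip-first Q sound))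
          (#-split-≤ U W l b (Q ∘ (inside ∷_)) (λ D q → let (u , w , D⊆) = sound (inside ∷ D) q in suc-injective u , w , drop-∷-⊆ D⊆)) ⟩
    x * z + y * z                                       ≡⟨ *-distribʳ-+ z x y ⟨
    (x + y) * z                                         ≡⟨ cong (_* z) (trans (+-comm x y) (sym (pascal ∣ U ∣ l))) ⟩
    (suc ∣ U ∣ choose suc l) * z                        ∎
    where
    open ≤-Reasoning
    x = ∣ U ∣ choose suc l
    y = ∣ U ∣ choose l
    z = ∣ W ∣ choose b
  #-split-≤ (outside ∷ U) (inside ∷ W) l zero Q sound = begin
    #[ Q ]
      ≡⟨ #-outside Q (λ D q → contradiction (proj₁ (proj₂ (sound (inside ∷ D) q))) λ ()) ⟩
    #[ Q ∘ (outside ∷_) ]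
      ≤⟨ #-split-≤ U W l 0 (Q ∘ (outside ∷_)) (skip-first Q sound) ⟩
    (∣ U ∣ choose l) * (∣ W ∣ choose 0)
      ≡⟨ cong ((∣ U ∣ choose l) *_) (trans (nC0≡1 ∣ W ∣) (sym (nC0≡1 (suc ∣ W ∣)))) ⟩
    (∣ U ∣ choose l) * (suc ∣ W ∣ choose 0)             ∎
    where open ≤-Reasoning
  #-split-≤ (outside ∷ U) (inside ∷ W) l (suc b) Q sound = begin
    #[ Q ]                                              ≡⟨ #-suc Q ⟩
    #[ Q ∘ (outside ∷_) ] + #[ Q ∘ (inside ∷_) ]
      ≤⟨ +-mono-≤
          (#-split-≤ U W l (suc b) (Q ∘ (outside ∷_)) (skip-first Q sound))
          (#-split-≤ U W l b (Q ∘ (inside ∷_)) (λ D q → let (u , w , D⊆) = sound (inside ∷ D) q in u , suc-injective w , drop-∷-⊆ D⊆)) ⟩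
    z * x + z * y                                       ≡⟨ *-distribˡ-+ z x y ⟨
    z * (x + y)                                         ≡⟨ cong (z *_) (trans (+-comm x y) (sym (pascal ∣ W ∣ b))) ⟩
    z * (suc ∣ W ∣ choose suc b)                        ∎
    where
    open ≤-Reasoning
    x = ∣ W ∣ choose suc b
    y = ∣ W ∣ choose b
    z = ∣ U ∣ choose l
  #-split-≤ (inside ∷ U) (inside ∷ W) l b Q sound = begin
    #[ Q ]                                              ≡⟨ #-suc Q ⟩
    #[ Q ∘ (outside ∷_) ] + #[ Q ∘ (inside ∷_) ]
      ≤⟨ +-mono-≤
          (#-split-≤ U W l b (Q ∘ (outside ∷_)) (skip-first Q sound))
          (branch l b sound) ⟩
    (∣ U ∣ choose l) * (∣ W ∣ choose b) + rest l b      ≤⟨ combine l b ⟩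
    (suc ∣ U ∣ choose l) * (suc ∣ W ∣ choose b)         ∎
    where
    open ≤-Reasoning
    -- The branch in which `D` contains a vertex common to `U` and `W`: both traces drop by one, and
    -- the branch is empty if either index is already zero. Pascal's rule on both factors leaves
    -- room for the two branches, since `x y + x′ y′ ≤ (x + x′) (y + y′)`.
    rest : ℕ → ℕ → ℕ
    rest zero    b       = 0
    rest (suc l) zero    = 0
    rest (suc l) (suc b) = (∣ U ∣ choose l) * (∣ W ∣ choose b)

    branch : ∀ l b → (∀ D → T (Q D) → ∣ D ∩ (inside ∷ U) ∣ ≡ l × ∣ D ∩ (inside ∷ W) ∣ ≡ b × D ⊆ (inside ∷ U) ∪ (inside ∷ W)) →
      #[ Q ∘ (inside ∷_) ] ≤ rest l b
    branch zero b sound = ≤-reflexive (#-empty (Q ∘ (inside ∷_)) (λ D q → contradiction (proj₁ (sound (inside ∷ D) q)) λ ()))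
    branch (suc l) zero sound = ≤-reflexive (#-empty (Q ∘ (inside ∷_)) (λ D q → contradiction (proj₁ (proj₂ (sound (inside ∷ D) q))) λ ()))
    branch (suc l) (suc b) sound =
      #-split-≤ U W l b (Q ∘ (inside ∷_)) (λ D q → let (u , w , D⊆) = sound (inside ∷ D) q in suc-injective u , suc-injective w , drop-∷-⊆ D⊆)

    combine : ∀ l b → (∣ U ∣ choose l) * (∣ W ∣ choose b) + rest l b ≤ (suc ∣ U ∣ choose l) * (suc ∣ W ∣ choose b)
    combine zero b = ≤-trans (≤-reflexive (+-identityʳ _)) (*-mono-≤ (C-monoˡ-≤ 0 (n≤1+n ∣ U ∣)) (C-monoˡ-≤ b (n≤1+n ∣ W ∣)))
    combine (suc l) zero = ≤-trans (≤-reflexive (+-identityʳ _)) (*-mono-≤ (C-monoˡ-≤ (suc l) (n≤1+n ∣ U ∣)) (C-monoˡ-≤ 0 (n≤1+n ∣ W ∣)))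
    combine (suc l) (suc b) rewrite pascal ∣ U ∣ l | pascal ∣ W ∣ b = begin
      x′ * y′ + x * y                             ≡⟨ +-comm (x′ * y′) (x * y) ⟩
      x * y + x′ * y′                             ≤⟨ +-mono-≤ (*-monoʳ-≤ x (m≤m+n y y′)) (*-monoʳ-≤ x′ (m≤n+m y′ y)) ⟩
      x * (y + y′) + x′ * (y + y′)                ≡⟨ *-distribʳ-+ (y + y′) x x′ ⟨
      (x + x′) * (y + y′)                         ∎
      where
      x = ∣ U ∣ choose l
      x′ = ∣ U ∣ choose suc l
      y = ∣ W ∣ choose b
      y′ = ∣ W ∣ choose suc b

  disjointOfSize : ∀ {n} → Subset n → ℕ → Subset n → Bool
  disjointOfSize S q D = (∣ D ∣ ≡ᵇ q) ∧ (∣ D ∩ S ∣ ≡ᵇ 0)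

  #-disjointOfSize : ∀ {n} (S : Subset n) q → #[ disjointOfSize S q ] ≡ ∣ ∁ S ∣ choose q
  #-disjointOfSize [] zero    = refl
  #-disjointOfSize [] (suc q) = refl
  #-disjointOfSize (inside ∷ S) q = trans (#-outside (disjointOfSize (inside ∷ S) q) (λ D → false′ (suc ∣ D ∣ ≡ᵇ q)))
    (#-disjointOfSize S q)
    where
    false′ : ∀ b → ¬ T (b ∧ false)
    false′ true  ()
    false′ false ()
  #-disjointOfSize (outside ∷ S) zero = trans (#-outside (disjointOfSize (outside ∷ S) 0) (λ D ()))
    (trans (#-disjointOfSize S 0) (trans (nC0≡1 ∣ ∁ S ∣) (sym (nC0≡1 (suc ∣ ∁ S ∣)))))
  #-disjointOfSize (outside ∷ S) (suc q) = trans (#-suc (disjointOfSize (outside ∷ S) (suc q)))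
    (trans (cong₂ _+_ (#-disjointOfSize S (suc q)) (#-disjointOfSize S q))
      (trans (+-comm (∣ ∁ S ∣ choose suc q) _) (sym (pascal ∣ ∁ S ∣ q))))

  shrink : ∀ {n} (C S : Subset n) p → ∣ C ∩ S ∣ ≤ p → p ≤ ∣ C ∣ →
    ∃[ D ] D ⊆ C × ∣ D ∣ ≡ p × ∣ D ∩ S ∣ ≡ ∣ C ∩ S ∣
  shrink [] [] zero _ _ = [] , id , refl , refl
  shrink (outside ∷ C) (s ∷ S) p lo hi with shrink C S p lo hi
  ... | D , D⊆C , ∣D∣ , ∣D∩S∣ = outside ∷ D , out⊆ D⊆C , ∣D∣ , ∣D∩S∣
  shrink (inside ∷ C) (inside ∷ S) (suc p) (s≤s lo) (s≤s hi) with shrink C S p lo hi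
  ... | D , D⊆C , ∣D∣ , ∣D∩S∣ = inside ∷ D , in⊆in D⊆C , cong suc ∣D∣ , cong suc ∣D∩S∣
  shrink (inside ∷ C) (outside ∷ S) p lo hi with p ≤? ∣ C ∣
  ... | no  p≰ = inside ∷ C , id , ≤-antisym (≰⇒> p≰) hi , refl
  ... | yes p≤ with shrink C S p lo p≤
  ... | D , D⊆C , ∣D∣ , ∣D∩S∣ = outside ∷ D , out⊆ D⊆C , ∣D∣ , ∣D∩S∣

-- Moment inequalities and clique counts of the planted random graph.

module RandomGraph where
  open Arithmetic
  open ListSum ℕ.+-*-commutativeSemiring
  open import Data.Bool.Base using (Bool; true; false; T; if_then_else_; _∧_; not)
  open import Data.List.Base using (List; []; _∷_; length; filter; upTo)
  open import Data.List.Membership.Propositional using (_∈_)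
  open import Data.List.Relation.Unary.Any using (here; there)
  open import Data.Nat.Base
  open import Data.Nat.Properties
  open import Data.Nat.Solver using (module +-*-Solver)
  open import Data.Product.Base using (∃-syntax; _×_; _,_; proj₁; proj₂)
  open import Data.Sum.Base using (inj₁; inj₂)
  open import Relation.Binary.PropositionalEquality
  open import Relation.Nullary.Decidable using (no; does; Dec; yes; _×-dec_)
  open CliqueCount
  open import Data.Bool.Properties using (T-∧)
  open import Data.Fin.Subset using (Subset; inside; outside; _∩_; _∪_; _─_; ∁; ∣_∣; _⊆_)
  open import Data.Fin.Subset.Properties
  open import Data.List.Membership.Propositional.Properties using (∈-filter⁺; ∈-filter⁻; ∈-cartesianProductWith⁺; ∈-upTo⁺; ∈-upTo⁻)
  open import Data.Nat.Combinatorics using () renaming (_C_ to infixl 8 _choose_)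
  open import Data.Vec.Base using ([]; _∷_)
  open import Function.Bundles using (module Equivalence)
  open import Relation.Nullary.Negation using (contradiction; ¬_)
  open import Data.Fin.Base using (Fin; toℕ)
  open import Data.Fin.Properties using (all?)
  open import Data.List.Properties using (length-upTo)
  open +-*-Solver using (solve; _:=_; _:+_; _:*_; con)

  private
    variable
      a : Level
      A : Set a

  ∈⇒≤∑ : ∀ (xs : List A) (f : A → ℕ) {x} → x ∈ xs → f x ≤ ∑ xs f
  ∈⇒≤∑ (x ∷ xs) f (here refl) = m≤m+n (f x) (∑ xs f)
  ∈⇒≤∑ (y ∷ xs) f (there x∈)  = ≤-trans (∈⇒≤∑ xs f x∈) (m≤n+m (∑ xs f) (f y))

  ∑-mono-∈ : ∀ (xs : List A) {f g : A → ℕ} → (∀ x → x ∈ xs → f x ≤ g x) → ∑ xs f ≤ ∑ xs g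
  ∑-mono-∈ []       f≤g = z≤n
  ∑-mono-∈ (x ∷ xs) f≤g = +-mono-≤ (f≤g x (here refl)) (∑-mono-∈ xs (λ y y∈ → f≤g y (there y∈)))

  ∑-const : ∀ (xs : List A) c → ∑ xs (λ _ → c) ≡ length xs * c
  ∑-const []       c = refl
  ∑-const (x ∷ xs) c = cong (c +_) (∑-const xs c)

  ∑-1*c : ∀ (xs : List A) c → ∑ xs (λ _ → c) ≡ ∑ xs (λ _ → 1) * c
  ∑-1*c xs c = trans (∑-cong xs (λ _ → sym (+-identityʳ c))) (∑-*ʳ xs c (λ _ → 1))

  0<∑⇒∃ : ∀ (xs : List A) (b : A → Bool) → 0 < ∑ xs (λ x → 𝟙 (b x)) → ∃[ x ] x ∈ xs × T (b x)
  0<∑⇒∃ (x ∷ xs) b 0<∑ with b x in eq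
  ... | true  = x , here refl , subst T (sym eq) _
  ... | false with 0<∑⇒∃ xs b 0<∑
  ...   | y , y∈ , by = y , there y∈ , by

  markov : ∀ (Ω : List A) (Y : A → ℕ) t →
    t * ∑ Ω (λ G → 𝟙 (does (t <? Y G))) ≤ ∑ Ω Y
  markov Ω Y t = begin
    t * ∑ Ω (λ G → 𝟙 (does (t <? Y G)))     ≡⟨ ∑-*ˡ Ω t _ ⟨
    ∑ Ω (λ G → t * 𝟙 (does (t <? Y G)))     ≤⟨ ∑-mono Ω pointwise ⟩
    ∑ Ω Y                                   ∎
    where
    open ≤-Reasoning
    pointwise : ∀ G → t * 𝟙 (does (t <? Y G)) ≤ Y G
    pointwise G with t <ᵇ Y G | <ᵇ⇒< t (Y G)
    ... | true  | t<Y = ≤-trans (≤-reflexive (*-identityʳ t)) (<⇒≤ (t<Y _))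
    ... | false | _   = ≤-trans (≤-reflexive (*-zeroʳ t)) z≤n

  am-gm : ∀ x y → 2 * (x * y) ≤ x * x + y * y
  am-gm x y with ≤-total x y
  ... | inj₁ x≤y = subst (λ y → 2 * (x * y) ≤ x * x + y * y) (m+[n∸m]≡n x≤y) (am-gm′ x (y ∸ x))
    where
    am-gm′ : ∀ x d → 2 * (x * (x + d)) ≤ x * x + (x + d) * (x + d)
    am-gm′ x d = ≤-trans (m≤m+n _ (d * d)) (≤-reflexive
      (solve 2 (λ x d → con 2 :* (x :* (x :+ d)) :+ d :* d := x :* x :+ (x :+ d) :* (x :+ d)) refl x d))
  ... | inj₂ y≤x = subst (λ x → 2 * (x * y) ≤ x * x + y * y) (m+[n∸m]≡n y≤x) (am-gm′ y (x ∸ y))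
    where
    am-gm′ : ∀ y d → 2 * ((y + d) * y) ≤ (y + d) * (y + d) + y * y
    am-gm′ y d = ≤-trans (m≤m+n _ (d * d)) (≤-reflexive
      (solve 2 (λ y d → con 2 :* ((y :+ d) :* y) :+ d :* d := (y :+ d) :* (y :+ d) :+ y :* y) refl y d))

  -- Markov's inequality for 4 (N X - S)², with all terms moved so that no
  -- subtraction occurs.
  chebyshev : ∀ (Ω : List A) (X : A → ℕ) K → let N = ∑ Ω (λ _ → 1); S = ∑ Ω X in
    0 < S → K * (N * ∑ Ω (λ G → X G * X G)) ≤ suc K * (S * S) →
    K * ∑ Ω (λ G → 𝟙 (does (2 * (N * X G) <? S))) ≤ 4 * N
  chebyshev Ω X K 0<S var = *-cancelʳ-≤ (K * #bad) (4 * N) (S * S) {{>-nonZero (*-mono-< 0<S 0<S)}}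
    (+-cancelʳ-≤ (8 * (K * (N * (S * S)))) _ _ (begin
      K * #bad * (S * S) + 8 * (K * (N * (S * S)))
        ≡⟨ solve 4 (λ K b N S → K :* b :* (S :* S) :+ con 8 :* (K :* (N :* (S :* S))) := K :* (b :* (S :* S) :+ (con 8 :* (N :* S)) :* S)) refl K #bad N S ⟩
      K * (#bad * (S * S) + 8 * (N * S) * S)
        ≤⟨ *-monoʳ-≤ K summed ⟩
      K * (4 * (N * N) * S₂ + N * (4 * (S * S)))
        ≡⟨ solve 4 (λ K N S S₂ → K :* (con 4 :* (N :* N) :* S₂ :+ N :* (con 4 :* (S :* S))) := (con 4 :* N) :* (K :* (N :* S₂)) :+ con 4 :* (K :* (N :* (S :* S)))) refl K N S S₂ ⟩
      4 * N * (K * (N * S₂)) + 4 * (K * (N * (S * S)))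
        ≤⟨ +-monoˡ-≤ _ (*-monoʳ-≤ (4 * N) var) ⟩
      4 * N * (suc K * (S * S)) + 4 * (K * (N * (S * S)))
        ≡⟨ solve 3 (λ K N S → con 4 :* N :* ((con 1 :+ K) :* (S :* S)) :+ con 4 :* (K :* (N :* (S :* S))) := con 4 :* N :* (S :* S) :+ con 8 :* (K :* (N :* (S :* S)))) refl K N S ⟩
      4 * N * (S * S) + 8 * (K * (N * (S * S))) ∎))
    where
    open ≤-Reasoning
    N = ∑ Ω (λ _ → 1)
    S = ∑ Ω X
    S₂ = ∑ Ω (λ G → X G * X G)
    bad : _ → Bool
    bad G = does (2 * (N * X G) <? S)
    #bad = ∑ Ω (λ G → 𝟙 (bad G))

    pointwise : ∀ G → 𝟙 (bad G) * (S * S) + 8 * (N * S) * X G ≤ 4 * (N * N) * (X G * X G) + 4 * (S * S)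
    pointwise G with 2 * (N * X G) <ᵇ S | <ᵇ⇒< (2 * (N * X G)) S
    ... | false | _ = begin
      8 * (N * S) * X G                               ≡⟨ solve 3 (λ N S X → con 8 :* (N :* S) :* X := con 4 :* (con 2 :* ((N :* X) :* S))) refl N S (X G) ⟩
      4 * (2 * ((N * X G) * S))                       ≤⟨ *-monoʳ-≤ 4 (am-gm (N * X G) S) ⟩
      4 * ((N * X G) * (N * X G) + S * S)             ≡⟨ solve 3 (λ N S X → con 4 :* ((N :* X) :* (N :* X) :+ S :* S) := con 4 :* (N :* N) :* (X :* X) :+ con 4 :* (S :* S)) refl N S (X G) ⟩
      4 * (N * N) * (X G * X G) + 4 * (S * S)         ∎
    ... | true | lt = begin
      1 * (S * S) + 8 * (N * S) * X G                 ≡⟨ cong (λ s → 1 * (s * s) + 8 * (N * s) * X G) (m+[n∸m]≡n (<⇒≤ (lt _))) ⟨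
      1 * (s * s) + 8 * (N * s) * X G                 ≤⟨ m≤m+n _ (3 * (d * d) + 4 * (N * X G * d)) ⟩
      1 * (s * s) + 8 * (N * s) * X G + (3 * (d * d) + 4 * (N * X G * d))
        ≡⟨ solve 3 (λ N X d → let s = con 2 :* (N :* X) :+ d in
              con 1 :* (s :* s) :+ con 8 :* (N :* s) :* X :+ (con 3 :* (d :* d) :+ con 4 :* (N :* X :* d))
                := con 4 :* (N :* N) :* (X :* X) :+ con 4 :* (s :* s)) refl N (X G) d ⟩
      4 * (N * N) * (X G * X G) + 4 * (s * s)         ≡⟨ cong (λ s → 4 * (N * N) * (X G * X G) + 4 * (s * s)) (m+[n∸m]≡n (<⇒≤ (lt _))) ⟩
      4 * (N * N) * (X G * X G) + 4 * (S * S)         ∎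
      where
      d = S ∸ 2 * (N * X G)
      s = 2 * (N * X G) + d

    summed : #bad * (S * S) + 8 * (N * S) * S ≤ 4 * (N * N) * S₂ + N * (4 * (S * S))
    summed = begin
      #bad * (S * S) + 8 * (N * S) * S
        ≡⟨ cong₂ _+_ (∑-*ʳ Ω (S * S) (λ G → 𝟙 (bad G))) (∑-*ˡ Ω (8 * (N * S)) X) ⟨
      ∑ Ω (λ G → 𝟙 (bad G) * (S * S)) + ∑ Ω (λ G → 8 * (N * S) * X G)
        ≡⟨ ∑-+ Ω _ _ ⟨
      ∑ Ω (λ G → 𝟙 (bad G) * (S * S) + 8 * (N * S) * X G)
        ≤⟨ ∑-mono Ω pointwise ⟩
      ∑ Ω (λ G → 4 * (N * N) * (X G * X G) + 4 * (S * S))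
        ≡⟨ ∑-+ Ω _ _ ⟩
      ∑ Ω (λ G → 4 * (N * N) * (X G * X G)) + ∑ Ω (λ _ → 4 * (S * S))
        ≡⟨ cong₂ _+_ (∑-*ˡ Ω (4 * (N * N)) _) (∑-1*c Ω (4 * (S * S))) ⟩
      4 * (N * N) * S₂ + N * (4 * (S * S)) ∎

  ∈-subsets : ∀ {n} (C : Subset n) → C ∈ subsets n
  ∈-subsets []            = here refl
  ∈-subsets (outside ∷ C) = ∈-cartesianProductWith⁺ _∷_ {outside ∷ inside ∷ []} (here refl) (∈-subsets C)
  ∈-subsets (inside  ∷ C) = ∈-cartesianProductWith⁺ _∷_ {outside ∷ inside ∷ []} (there (here refl)) (∈-subsets C)

  hasOverlap? : ∀ {n} (S : Subset n) q s (C : Subset n) → Dec (∣ C ∣ ≡ q × ∣ C ∩ S ∣ ≡ s)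
  hasOverlap? S q s C = (∣ C ∣ ≟ q) ×-dec (∣ C ∩ S ∣ ≟ s)

  family : ∀ {n} → Subset n → ℕ → ℕ → List (Subset n)
  family {n} S q s = filter (hasOverlap? S q s) (subsets n)

  -- W_{q,s} for the planted graph; G is the graph before planting.
  cliqueCount : ∀ {n} → Graph n → Subset n → ℕ → ℕ → ℕ
  cliqueCount G S q s = ∑ (family S q s) (λ C → 𝟙 (does (isClique? (plant G S) C)))

  #family : ∀ {n} → Subset n → ℕ → ℕ → ℕ
  #family S q s = ∑ (family S q s) (λ _ → 1)

  #family≡ : ∀ {n} (S : Subset n) q s → #family S q s ≡ #[ (λ C → (∣ C ∣ ≡ᵇ q) ∧ (∣ C ∩ S ∣ ≡ᵇ s)) ]
  #family≡ {n} S q s = ∑-filter (hasOverlap? S q s) (subsets n) (λ _ → 1)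

  ∣p∩q∣+∣p∩∁q∣ : ∀ {n} (p q : Subset n) → ∣ p ∩ q ∣ + ∣ p ∩ ∁ q ∣ ≡ ∣ p ∣
  ∣p∩q∣+∣p∩∁q∣ [] [] = refl
  ∣p∩q∣+∣p∩∁q∣ (inside  ∷ p) (inside  ∷ q) = cong suc (∣p∩q∣+∣p∩∁q∣ p q)
  ∣p∩q∣+∣p∩∁q∣ (inside  ∷ p) (outside ∷ q) = trans (+-suc _ _) (cong suc (∣p∩q∣+∣p∩∁q∣ p q))
  ∣p∩q∣+∣p∩∁q∣ (outside ∷ p) (inside  ∷ q) = ∣p∩q∣+∣p∩∁q∣ p q
  ∣p∩q∣+∣p∩∁q∣ (outside ∷ p) (outside ∷ q) = ∣p∩q∣+∣p∩∁q∣ p q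

  p∪∁q : ∀ {n} (D S : Subset n) → D ⊆ S ∪ ∁ S
  p∪∁q D S {x} _ with x ∈? S
  ... | yes x∈S = x∈p∪q⁺ (inj₁ x∈S)
  ... | no  x∉S = x∈p∪q⁺ (inj₂ (x∉p⇒x∈∁p x∉S))

  #family-≤ : ∀ {n} (S : Subset n) q s → #family S q s ≤ (∣ S ∣ choose s) * (∣ ∁ S ∣ choose (q ∸ s))
  #family-≤ S q s = ≤-trans (≤-reflexive (#family≡ S q s)) (#-split-≤ S (∁ S) s (q ∸ s) _ sound)
    where
    sound : ∀ D → T ((∣ D ∣ ≡ᵇ q) ∧ (∣ D ∩ S ∣ ≡ᵇ s)) → ∣ D ∩ S ∣ ≡ s × ∣ D ∩ ∁ S ∣ ≡ q ∸ s × D ⊆ S ∪ ∁ S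
    sound D t with Equivalence.to (T-∧ {∣ D ∣ ≡ᵇ q}) t
    ... | tq , ts with ≡ᵇ⇒≡ ∣ D ∣ q tq | ≡ᵇ⇒≡ ∣ D ∩ S ∣ s ts
    ... | refl | refl = refl , sym (trans (cong (_∸ ∣ D ∩ S ∣) (sym (∣p∩q∣+∣p∩∁q∣ D S))) (m+n∸m≡n ∣ D ∩ S ∣ _)) , p∪∁q D S

  #family-0 : ∀ {n} (S : Subset n) q → #family S q 0 ≡ ∣ ∁ S ∣ choose q
  #family-0 S q = trans (#family≡ S q 0) (#-disjointOfSize S q)

  #family-empty : ∀ {n} (S : Subset n) {q s} → q < s → #family S q s ≡ 0
  #family-empty {n} S {q} {s} q<s = trans (#family≡ S q s) (#-empty {n} _ λ D t →
    let (tq , ts) = Equivalence.to (T-∧ {∣ D ∣ ≡ᵇ q}) t in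
    contradiction (subst₂ _≤_ (≡ᵇ⇒≡ _ s ts) (≡ᵇ⇒≡ _ q tq) (∣p∩q∣≤∣p∣ D S)) (<⇒≱ q<s))

  ∈-family⁻ : ∀ {n} (S : Subset n) q s {C} → C ∈ family S q s → ∣ C ∣ ≡ q × ∣ C ∩ S ∣ ≡ s
  ∈-family⁻ {n} S q s C∈ = proj₂ (∈-filter⁻ (hasOverlap? S q s) {xs = subsets n} C∈)

  ∈-family⁺ : ∀ {n} (S : Subset n) q s {C} → ∣ C ∣ ≡ q → ∣ C ∩ S ∣ ≡ s → C ∈ family S q s
  ∈-family⁺ S q s {C} ∣C∣ ∣C∩S∣ = ∈-filter⁺ (hasOverlap? S q s) (∈-subsets C) (∣C∣ , ∣C∩S∣)

  cliqueCount≡ : ∀ {n} (G : Graph n) S q s → cliqueCount G S q s ≡ ∑ (family S q s) (λ C → 𝟙 (does (required S C ⊑? G)))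
  cliqueCount≡ G S q s = ∑-cong (family S q s) (λ C → cong 𝟙 (does-isClique-plant G S C))

  -- First moment. Of the `q choose 2` edges of a clique, the `s choose 2` edges inside the planted
  -- set are present for free.
  ∑-cliqueCount : ∀ {n} (S : Subset n) q s →
    ∑ (graphs n) (λ G → cliqueCount G S q s) * 2 ^ (q choose 2) ≡ #family S q s * (#graphs n * 2 ^ (s choose 2))
  ∑-cliqueCount {n} S q s = begin
    ∑ (graphs n) (λ G → cliqueCount G S q s) * P
      ≡⟨ cong (_* P) (trans (∑-cong (graphs n) (λ G → cliqueCount≡ G S q s)) (∑-swap (graphs n) F _)) ⟩
    ∑ F count * P
      ≡⟨ ∑-*ʳ F P count ⟨
    ∑ F (λ C → count C * P)
      ≡⟨ ∑-cong-∈ F each ⟩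
    ∑ F (λ C → #graphs n * 2 ^ (s choose 2))
      ≡⟨ ∑-1*c F _ ⟩
    #family S q s * (#graphs n * 2 ^ (s choose 2)) ∎
    where
    open ≡-Reasoning
    P = 2 ^ (q choose 2)
    F = family S q s
    count = λ C → ∑ (graphs n) (λ G → 𝟙 (does (required S C ⊑? G)))
    each : ∀ C → C ∈ F → count C * P ≡ #graphs n * 2 ^ (s choose 2)
    each C C∈ with ∈-family⁻ S q s C∈
    ... | refl , refl = begin
      count C * 2 ^ (∣ C ∣ choose 2)
        ≡⟨ cong (λ x → count C * 2 ^ x) (edges-required S C) ⟨
      count C * 2 ^ (edges (required S C) + (∣ C ∩ S ∣ choose 2))
        ≡⟨ cong (count C *_) (^-distribˡ-+-* 2 (edges (required S C)) _) ⟩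
      count C * (2 ^ edges (required S C) * 2 ^ (∣ C ∩ S ∣ choose 2))
        ≡⟨ *-assoc (count C) _ _ ⟨
      count C * 2 ^ edges (required S C) * 2 ^ (∣ C ∩ S ∣ choose 2)
        ≡⟨ cong (_* 2 ^ (∣ C ∩ S ∣ choose 2)) (count-⊑ (required S C)) ⟩
      #graphs n * 2 ^ (∣ C ∩ S ∣ choose 2) ∎

  -- Second moment. The square expands into pairs of cliques; each pair asks for the union of two
  -- edge sets, whose size falls short of the sum by the edges inside the overlap.
  ∑-cliqueCount² : ∀ {n} (S : Subset n) q →
    ∑ (graphs n) (λ G → cliqueCount G S q 0 * cliqueCount G S q 0) * (2 ^ (q choose 2) * 2 ^ (q choose 2))
      ≤ #graphs n * ∑ (family S q 0) (λ C → ∑ (family S q 0) (λ C′ → 2 ^ (∣ C ∩ C′ ∣ choose 2)))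
  ∑-cliqueCount² {n} S q = begin
    ∑ (graphs n) (λ G → cliqueCount G S q 0 * cliqueCount G S q 0) * P
      ≡⟨ cong (_* P) (∑-cong (graphs n) square) ⟩
    ∑ (graphs n) (λ G → ∑ F (λ C → ∑ F (λ C′ → 𝟙 (does ((required S C ∪ᴳ required S C′) ⊑? G))))) * P
      ≡⟨ cong (_* P) (trans (∑-swap (graphs n) F _) (∑-cong F (λ C → ∑-swap (graphs n) F _))) ⟩
    ∑ F (λ C → ∑ F (λ C′ → count C C′)) * P
      ≡⟨ trans (sym (∑-*ʳ F P _)) (∑-cong F (λ C → sym (∑-*ʳ F P _))) ⟩
    ∑ F (λ C → ∑ F (λ C′ → count C C′ * P))
      ≤⟨ ∑-mono-∈ F (λ C C∈ → ∑-mono-∈ F (λ C′ C′∈ → each C C′ C∈ C′∈)) ⟩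
    ∑ F (λ C → ∑ F (λ C′ → #graphs n * 2 ^ (∣ C ∩ C′ ∣ choose 2)))
      ≡⟨ trans (∑-cong F (λ C → ∑-*ˡ F (#graphs n) _)) (∑-*ˡ F (#graphs n) _) ⟩
    #graphs n * ∑ F (λ C → ∑ F (λ C′ → 2 ^ (∣ C ∩ C′ ∣ choose 2))) ∎
    where
    open ≤-Reasoning
    P = 2 ^ (q choose 2) * 2 ^ (q choose 2)
    F = family S q 0
    count = λ C C′ → ∑ (graphs n) (λ G → 𝟙 (does ((required S C ∪ᴳ required S C′) ⊑? G)))
    square : ∀ G → cliqueCount G S q 0 * cliqueCount G S q 0
      ≡ ∑ F (λ C → ∑ F (λ C′ → 𝟙 (does ((required S C ∪ᴳ required S C′) ⊑? G))))
    square G = trans (cong₂ _*_ (cliqueCount≡ G S q 0) (cliqueCount≡ G S q 0))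
      (trans (sym (∑-*ʳ F _ _)) (∑-cong F (λ C → trans (sym (∑-*ˡ F (𝟙 (does (required S C ⊑? G))) _))
        (∑-cong F (λ C′ → 𝟙-∪⊑ (required S C) (required S C′) G)))))
    -- A clique disjoint from `S` receives no edge from planting and needs all `q choose 2` of them.
    edges≡ : ∀ C → C ∈ F → edges (required S C) ≡ q choose 2
    edges≡ C C∈ = trans (sym (+-identityʳ _))
      (trans (cong (λ x → edges (required S C) + x choose 2) (sym (proj₂ (∈-family⁻ S q 0 C∈))))
      (trans (edges-required S C) (cong (_choose 2) (proj₁ (∈-family⁻ S q 0 C∈)))))
    each : ∀ C C′ → C ∈ F → C′ ∈ F → count C C′ * P ≤ #graphs n * 2 ^ (∣ C ∩ C′ ∣ choose 2)
    each C C′ C∈ C′∈ = begin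
      count C C′ * P
        ≡⟨ cong (count C C′ *_) (sym (trans (cong (2 ^_) (cong₂ _+_ (edges≡ C C∈) (edges≡ C′ C′∈))) (^-distribˡ-+-* 2 (q choose 2) _))) ⟩
      count C C′ * 2 ^ (edges (required S C) + edges (required S C′))
        ≤⟨ *-monoʳ-≤ (count C C′) (^-monoʳ-≤ 2 (edges-required-∪ S C C′)) ⟩
      count C C′ * 2 ^ (edges (required S C ∪ᴳ required S C′) + (∣ C ∩ C′ ∣ choose 2))
        ≡⟨ cong (count C C′ *_) (^-distribˡ-+-* 2 (edges (required S C ∪ᴳ required S C′)) _) ⟩
      count C C′ * (2 ^ edges (required S C ∪ᴳ required S C′) * 2 ^ (∣ C ∩ C′ ∣ choose 2))
        ≡⟨ *-assoc (count C C′) _ _ ⟨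
      count C C′ * 2 ^ edges (required S C ∪ᴳ required S C′) * 2 ^ (∣ C ∩ C′ ∣ choose 2)
        ≡⟨ cong (_* 2 ^ (∣ C ∩ C′ ∣ choose 2)) (count-⊑ (required S C ∪ᴳ required S C′)) ⟩
      #graphs n * 2 ^ (∣ C ∩ C′ ∣ choose 2) ∎

  #overlap-≤ : ∀ {n} (S C : Subset n) q l → ∣ C ∣ ≡ q → l ≤ q →
    ∑ (family S q 0) (λ D → 𝟙 (∣ C ∩ D ∣ ≡ᵇ l)) ≤ (q choose l) * (∣ ∁ S ∣ choose (q ∸ l))
  #overlap-≤ {n} S C q l refl l≤q = begin
    ∑ (family S q 0) (λ D → 𝟙 (∣ C ∩ D ∣ ≡ᵇ l))
      ≡⟨ ∑-filter (hasOverlap? S q 0) (subsets n) _ ⟩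
    ∑ (subsets n) (λ D → if disjointOfSize S q D then 𝟙 (∣ C ∩ D ∣ ≡ᵇ l) else 0)
      ≡⟨ ∑-cong (subsets n) (λ D → if-∧ (disjointOfSize S q D) (∣ C ∩ D ∣ ≡ᵇ l) 1) ⟩
    #[ (λ D → disjointOfSize S q D ∧ (∣ C ∩ D ∣ ≡ᵇ l)) ]
      ≤⟨ #-split-≤ C (∁ S ─ C) l (q ∸ l) _ sound ⟩
    (∣ C ∣ choose l) * (∣ ∁ S ─ C ∣ choose (q ∸ l))
      ≤⟨ *-monoʳ-≤ (∣ C ∣ choose l) (C-monoˡ-≤ (q ∸ l) (p⊆q⇒∣p∣≤∣q∣ (p─q⊆p (∁ S) C))) ⟩
    (∣ C ∣ choose l) * (∣ ∁ S ∣ choose (q ∸ l)) ∎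
    where
    open ≤-Reasoning
    sound : ∀ D → T (disjointOfSize S q D ∧ (∣ C ∩ D ∣ ≡ᵇ l)) → ∣ D ∩ C ∣ ≡ l × ∣ D ∩ (∁ S ─ C) ∣ ≡ q ∸ l × D ⊆ C ∪ (∁ S ─ C)
    sound D t with Equivalence.to (T-∧ {disjointOfSize S q D}) t
    ... | tf , tl with Equivalence.to (T-∧ {∣ D ∣ ≡ᵇ q}) tf
    ... | tq , t0 with ≡ᵇ⇒≡ ∣ D ∣ q tq | ≡ᵇ⇒≡ ∣ D ∩ S ∣ 0 t0 | ≡ᵇ⇒≡ ∣ C ∩ D ∣ l tl
    ... | ∣D∣≡q | ∣D∩S∣≡0 | refl = cong ∣_∣ (∩-comm D C) ,
        trans (cong ∣_∣ rest≡) (trans (sym (m+n∸n≡m ∣ D ─ C ∣ ∣ D ∩ C ∣))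
          (cong₂ _∸_ (trans (∣p─q∣+∣p∩q∣ D C) ∣D∣≡q) (cong ∣_∣ (∩-comm D C)))) ,
        λ {x} → D⊆ {x}
      where
      D⊆∁S : D ⊆ ∁ S
      D⊆∁S {x} x∈D = x∉p⇒x∈∁p λ x∈S → n≮0 (<-≤-trans (x∈p⇒∣p-x∣<∣p∣ (x∈p∩q⁺ (x∈D , x∈S))) (≤-reflexive ∣D∩S∣≡0))
      D⊆ : D ⊆ C ∪ (∁ S ─ C)
      D⊆ {x} x∈D with x ∈? C
      ... | yes x∈C = x∈p∪q⁺ (inj₁ x∈C)
      ... | no  x∉C = x∈p∪q⁺ (inj₂ (x∈p∧x∉q⇒x∈p─q (D⊆∁S x∈D) x∉C))
      ∩─ : ∀ {n} (p q r : Subset n) → p ∩ (q ─ r) ≡ (p ∩ q) ─ r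
      ∩─ [] [] [] = refl
      ∩─ (x ∷ p) (y ∷ q) (outside ∷ r) = cong (_ ∷_) (∩─ p q r)
      ∩─ (x ∷ p) (y ∷ q) (inside  ∷ r) = cong₂ _∷_ (Data.Bool.Properties.∧-zeroʳ x) (∩─ p q r)
        where import Data.Bool.Properties
      rest≡ : D ∩ (∁ S ─ C) ≡ D ─ C
      rest≡ = trans (∩─ D (∁ S) C) (cong (_─ C) (⊆-antisym (p∩q⊆p D (∁ S)) (λ x∈D → x∈p∩q⁺ (x∈D , D⊆∁S x∈D))))

  -- Relative to disjoint choices, an overlap of `l` vertices costs `(q / p) ^ l` in the remaining
  -- choice, while selecting the common vertices gains at most `q ^ l` and their shared edges at
  -- most `(2 ^ h) ^ l`. With the factor `(q * K) ^ l` all terms are `l`-th powers, and the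
  -- hypothesis is the comparison of their bases.
  overlap-term-≤ : ∀ p q l h K → l ≤ q → q ≤ 2 * h → .{{_ : NonZero p}} →
    q * q * (q * K) * 2 ^ h ≤ p →
    (q choose l) * ((p + q) choose (q ∸ l)) * 2 ^ (l choose 2) * (q * K) ^ l ≤ (p + q) choose q
  overlap-term-≤ p q l h K l≤q q≤2h small = *-cancelʳ-≤ _ _ (p ^ l) {{m^n≢0 p l}} (begin
    (q choose l) * y * 2 ^ (l choose 2) * (q * K) ^ l * p ^ l
      ≤⟨ *-monoˡ-≤ (p ^ l) (*-monoˡ-≤ ((q * K) ^ l) (*-mono-≤ (*-monoˡ-≤ y (C≤^ q l)) pow)) ⟩
    q ^ l * y * (2 ^ h) ^ l * (q * K) ^ l * p ^ l
      ≡⟨ solve 5 (λ a y b c d → a :* y :* b :* c :* d := a :* b :* c :* (y :* d)) refl (q ^ l) y ((2 ^ h) ^ l) ((q * K) ^ l) (p ^ l) ⟩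
    q ^ l * (2 ^ h) ^ l * (q * K) ^ l * (y * p ^ l)
      ≤⟨ *-monoʳ-≤ (q ^ l * (2 ^ h) ^ l * (q * K) ^ l) (C-steps p q l (q ∸ l) (≤-reflexive l+[q∸l])) ⟩
    q ^ l * (2 ^ h) ^ l * (q * K) ^ l * (q ^ l * ((p + q) choose (l + (q ∸ l))))
      ≡⟨ cong (λ x → q ^ l * (2 ^ h) ^ l * (q * K) ^ l * (q ^ l * ((p + q) choose x))) l+[q∸l] ⟩
    q ^ l * (2 ^ h) ^ l * (q * K) ^ l * (q ^ l * z)
      ≡⟨ solve 4 (λ a b c z → a :* b :* c :* (a :* z) := z :* (a :* a :* c :* b)) refl (q ^ l) ((2 ^ h) ^ l) ((q * K) ^ l) z ⟩
    z * (q ^ l * q ^ l * (q * K) ^ l * (2 ^ h) ^ l)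
      ≡⟨ cong (z *_) (sym (trans (^-distribʳ-* (q * q * (q * K)) (2 ^ h) l) (cong (_* (2 ^ h) ^ l)
          (trans (^-distribʳ-* (q * q) (q * K) l) (cong (_* (q * K) ^ l) (^-distribʳ-* q q l)))))) ⟩
    z * (q * q * (q * K) * 2 ^ h) ^ l
      ≤⟨ *-monoʳ-≤ z (^-monoˡ-≤ l small) ⟩
    z * p ^ l ∎)
    where
    open ≤-Reasoning
    y = (p + q) choose (q ∸ l)
    z = (p + q) choose q
    l+[q∸l] = m+[n∸m]≡n l≤q
    pow : 2 ^ (l choose 2) ≤ (2 ^ h) ^ l
    pow = ≤-trans (^-monoʳ-≤ 2 (≤-trans (nC2≤n*h l h (≤-trans (≤-trans l≤q q≤2h) (n≤1+n _))) (≤-reflexive (*-comm l h))))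
      (≤-reflexive (sym (^-*-assoc 2 h l)))

  -- ∑_{C'} 2^{C(|C∩C'|,2)} ≤ (1 + 1/K) |F|, the terms with C ∩ C' ≠ ∅ being negligible.
  overlap-sum-≤ : ∀ {n} (S C : Subset n) p q h K → ∣ ∁ S ∣ ≡ p + q → C ∈ family S q 0 →
    q ≤ 2 * h → .{{_ : NonZero p}} → .{{_ : NonZero K}} → q * q * (q * K) * 2 ^ h ≤ p →
    K * ∑ (family S q 0) (λ D → 2 ^ (∣ C ∩ D ∣ choose 2)) ≤ suc K * #family S q 0
  overlap-sum-≤ S C p zero h K ∣∁S∣ C∈ q≤2h small = *-mono-≤ (n≤1+n K) (∑-mono F λ D → ≤-reflexive (cong (λ x → 2 ^ (x choose 2)) (n≤0⇒n≡0 (≤-trans (∣p∩q∣≤∣p∣ C D) (≤-reflexive (proj₁ (∈-family⁻ S 0 0 C∈)))))))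
    where F = family S 0 0
  overlap-sum-≤ S C p q@(suc q-1) h K ∣∁S∣ C∈ q≤2h small = begin
    K * ∑ F (λ D → 2 ^ (∣ C ∩ D ∣ choose 2))
      ≤⟨ *-monoʳ-≤ K (∑-mono F pointwise) ⟩
    K * ∑ F (λ D → 1 + ∑ (upTo q) (λ j → 𝟙 (∣ C ∩ D ∣ ≡ᵇ suc j) * 2 ^ (suc j choose 2)))
      ≡⟨ cong (K *_) (trans (∑-+ F (λ _ → 1) _) (cong (∑ F (λ _ → 1) +_) (trans (∑-swap F (upTo q) _)
          (∑-cong (upTo q) (λ j → ∑-*ʳ F (2 ^ (suc j choose 2)) _))))) ⟩
    K * (#F + ∑ (upTo q) term)
      ≡⟨ *-distribˡ-+ K #F _ ⟩
    K * #F + K * ∑ (upTo q) term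
      ≤⟨ +-monoʳ-≤ (K * #F) terms ⟩
    K * #F + #F
      ≡⟨ +-comm (K * #F) #F ⟩
    suc K * #F ∎
    where
    open ≤-Reasoning
    F = family S q 0
    #F = #family S q 0
    N : ℕ → ℕ
    N l = ∑ F (λ D → 𝟙 (∣ C ∩ D ∣ ≡ᵇ l))
    term : ℕ → ℕ
    term j = N (suc j) * 2 ^ (suc j choose 2)

    pointwise : ∀ D → 2 ^ (∣ C ∩ D ∣ choose 2) ≤ 1 + ∑ (upTo q) (λ j → 𝟙 (∣ C ∩ D ∣ ≡ᵇ suc j) * 2 ^ (suc j choose 2))
    pointwise D with ∣ C ∩ D ∣ | ≤-trans (∣p∩q∣≤∣p∣ C D) (≤-reflexive (proj₁ (∈-family⁻ S q 0 C∈)))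
    ... | zero  | _   = s≤s z≤n
    ... | suc l | l<q = m≤n⇒m≤1+n (≤-trans
      (≤-reflexive (sym (trans (cong (_* 2 ^ (suc l choose 2)) (𝟙-refl l)) (+-identityʳ _))))
      (∈⇒≤∑ (upTo q) (λ j → 𝟙 (l ≡ᵇ j) * 2 ^ (suc j choose 2)) (∈-upTo⁺ l<q)))
      where
      𝟙-refl : ∀ l → 𝟙 (l ≡ᵇ l) ≡ 1
      𝟙-refl zero    = refl
      𝟙-refl (suc l) = 𝟙-refl l

    each : ∀ j → j ∈ upTo q → q * K * term j ≤ #F
    each j j∈ = begin
      q * K * (N l * P)
        -- Since `l ≥ 1`, the single factor `q * K` is at most the power `(q * K) ^ l` that
        -- `overlap-term-≤` can absorb. It is later spent on the `q` possible overlap sizes and on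
        -- `K`.
        ≤⟨ *-mono-≤ (m≤m*n (q * K) ((q * K) ^ j) {{m^n≢0 (q * K) j {{m*n≢0 q K}}}}) (*-monoˡ-≤ P (#overlap-≤ S C q l (proj₁ (∈-family⁻ S q 0 C∈)) (∈-upTo⁻ j∈))) ⟩
      (q * K) ^ l * ((q choose l) * (∣ ∁ S ∣ choose (q ∸ l)) * P)
        ≡⟨ *-comm ((q * K) ^ l) _ ⟩
      (q choose l) * (∣ ∁ S ∣ choose (q ∸ l)) * P * (q * K) ^ l
        ≡⟨ cong (λ x → (q choose l) * (x choose (q ∸ l)) * P * (q * K) ^ l) ∣∁S∣ ⟩
      (q choose l) * ((p + q) choose (q ∸ l)) * P * (q * K) ^ l
        ≤⟨ overlap-term-≤ p q l h K (∈-upTo⁻ j∈) q≤2h small ⟩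
      (p + q) choose q
        ≡⟨ trans (cong (_choose q) (sym ∣∁S∣)) (sym (#family-0 S q)) ⟩
      #F ∎
      where
      l = suc j
      P = 2 ^ (l choose 2)

    terms : K * ∑ (upTo q) term ≤ #F
    terms = *-cancelˡ-≤ q (begin
      q * (K * ∑ (upTo q) term)       ≡⟨ *-assoc q K _ ⟨
      q * K * ∑ (upTo q) term         ≡⟨ ∑-*ˡ (upTo q) (q * K) term ⟨
      ∑ (upTo q) (λ j → q * K * term j) ≤⟨ ∑-mono-∈ (upTo q) each ⟩
      ∑ (upTo q) (λ _ → #F)           ≡⟨ ∑-const (upTo q) #F ⟩
      length (upTo q) * #F            ≡⟨ cong (_* #F) (length-upTo q) ⟩
      q * #F ∎)

  -- `C-steps` started at the coefficient `1` yields `p ^ q ≤ q ^ q * C(p + q, q)`, so the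
  -- coefficient cannot vanish. Chebyshev's inequality needs this to have a positive mean.
  #family-0>0 : ∀ {n} (S : Subset n) p q → ∣ ∁ S ∣ ≡ p + q → .{{NonZero p}} → 0 < #family S q 0
  #family-0>0 S p q ∣∁S∣ = subst (0 <_) (sym (trans (#family-0 S q) (cong (_choose q) ∣∁S∣)))
    (n≢0⇒n>0 λ C≡0 → n≮0 (<-≤-trans (m^n>0 p q) (begin
      p ^ q                         ≡⟨ *-identityˡ (p ^ q) ⟨
      1 * p ^ q                     ≡⟨ cong (_* p ^ q) (nC0≡1 (p + q)) ⟨
      ((p + q) choose 0) * p ^ q    ≤⟨ C-steps p q q 0 (≤-reflexive (+-identityʳ q)) ⟩
      q ^ q * ((p + q) choose (q + 0)) ≡⟨ cong (q ^ q *_) (trans (cong ((p + q) choose_) (+-identityʳ q)) C≡0) ⟩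
      q ^ q * 0                     ≡⟨ *-zeroʳ (q ^ q) ⟩
      0 ∎)))
    where open ≤-Reasoning

  ∈-graphs : ∀ {n} (G : Graph n) → G ∈ graphs n
  ∈-graphs []      = here refl
  ∈-graphs (N ∷ G) = ∈-cartesianProductWith⁺ _∷_ (∈-subsets N) (∈-graphs G)

  #graphs>0 : ∀ n → 0 < #graphs n
  #graphs>0 n = ∈⇒≤∑ (graphs n) (λ _ → 1) (∈-graphs (complete {n} Data.Fin.Subset.⊥))
    where import Data.Fin.Subset

  -- 1/K bounds the relative variance of W_{q,0} for q ≤ 2h.
  record Regime (n k h e c r K : ℕ) : Set where
    field
      K>0     : 0 < K
      r≤2h+1  : r ≤ suc (2 * h)
      k-small : k * 2 ^ (4 * r) ≤ n
      n≥      : 2 ^ (h + e) ≤ n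
      n≤      : n ≤ 2 ^ (h + e + c)
      room    : 2 * k + 4 * h ≤ n
      K-small : 2 * (2 * h * (2 * h) * (2 * h * K)) ≤ 2 ^ e
      h-small : 4 * h ≤ 2 ^ r
      e-small : (e + c) * suc (2 * h) ≤ 2 * (r * r)
      K≤      : K ≤ 2 ^ (r * r)

  module FixedClique {n k h e c r K : ℕ} (R : Regime n k h e c r K) (S : Subset n) (∣S∣≡k : ∣ S ∣ ≡ k) where
    open Regime R
    open ≤-Reasoning

    N = #graphs n
    m = ∣ ∁ S ∣
    X Y : ℕ → Graph n → ℕ
    X q G = cliqueCount G S q 0
    Y q G = cliqueCount G S q r
    E : ℕ → ℕ
    E q = ∑ (graphs n) (X q)

    k+m : k + m ≡ n
    k+m = trans (cong₂ _+_ (sym ∣S∣≡k) (∣∁p∣≡n∸∣p∣ S)) (m+[n∸m]≡n (∣p∣≤n S))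

    module Size (q : ℕ) (q≤2h : q ≤ 2 * h) where
      p = m ∸ q

      q≤m : q ≤ m
      q≤m = ≤-trans q≤2h (*-cancelˡ-≤ 2 (+-cancelˡ-≤ (2 * k) _ _ (begin
        2 * k + 2 * (2 * h)   ≡⟨ cong (2 * k +_) (sym (*-assoc 2 2 h)) ⟩
        2 * k + 4 * h         ≤⟨ room ⟩
        n                     ≡⟨ k+m ⟨
        k + m                 ≤⟨ +-mono-≤ (m≤n*m k 2) (m≤n*m m 2) ⟩
        2 * k + 2 * m         ∎)))

      m≡p+q : m ≡ p + q
      m≡p+q = sym (m∸n+n≡m q≤m)

      n≤2p : n ≤ 2 * p
      n≤2p = +-cancelʳ-≤ n n (2 * p) (begin
        n + n                     ≡⟨ cong (n +_) (trans (sym k+m) (cong (k +_) m≡p+q)) ⟩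
        n + (k + (p + q))         ≡⟨ cong (_+ (k + (p + q))) (trans (sym k+m) (cong (k +_) m≡p+q)) ⟩
        (k + (p + q)) + (k + (p + q)) ≡⟨ solve 3 (λ k p q → (k :+ (p :+ q)) :+ (k :+ (p :+ q)) := con 2 :* p :+ (con 2 :* k :+ con 2 :* q)) refl k p q ⟩
        2 * p + (2 * k + 2 * q)   ≤⟨ +-monoʳ-≤ (2 * p) (≤-trans (+-monoʳ-≤ (2 * k) (*-monoʳ-≤ 2 q≤2h)) (≤-trans (≤-reflexive (cong (2 * k +_) (sym (*-assoc 2 2 h)))) room)) ⟩
        2 * p + n ∎)

      instance
        p≢0 : NonZero p
        p≢0 = ≢-nonZero λ p≡0 → n≮0 (<-≤-trans (m^n>0 2 (h + e)) (≤-trans n≥ (subst (λ p → n ≤ 2 * p) p≡0 n≤2p)))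
        K≢0 : NonZero K
        K≢0 = >-nonZero K>0

      -- The slack between `2 ^ h` and `n` is spent here: `K-small` fits twice the polynomial factor
      -- into `2 ^ e`, and `2 ^ (h + e) ≤ n ≤ 2 * p`.
      small : q * q * (q * K) * 2 ^ h ≤ p
      small = *-cancelˡ-≤ 2 (begin
        2 * (q * q * (q * K) * 2 ^ h)   ≡⟨ *-assoc 2 (q * q * (q * K)) (2 ^ h) ⟨
        2 * (q * q * (q * K)) * 2 ^ h   ≤⟨ *-monoˡ-≤ (2 ^ h) (≤-trans (*-monoʳ-≤ 2 (*-mono-≤ (*-mono-≤ q≤2h q≤2h) (*-monoˡ-≤ K q≤2h))) K-small) ⟩
        2 ^ e * 2 ^ h                   ≡⟨ trans (*-comm (2 ^ e) (2 ^ h)) (sym (^-distribˡ-+-* 2 h e)) ⟩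
        2 ^ (h + e)                     ≤⟨ ≤-trans n≥ n≤2p ⟩
        2 * p                           ∎)

      F = #family S q 0
      P = 2 ^ (q choose 2)

      P≢0 : NonZero P
      P≢0 = 2^≢0 (q choose 2)

      E*P : E q * P ≡ F * N
      E*P = trans (∑-cliqueCount S q 0) (cong (F *_) (*-identityʳ N))

      F>0 : 0 < F
      F>0 = #family-0>0 S p q m≡p+q

      E>0 : 0 < E q
      E>0 = n≢0⇒n>0 λ E≡0 → n≮0 (subst (0 <_) (trans (sym E*P) (cong (_* P) E≡0)) (*-mono-< F>0 (#graphs>0 n)))

      variance : K * (N * ∑ (graphs n) (λ G → X q G * X q G)) ≤ suc K * (E q * E q)
      variance = *-cancelʳ-≤ _ _ (P * P) {{m*n≢0 P P {{P≢0}} {{P≢0}}}} (begin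
        K * (N * V) * (P * P)
          ≡⟨ solve 4 (λ K N V P → K :* (N :* V) :* (P :* P) := K :* N :* (V :* (P :* P))) refl K N V P ⟩
        K * N * (V * (P * P))
          ≤⟨ *-monoʳ-≤ (K * N) (∑-cliqueCount² S q) ⟩
        K * N * (N * ∑ (family S q 0) overlaps)
          ≡⟨ solve 3 (λ K N s → K :* N :* (N :* s) := N :* N :* (K :* s)) refl K N (∑ (family S q 0) overlaps) ⟩
        N * N * (K * ∑ (family S q 0) overlaps)
          ≡⟨ cong (N * N *_) (sym (∑-*ˡ (family S q 0) K overlaps)) ⟩
        N * N * ∑ (family S q 0) (λ C → K * overlaps C)
          ≤⟨ *-monoʳ-≤ (N * N) (∑-mono-∈ (family S q 0) (λ C C∈ → overlap-sum-≤ S C p q h K m≡p+q C∈ q≤2h small)) ⟩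
        N * N * ∑ (family S q 0) (λ _ → suc K * F)
          ≡⟨ cong (N * N *_) (∑-1*c (family S q 0) (suc K * F)) ⟩
        N * N * (F * (suc K * F))
          ≡⟨ solve 3 (λ N F K → N :* N :* (F :* (K :* F)) := K :* ((F :* N) :* (F :* N))) refl N F (suc K) ⟩
        suc K * ((F * N) * (F * N))
          ≡⟨ cong (λ x → suc K * (x * x)) (sym E*P) ⟩
        suc K * ((E q * P) * (E q * P))
          ≡⟨ solve 3 (λ K E P → K :* ((E :* P) :* (E :* P)) := K :* (E :* E) :* (P :* P)) refl (suc K) (E q) P ⟩
        suc K * (E q * E q) * (P * P) ∎)
        where
        V = ∑ (graphs n) (λ G → X q G * X q G)
        overlaps = λ C → ∑ (family S q 0) (λ C′ → 2 ^ (∣ C ∩ C′ ∣ choose 2))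

      few : K * ∑ (graphs n) (λ G → 𝟙 (does (2 * (N * X q G) <? E q))) ≤ 4 * N
      few = chebyshev (graphs n) (X q) K E>0 variance

      -- Replacing `r` outside vertices by planted ones changes the number of sets by at most
      -- `(k q / p) ^ r`. By `k 2^(4r) ≤ n ≤ 2p` this is at most `(2q) ^ r 2^(-4r²)`, and
      -- `2q ≤ 4h ≤ 2 ^ r` gives back one factor `2^(r²)`.
      #family-r-≤ : #family S q r * 2 ^ (3 * (r * r)) ≤ F
      #family-r-≤ with r ≤? q
      ... | no r≰q rewrite #family-empty S (≰⇒> r≰q) = z≤n
      ... | yes r≤q = *-cancelʳ-≤ _ _ (2 ^ (r * r) * p ^ r) {{m*n≢0 (2 ^ (r * r)) (p ^ r) {{2^≢0 (r * r)}} {{m^n≢0 p r}}}} (begin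
        #family S q r * 2 ^ (3 * (r * r)) * (2 ^ (r * r) * p ^ r)
          ≡⟨ solve 4 (λ f a b p → f :* a :* (b :* p) := f :* (a :* b) :* p) refl (#family S q r) (2 ^ (3 * (r * r))) (2 ^ (r * r)) (p ^ r) ⟩
        #family S q r * (2 ^ (3 * (r * r)) * 2 ^ (r * r)) * p ^ r
          ≡⟨ cong (λ x → #family S q r * x * p ^ r) (trans (sym (^-distribˡ-+-* 2 (3 * (r * r)) (r * r)))
              (trans (cong (2 ^_) (solve 1 (λ r → con 3 :* (r :* r) :+ r :* r := con 4 :* r :* r) refl r)) (sym (^-*-assoc 2 (4 * r) r)))) ⟩
        #family S q r * (2 ^ (4 * r)) ^ r * p ^ r
          ≤⟨ *-monoˡ-≤ (p ^ r) (*-monoˡ-≤ ((2 ^ (4 * r)) ^ r) (≤-trans (#family-≤ S q r) (*-monoˡ-≤ y (≤-trans (≤-reflexive (cong (_choose r) ∣S∣≡k)) (C≤^ k r))))) ⟩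
        k ^ r * y * (2 ^ (4 * r)) ^ r * p ^ r
          ≡⟨ solve 4 (λ a y b p → a :* y :* b :* p := a :* b :* (y :* p)) refl (k ^ r) y ((2 ^ (4 * r)) ^ r) (p ^ r) ⟩
        k ^ r * (2 ^ (4 * r)) ^ r * (y * p ^ r)
          ≡⟨ cong (_* (y * p ^ r)) (sym (^-distribʳ-* k (2 ^ (4 * r)) r)) ⟩
        (k * 2 ^ (4 * r)) ^ r * (y * p ^ r)
          ≤⟨ *-mono-≤ (^-monoˡ-≤ r (≤-trans k-small n≤2p)) y-step ⟩
        (2 * p) ^ r * (q ^ r * F)
          ≡⟨ cong (_* (q ^ r * F)) (^-distribʳ-* 2 p r) ⟩
        2 ^ r * p ^ r * (q ^ r * F)
          ≡⟨ solve 4 (λ a p b F → a :* p :* (b :* F) := F :* ((a :* b) :* p)) refl (2 ^ r) (p ^ r) (q ^ r) F ⟩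
        F * ((2 ^ r * q ^ r) * p ^ r)
          ≡⟨ cong (λ x → F * (x * p ^ r)) (sym (^-distribʳ-* 2 q r)) ⟩
        F * ((2 * q) ^ r * p ^ r)
          ≤⟨ *-monoʳ-≤ F (*-monoˡ-≤ (p ^ r) (^-monoˡ-≤ r (≤-trans (*-monoʳ-≤ 2 q≤2h) (≤-trans (≤-reflexive (sym (*-assoc 2 2 h))) h-small)))) ⟩
        F * ((2 ^ r) ^ r * p ^ r)
          ≡⟨ cong (λ x → F * (x * p ^ r)) (^-*-assoc 2 r r) ⟩
        F * (2 ^ (r * r) * p ^ r) ∎)
        where
        y = m choose (q ∸ r)
        y-step : y * p ^ r ≤ q ^ r * F
        y-step = begin
          y * p ^ r                                   ≡⟨ cong (λ m → (m choose (q ∸ r)) * p ^ r) m≡p+q ⟩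
          ((p + q) choose (q ∸ r)) * p ^ r            ≤⟨ C-steps p q r (q ∸ r) (≤-reflexive (m+[n∸m]≡n r≤q)) ⟩
          q ^ r * ((p + q) choose (r + (q ∸ r)))      ≡⟨ cong₂ (λ x y → q ^ r * (x choose y)) (sym m≡p+q) (m+[n∸m]≡n r≤q) ⟩
          q ^ r * (m choose q)                        ≡⟨ cong (q ^ r *_) (sym (#family-0 S q)) ⟩
          q ^ r * F                                   ∎

      -- The `r choose 2` free planted edges raise the probability by at most `2^(r²)`, which leaves
      -- two of the three factors gained in the number of sets.
      ∑Y-≤ : ∑ (graphs n) (Y q) * 2 ^ (2 * (r * r)) ≤ E q
      ∑Y-≤ = *-cancelʳ-≤ _ _ P {{P≢0}} (begin
        ∑ (graphs n) (Y q) * 2 ^ (2 * (r * r)) * P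
          ≡⟨ solve 3 (λ y a P → y :* a :* P := y :* P :* a) refl (∑ (graphs n) (Y q)) (2 ^ (2 * (r * r))) P ⟩
        ∑ (graphs n) (Y q) * P * 2 ^ (2 * (r * r))
          ≡⟨ cong (_* 2 ^ (2 * (r * r))) (∑-cliqueCount S q r) ⟩
        #family S q r * (N * 2 ^ (r choose 2)) * 2 ^ (2 * (r * r))
          ≤⟨ *-monoˡ-≤ (2 ^ (2 * (r * r))) (*-monoʳ-≤ (#family S q r) (*-monoʳ-≤ N (^-monoʳ-≤ 2 (nC2≤n*n r)))) ⟩
        #family S q r * (N * 2 ^ (r * r)) * 2 ^ (2 * (r * r))
          ≡⟨ solve 4 (λ f N a b → f :* (N :* a) :* b := f :* (a :* b) :* N) refl (#family S q r) N (2 ^ (r * r)) (2 ^ (2 * (r * r))) ⟩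
        #family S q r * (2 ^ (r * r) * 2 ^ (2 * (r * r))) * N
          ≡⟨ cong (λ x → #family S q r * x * N) (trans (sym (^-distribˡ-+-* 2 (r * r) (2 * (r * r))))
              (cong (2 ^_) (solve 1 (λ x → x :+ con 2 :* x := con 3 :* x) refl (r * r)))) ⟩
        #family S q r * 2 ^ (3 * (r * r)) * N
          ≤⟨ *-monoˡ-≤ N #family-r-≤ ⟩
        F * N
          ≡⟨ E*P ⟨
        E q * P ∎)

      M = 2 ^ (r * r)

      -- Of the two remaining factors `2^(r²)`, one goes into the ratio demanded of `X` and `Y`, the
      -- other into the failure probability through Markov's inequality. The threshold is half the
      -- mean of `X`, the same as in `few`.
      many : M * ∑ (graphs n) (λ G → 𝟙 (does (E q <? 2 * (N * (M * Y q G))))) ≤ 2 * N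
      many = *-cancelʳ-≤ _ _ (E q) {{>-nonZero E>0}} (begin
        M * B * E q
          ≡⟨ solve 3 (λ M B E → M :* B :* E := M :* (E :* B)) refl M B (E q) ⟩
        M * (E q * B)
          ≤⟨ *-monoʳ-≤ M (markov (graphs n) (λ G → 2 * (N * (M * Y q G))) (E q)) ⟩
        M * ∑ (graphs n) (λ G → 2 * (N * (M * Y q G)))
          ≡⟨ cong (M *_) (trans (∑-*ˡ (graphs n) 2 _) (cong (2 *_) (trans (∑-*ˡ (graphs n) N _) (cong (N *_) (∑-*ˡ (graphs n) M _))))) ⟩
        M * (2 * (N * (M * ∑ (graphs n) (Y q))))
          ≡⟨ solve 3 (λ M N y → M :* (con 2 :* (N :* (M :* y))) := con 2 :* N :* (y :* (M :* M))) refl M N (∑ (graphs n) (Y q)) ⟩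
        2 * N * (∑ (graphs n) (Y q) * (M * M))
          ≡⟨ cong (λ x → 2 * N * (∑ (graphs n) (Y q) * x)) (trans (sym (^-distribˡ-+-* 2 (r * r) (r * r))) (cong (λ x → 2 ^ (r * r + x)) (sym (+-identityʳ (r * r))))) ⟩
        2 * N * (∑ (graphs n) (Y q) * 2 ^ (2 * (r * r)))
          ≤⟨ *-monoʳ-≤ (2 * N) ∑Y-≤ ⟩
        2 * N * E q ∎)
        where
        B = ∑ (graphs n) (λ G → 𝟙 (does (E q <? 2 * (N * (M * Y q G)))))

    M = 2 ^ (r * r)
    q⁺ = suc (2 * h)

    -- At size `2h + 1` the edges cost exactly `2^(q⁺ h)`, against at most `2^(q⁺ (h + e + c))` from
    -- `n ^ q⁺`. The excess is at most `2^(2r²)` by `e-small`; the planted vertices save `2^(4r²)`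
    -- through `k-small`, and their free edges return at most `2^(r²)`. A factor `2^(-r²)` remains.
    few-top : M * ∑ (graphs n) (Y q⁺) ≤ N
    few-top = *-cancelʳ-≤ _ _ (2 ^ (q⁺ * h) * 2 ^ (4 * (r * r))) {{m*n≢0 (2 ^ (q⁺ * h)) (2 ^ (4 * (r * r))) {{2^≢0 (q⁺ * h)}} {{2^≢0 (4 * (r * r))}}}} (begin
      M * y * (2 ^ (q⁺ * h) * Q)
        ≡⟨ solve 4 (λ M y a Q → M :* y :* (a :* Q) := M :* Q :* (y :* a)) refl M y (2 ^ (q⁺ * h)) Q ⟩
      M * Q * (y * 2 ^ (q⁺ * h))
        ≡⟨ cong (λ x → M * Q * (y * 2 ^ x)) (sym ([1+2h]C2 h)) ⟩
      M * Q * (y * 2 ^ (q⁺ choose 2))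
        ≡⟨ cong (M * Q *_) (∑-cliqueCount S q⁺ r) ⟩
      M * Q * (#family S q⁺ r * (N * 2 ^ (r choose 2)))
        ≤⟨ *-monoʳ-≤ (M * Q) (*-mono-≤ family≤ (*-monoʳ-≤ N (^-monoʳ-≤ 2 (nC2≤n*n r)))) ⟩
      M * Q * (k ^ r * n ^ (q⁺ ∸ r) * (N * M))
        ≡⟨ solve 5 (λ M Q a b N → M :* Q :* (a :* b :* (N :* M)) := N :* (M :* M :* (a :* Q :* b))) refl M Q (k ^ r) (n ^ (q⁺ ∸ r)) N ⟩
      N * (M * M * (k ^ r * Q * n ^ (q⁺ ∸ r)))
        ≤⟨ *-monoʳ-≤ N (*-monoʳ-≤ (M * M) powers) ⟩
      N * (M * M * 2 ^ (q⁺ * (h + e + c)))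
        ≡⟨ cong (N *_) (trans (cong (_* 2 ^ (q⁺ * (h + e + c))) (sym (^-distribˡ-+-* 2 (r * r) (r * r)))) (sym (^-distribˡ-+-* 2 (r * r + r * r) _))) ⟩
      N * 2 ^ (r * r + r * r + q⁺ * (h + e + c))
        ≤⟨ *-monoʳ-≤ N (^-monoʳ-≤ 2 exponents) ⟩
      N * 2 ^ (q⁺ * h + 4 * (r * r))
        ≡⟨ cong (N *_) (^-distribˡ-+-* 2 (q⁺ * h) _) ⟩
      N * (2 ^ (q⁺ * h) * Q) ∎)
      where
      y = ∑ (graphs n) (Y q⁺)
      Q = 2 ^ (4 * (r * r))
      family≤ : #family S q⁺ r ≤ k ^ r * n ^ (q⁺ ∸ r)
      family≤ = ≤-trans (#family-≤ S q⁺ r) (*-mono-≤ (≤-trans (≤-reflexive (cong (_choose r) ∣S∣≡k)) (C≤^ k r))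
        (≤-trans (C≤^ m (q⁺ ∸ r)) (^-monoˡ-≤ (q⁺ ∸ r) (∣p∣≤n (∁ S)))))
      powers : k ^ r * Q * n ^ (q⁺ ∸ r) ≤ 2 ^ (q⁺ * (h + e + c))
      powers = begin
        k ^ r * Q * n ^ (q⁺ ∸ r)
          ≡⟨ cong (λ x → k ^ r * x * n ^ (q⁺ ∸ r)) (trans (cong (2 ^_) (sym (*-assoc 4 r r))) (sym (^-*-assoc 2 (4 * r) r))) ⟩
        k ^ r * (2 ^ (4 * r)) ^ r * n ^ (q⁺ ∸ r)
          ≡⟨ cong (_* n ^ (q⁺ ∸ r)) (^-distribʳ-* k (2 ^ (4 * r)) r) ⟨
        (k * 2 ^ (4 * r)) ^ r * n ^ (q⁺ ∸ r)
          ≤⟨ *-monoˡ-≤ (n ^ (q⁺ ∸ r)) (^-monoˡ-≤ r k-small) ⟩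
        n ^ r * n ^ (q⁺ ∸ r)
          ≡⟨ trans (sym (^-distribˡ-+-* n r (q⁺ ∸ r))) (cong (n ^_) (m+[n∸m]≡n r≤2h+1)) ⟩
        n ^ q⁺
          ≤⟨ ^-monoˡ-≤ q⁺ n≤ ⟩
        (2 ^ (h + e + c)) ^ q⁺
          ≡⟨ trans (^-*-assoc 2 (h + e + c) q⁺) (cong (2 ^_) (*-comm (h + e + c) q⁺)) ⟩
        2 ^ (q⁺ * (h + e + c)) ∎
      exponents : r * r + r * r + q⁺ * (h + e + c) ≤ q⁺ * h + 4 * (r * r)
      exponents = begin
        r * r + r * r + q⁺ * (h + e + c)
          ≡⟨ solve 5 (λ x q h e c → x :+ x :+ q :* (h :+ e :+ c) := q :* h :+ con 2 :* x :+ (e :+ c) :* q) refl (r * r) q⁺ h e c ⟩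
        q⁺ * h + 2 * (r * r) + (e + c) * q⁺
          ≤⟨ +-monoʳ-≤ (q⁺ * h + 2 * (r * r)) e-small ⟩
        q⁺ * h + 2 * (r * r) + 2 * (r * r)
          ≡⟨ solve 2 (λ a x → a :+ con 2 :* x :+ con 2 :* x := a :+ con 4 :* x) refl (q⁺ * h) (r * r) ⟩
        q⁺ * h + 4 * (r * r) ∎

  -- No parameter of the dynamics enters, so a single graph event serves all of them. The finite
  -- range of `q` makes it decidable, as required of the Boolean subevent in `MassAtLeast`.
  Good : ∀ {n} → Graph n → Subset n → ℕ → Set
  Good {n} G S r = ∀ (q : Fin (suc n)) → 2 ^ (r * r) * cliqueCount G S (toℕ q) r ≤ cliqueCount G S (toℕ q) 0

  good? : ∀ {n} (G : Graph n) S r → Dec (Good G S r)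
  good? G S r = all? λ q → 2 ^ (r * r) * cliqueCount G S (toℕ q) r ≤? cliqueCount G S (toℕ q) 0

  does-no : ∀ {p} {P : Set p} (P? : Dec P) → 𝟙 (does P?) < 1 → ¬ P
  does-no (no ¬p) _         = ¬p
  does-no (yes _) (s≤s ())

  does-yes : ∀ {p} {P : Set p} (P? : Dec P) → T (does P?) → P
  does-yes (yes p) _ = p

  𝟙-not-≤ : ∀ {p} {P : Set p} (P? : Dec P) {b} → (b < 1 → P) → 𝟙 (not (does P?)) ≤ b
  𝟙-not-≤ (yes _) _   = z≤n
  𝟙-not-≤ (no ¬p) b→p = ≮⇒≥ (λ b<1 → ¬p (b→p b<1))

  cliqueCount-vanishes : ∀ {n} (G : Graph n) S {p q} s → s ≤ p → p ≤ q →
    cliqueCount G S p s ≡ 0 → cliqueCount G S q s ≡ 0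
  cliqueCount-vanishes G S {p} {q} s s≤p p≤q none with cliqueCount G S q s in eq
  ... | zero  = refl
  ... | suc _ with 0<∑⇒∃ (family S q s) (λ C → does (isClique? (plant G S) C)) (subst (0 <_) (sym eq) z<s)
  ...   | C , C∈ , clique with ∈-family⁻ S q s C∈
  ...     | refl , refl with shrink C S p s≤p p≤q
  ...       | D , D⊆C , ∣D∣ , ∣D∩S∣ = contradiction
    (<-≤-trans (s≤s z≤n) (≤-trans (≤-reflexive (sym (𝟙-true (isClique? (plant G S) D) D-clique)))
      (≤-trans (∈⇒≤∑ (family S p s) (λ C → 𝟙 (does (isClique? (plant G S) C))) (∈-family⁺ S p s ∣D∣ ∣D∩S∣)) (≤-reflexive none)))) n≮0
    where
    𝟙-true : ∀ {P : Set} (P? : Dec P) → P → 𝟙 (does P?) ≡ 1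
    𝟙-true (yes _)  _ = refl
    𝟙-true (no ¬p) p = contradiction p ¬p
    C-clique : IsClique (plant G S) C
    C-clique = does-yes (isClique? (plant G S) C) clique
    D-clique : IsClique (plant G S) D
    D-clique u v u∈ v∈ = C-clique u v (D⊆C u∈) (D⊆C v∈)

  -- Union bound: each of the `2h + 1` sizes fails on at most `4N / K` graphs by Chebyshev and
  -- `2N / K` by Markov, and the size `2h + 1` adds at most `N / K`. Hence the constant
  -- `6 * suc (2 * h) + 1`.
  #bad-≤ : ∀ {n k h e c r K} → Regime n k h e c r K → ∀ t → (6 * suc (2 * h) + 1) * t ≤ K →
    ∀ (S : Subset n) → ∣ S ∣ ≡ k → t * ∑ (graphs n) (λ G → 𝟙 (not (does (good? G S r)))) ≤ #graphs n
  #bad-≤ {n} {k} {h} {e} {c} {r} {K} R t t≤K S ∣S∣≡k = *-cancelˡ-≤ (6 * q⁺ + 1) (begin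
    (6 * q⁺ + 1) * (t * B)
      ≡⟨ *-assoc (6 * q⁺ + 1) t B ⟨
    (6 * q⁺ + 1) * t * B
      ≤⟨ *-mono-≤ t≤K (∑-mono (graphs n) pointwise) ⟩
    K * ∑ (graphs n) bound
      ≡⟨ cong (K *_) (trans (∑-+ (graphs n) _ _) (cong (_+ ∑ (graphs n) (Y q⁺)) (trans (∑-swap (graphs n) (upTo q⁺) _) (∑-cong (upTo q⁺) (λ q → ∑-+ (graphs n) _ _))))) ⟩
    K * (∑ (upTo q⁺) (λ q → ∑ (graphs n) (λ G → 𝟙 (does (low q G))) + ∑ (graphs n) (λ G → 𝟙 (does (high q G)))) + ∑ (graphs n) (Y q⁺))
      ≡⟨ trans (*-distribˡ-+ K _ (∑ (graphs n) (Y q⁺))) (cong (_+ K * ∑ (graphs n) (Y q⁺)) (sym (∑-*ˡ (upTo q⁺) K _))) ⟩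
    ∑ (upTo q⁺) (λ q → K * (∑ (graphs n) (λ G → 𝟙 (does (low q G))) + ∑ (graphs n) (λ G → 𝟙 (does (high q G))))) + K * ∑ (graphs n) (Y q⁺)
      ≤⟨ +-mono-≤ (∑-mono-∈ (upTo q⁺) each) (≤-trans (*-monoˡ-≤ (∑ (graphs n) (Y q⁺)) K≤) (FixedClique.few-top R S ∣S∣≡k)) ⟩
    ∑ (upTo q⁺) (λ _ → 6 * N) + N
      ≡⟨ cong (_+ N) (trans (∑-const (upTo q⁺) (6 * N)) (cong (_* (6 * N)) (length-upTo q⁺))) ⟩
    q⁺ * (6 * N) + N
      ≡⟨ solve 2 (λ q N → q :* (con 6 :* N) :+ N := (con 6 :* q :+ con 1) :* N) refl q⁺ N ⟩
    (6 * q⁺ + 1) * N ∎)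
    where
    open ≤-Reasoning
    open Regime R
    q⁺ = suc (2 * h)
    N = #graphs n
    X Y : ℕ → Graph n → ℕ
    X q G = cliqueCount G S q 0
    Y q G = cliqueCount G S q r
    E : ℕ → ℕ
    E q = ∑ (graphs n) (X q)
    M = 2 ^ (r * r)
    B = ∑ (graphs n) (λ G → 𝟙 (not (does (good? G S r))))
    low : ∀ q G → Dec (2 * (N * X q G) < E q)
    low q G = 2 * (N * X q G) <? E q
    high : ∀ q G → Dec (E q < 2 * (N * (M * Y q G)))
    high q G = E q <? 2 * (N * (M * Y q G))
    -- All terms are natural numbers, so `bound G < 1` excludes every bad event at once; the count
    -- `Y q⁺ G` acts as the indicator of its own positivity.
    bound : Graph n → ℕ
    bound G = ∑ (upTo q⁺) (λ q → 𝟙 (does (low q G)) + 𝟙 (does (high q G))) + Y q⁺ G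

    each : ∀ q → q ∈ upTo q⁺ → K * (∑ (graphs n) (λ G → 𝟙 (does (low q G))) + ∑ (graphs n) (λ G → 𝟙 (does (high q G)))) ≤ 6 * N
    each q q∈ = begin
      K * (l + u)       ≡⟨ *-distribˡ-+ K l u ⟩
      K * l + K * u     ≤⟨ +-mono-≤ few (≤-trans (*-monoˡ-≤ u K≤) many) ⟩
      4 * N + 2 * N     ≡⟨ *-distribʳ-+ N 4 2 ⟨
      6 * N             ∎
      where
      open FixedClique.Size R S ∣S∣≡k q (s≤s⁻¹ (∈-upTo⁻ q∈)) using (few; many)
      l = ∑ (graphs n) (λ G → 𝟙 (does (low q G)))
      u = ∑ (graphs n) (λ G → 𝟙 (does (high q G)))

    good : ∀ G → bound G < 1 → Good G S r
    good G b<1 i with toℕ i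
    ... | q with q <? q⁺
    ...   | yes q<q⁺ = *-cancelˡ-≤ N {{>-nonZero (#graphs>0 n)}} (*-cancelˡ-≤ 2
              (≤-trans (≮⇒≥ (does-no (high q G) (≤-<-trans (m≤n+m _ (𝟙 (does (low q G)))) term<1)))
                       (≮⇒≥ (does-no (low q G) (≤-<-trans (m≤m+n _ _) term<1)))))
      where
      term<1 : 𝟙 (does (low q G)) + 𝟙 (does (high q G)) < 1
      term<1 = ≤-<-trans (≤-trans (∈⇒≤∑ (upTo q⁺) (λ q → 𝟙 (does (low q G)) + 𝟙 (does (high q G))) (∈-upTo⁺ q<q⁺)) (m≤m+n _ (Y q⁺ G))) b<1
    ...   | no q≮q⁺ = ≤-trans (≤-reflexive (trans (cong (M *_) (cliqueCount-vanishes G S r r≤2h+1 (≮⇒≥ q≮q⁺) top≡0)) (*-zeroʳ M))) z≤n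
      where
      top≡0 : Y q⁺ G ≡ 0
      top≡0 = n<1⇒n≡0 (≤-<-trans (m≤n+m (Y q⁺ G) _) b<1)

    pointwise : ∀ G → 𝟙 (not (does (good? G S r))) ≤ bound G
    pointwise G = 𝟙-not-≤ (good? G S r) (good G)

-- Order, minimum and exponential of the reals, constructively.

module Reals {c ℓ} (ℝ : RealField c ℓ) where
  open RealField ℝ hiding (∑)
  open import Data.Bool.Base using (Bool; true; false; if_then_else_)
  open import Data.Empty using (⊥-elim)
  open import Data.List.Base using (List; []; _∷_)
  open import Data.List.Membership.Propositional using (_∈_)
  open import Data.List.Relation.Unary.Any using (here; there)
  open import Data.Nat.Base as ℕ using (ℕ) renaming (zero to zeroℕ; suc to sucℕ)
  import Data.Nat.Properties as ℕ
  open import Data.Product.Base using (∃-syntax; _×_; _,_; proj₁; proj₂)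
  open import Data.Sum.Base using (inj₁; inj₂)
  open import Algebra.Morphism.Structures using (module MonoidMorphisms)
  open import Algebra.Properties.Monoid.Mult +-monoid using (×-homo-+)
  open import Algebra.Properties.Semiring.Mult semiring using (×1-homo-*)
  open import Algebra.Solver.Ring.NaturalCoefficients.Default commutativeSemiring using (solve; _:=_; _:+_; _:*_; con)
  open import Relation.Binary.PropositionalEquality.Core as ≡ using (_≡_)
  open import Relation.Binary.Structures using (IsStrictPartialOrder; IsPreorder)
  open import Relation.Nullary.Negation using (¬_)
  open ListSum commutativeSemiring

  open IsStrictPartialOrder isStrictPartialOrder public
    using (<-respʳ-≈; <-respˡ-≈; <-resp-≈)
    renaming (trans to <-trans; asym to <-asym; irrefl to <-irrefl)

  <⇒≤ : ∀ {x y} → x < y → x ≤ y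
  <⇒≤ = <-asym

  ≤-reflexive : ∀ {x y} → x ≈ y → x ≤ y
  ≤-reflexive x≈y y<x = <-irrefl (sym x≈y) y<x

  ≤-refl : ∀ {x} → x ≤ x
  ≤-refl = ≤-reflexive refl

  <-≤-trans : ∀ {x y z} → x < y → y ≤ z → x < z
  <-≤-trans {z = z} x<y y≤z with cotransitive x<y z
  ... | inj₁ x<z = x<z
  ... | inj₂ z<y = ⊥-elim (y≤z z<y)

  ≤-<-trans : ∀ {x y z} → x ≤ y → y < z → x < z
  ≤-<-trans {x} x≤y y<z with cotransitive y<z x
  ... | inj₁ y<x = ⊥-elim (x≤y y<x)
  ... | inj₂ x<z = x<z

  ≤-trans : ∀ {x y z} → x ≤ y → y ≤ z → x ≤ z
  ≤-trans x≤y y≤z z<x = x≤y (≤-<-trans y≤z z<x)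

  ≤-isPreorder : IsPreorder _≈_ _≤_
  ≤-isPreorder = record { isEquivalence = isEquivalence ; reflexive = ≤-reflexive ; trans = ≤-trans }

  module ≤-Reasoning where
    open import Relation.Binary.Reasoning.Base.Triple
      ≤-isPreorder <-asym <-trans <-resp-≈ <⇒≤ <-≤-trans ≤-<-trans public

  +-monoʳ-< : ∀ z {x y} → x < y → z + x < z + y
  +-monoʳ-< z x<y = <-respʳ-≈ (+-comm _ z) (<-respˡ-≈ (+-comm _ z) (+-monoˡ-< z x<y))

  x+y-y≈x : ∀ x y → (x + y) - y ≈ x
  x+y-y≈x x y = trans (+-assoc x y (- y)) (trans (+-congˡ (-‿inverseʳ y)) (+-identityʳ x))

  x-y+y≈x : ∀ x y → (x - y) + y ≈ x
  x-y+y≈x x y = trans (+-assoc x (- y) y) (trans (+-congˡ (-‿inverseˡ y)) (+-identityʳ x))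

  +-cancelʳ-< : ∀ z {x y} → x + z < y + z → x < y
  +-cancelʳ-< z lt = <-respʳ-≈ (x+y-y≈x _ z) (<-respˡ-≈ (x+y-y≈x _ z) (+-monoˡ-< (- z) lt))

  +-cancelˡ-< : ∀ z {x y} → z + x < z + y → x < y
  +-cancelˡ-< z lt = +-cancelʳ-< z (<-respʳ-≈ (+-comm z _) (<-respˡ-≈ (+-comm z _) lt))

  +-monoˡ-≤ : ∀ z {x y} → x ≤ y → x + z ≤ y + z
  +-monoˡ-≤ z x≤y lt = x≤y (+-cancelʳ-< z lt)

  +-monoʳ-≤ : ∀ z {x y} → x ≤ y → z + x ≤ z + y
  +-monoʳ-≤ z x≤y lt = x≤y (+-cancelˡ-< z lt)

  +-cancelʳ-≤ : ∀ z {x y} → x + z ≤ y + z → x ≤ y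
  +-cancelʳ-≤ z x+z≤y+z y<x = x+z≤y+z (+-monoˡ-< z y<x)

  +-mono-≤ : ∀ {x y u v} → x ≤ y → u ≤ v → x + u ≤ y + v
  +-mono-≤ {y = y} {u} x≤y u≤v = ≤-trans (+-monoˡ-≤ u x≤y) (+-monoʳ-≤ y u≤v)

  x≤x+y : ∀ x {y} → 0# ≤ y → x ≤ x + y
  x≤x+y x 0≤y = ≤-trans (≤-reflexive (sym (+-identityʳ x))) (+-monoʳ-≤ x 0≤y)

  x<y⇒0<y-x : ∀ {x y} → x < y → 0# < y - x
  x<y⇒0<y-x {x} x<y = <-respˡ-≈ (-‿inverseʳ x) (+-monoˡ-< (- x) x<y)

  0≤y-x : ∀ {x y} → x ≤ y → 0# ≤ y - x
  0≤y-x {x} x≤y = ≤-trans (≤-reflexive (sym (-‿inverseʳ x))) (+-monoˡ-≤ (- x) x≤y)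

  *-monoʳ-< : ∀ {z x y} → 0# < z → x < y → z * x < z * y
  *-monoʳ-< {z} {x} {y} 0<z x<y = <-respʳ-≈ (trans (sym (distribˡ z _ _)) (*-congˡ (x-y+y≈x y x)))
    (<-respˡ-≈ (+-identityˡ (z * x)) (+-monoˡ-< (z * x) (*-pos 0<z (x<y⇒0<y-x x<y))))

  x<0⇒x*y<0 : ∀ {x y} → x < 0# → 0# < y → y * x < 0#
  x<0⇒x*y<0 {y = y} x<0 0<y = <-respʳ-≈ (zeroʳ y) (*-monoʳ-< 0<y x<0)

  0≤*-cancel : ∀ {x y} → 0# < x → 0# ≤ x * y → 0# ≤ y
  0≤*-cancel 0<x 0≤xy y<0 = 0≤xy (x<0⇒x*y<0 y<0 0<x)

  -- Double-negated trichotomy suffices, because ≤ is a negation.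
  *-nonNeg : ∀ {x y} → 0# ≤ x → 0# ≤ y → 0# ≤ x * y
  *-nonNeg {x} {y} 0≤x 0≤y xy<0 = ¬0<x λ 0<x → 0≤y (≤⇒y<0 0<x)
    where
    ¬0<x : ¬ ¬ (0# < x)
    ¬0<x ¬0<x = <-irrefl refl (<-respˡ-≈ (trans (*-congʳ (≤-antisym ¬0<x 0≤x)) (zeroˡ y)) xy<0)
    ≤⇒y<0 : 0# < x → y < 0#
    ≤⇒y<0 0<x = ⊥-elim (¬0<y λ 0<y → <-asym xy<0 (*-pos 0<x 0<y))
      where
      ¬0<y : ¬ ¬ (0# < y)
      ¬0<y ¬0<y = <-irrefl refl (<-respˡ-≈ (trans (*-congˡ (≤-antisym ¬0<y 0≤y)) (zeroʳ x)) xy<0)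

  *-monoʳ-≤ : ∀ {z x y} → 0# ≤ z → x ≤ y → z * x ≤ z * y
  *-monoʳ-≤ {z} {x} {y} 0≤z x≤y = ≤-trans (≤-reflexive (sym (+-identityˡ (z * x))))
    (≤-trans (+-monoˡ-≤ (z * x) (*-nonNeg 0≤z (0≤y-x x≤y)))
      (≤-reflexive (trans (sym (distribˡ z _ _)) (*-congˡ (x-y+y≈x y x)))))

  *-monoˡ-≤ : ∀ {z x y} → 0# ≤ z → x ≤ y → x * z ≤ y * z
  *-monoˡ-≤ {z} {x} {y} 0≤z x≤y = ≤-trans (≤-reflexive (*-comm x z)) (≤-trans (*-monoʳ-≤ 0≤z x≤y) (≤-reflexive (*-comm z y)))

  *-mono-≤ : ∀ {x y u v} → 0# ≤ x → x ≤ y → 0# ≤ u → u ≤ v → x * u ≤ y * v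
  *-mono-≤ 0≤x x≤y 0≤u u≤v = ≤-trans (*-monoˡ-≤ 0≤u x≤y) (*-monoʳ-≤ (≤-trans 0≤x x≤y) u≤v)

  *-cancelˡ-≤ : ∀ {z x y} → 0# < z → z * x ≤ z * y → x ≤ y
  *-cancelˡ-≤ 0<z zx≤zy y<x = zx≤zy (*-monoʳ-< 0<z y<x)

  0≤1 : 0# ≤ 1#
  0≤1 = <⇒≤ 0<1

  0≤fromℕ : ∀ n → 0# ≤ fromℕ n
  0≤fromℕ zeroℕ    = ≤-refl
  0≤fromℕ (sucℕ n) = ≤-trans 0≤1 (x≤x+y 1# (0≤fromℕ n))

  fromℕ-+ : ∀ m n → fromℕ (m ℕ.+ n) ≈ fromℕ m + fromℕ n
  fromℕ-+ m n = ×-homo-+ 1# m n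

  fromℕ-* : ∀ m n → fromℕ (m ℕ.* n) ≈ fromℕ m * fromℕ n
  fromℕ-* m n = ×1-homo-* m n

  fromℕ-1 : fromℕ 1 ≈ 1#
  fromℕ-1 = +-identityʳ 1#

  fromℕ-mono-≤ : ∀ {m n} → m ℕ.≤ n → fromℕ m ≤ fromℕ n
  fromℕ-mono-≤ {n = n} ℕ.z≤n = 0≤fromℕ n
  fromℕ-mono-≤ (ℕ.s≤s m≤n)   = +-monoʳ-≤ 1# (fromℕ-mono-≤ m≤n)

  fromℕ-mono-< : ∀ {m n} → m ℕ.< n → fromℕ m < fromℕ n
  fromℕ-mono-< {m} m<n = <-≤-trans (<-respˡ-≈ (+-identityˡ _) (+-monoˡ-< (fromℕ m) 0<1)) (fromℕ-mono-≤ m<n)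

  fromℕ-cancel-≤ : ∀ {m n} → fromℕ m ≤ fromℕ n → m ℕ.≤ n
  fromℕ-cancel-≤ m≤n = ℕ.≮⇒≥ λ n<m → m≤n (fromℕ-mono-< n<m)

  fromℕ-cancel-< : ∀ {m n} → fromℕ m < fromℕ n → m ℕ.< n
  fromℕ-cancel-< m<n = ℕ.≰⇒> λ n≤m → fromℕ-mono-≤ n≤m m<n

  -- Cotransitivity compares `0 < x + n x` with `x`: either `x` is positive, or one summand cancels
  -- and the induction continues. Together with an Archimedean bound this extracts strict positivity
  -- of a factor, hence of inverses, without deciding signs.
  0<fromℕ*⇒0< : ∀ n {x} → 0# < fromℕ n * x → 0# < x
  0<fromℕ*⇒0< zeroℕ {x} 0<0x = ⊥-elim (<-irrefl (sym (zeroˡ x)) 0<0x)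
  0<fromℕ*⇒0< (sucℕ n) {x} 0<nx with cotransitive (<-respʳ-≈ (trans (distribʳ x 1# (fromℕ n)) (+-congʳ (*-identityˡ x))) 0<nx) x
  ... | inj₁ 0<x    = 0<x
  ... | inj₂ x<x+nx = 0<fromℕ*⇒0< n (+-cancelˡ-< x (<-respˡ-≈ (sym (+-identityʳ x)) x<x+nx))

  0<*⇒0< : ∀ {x y} → 0# ≤ y → 0# < x * y → 0# < y
  0<*⇒0< {x} {y} 0≤y 0<xy with archimedean x
  ... | n , x<n = 0<fromℕ*⇒0< n (<-≤-trans 0<xy (*-monoˡ-≤ 0≤y (<⇒≤ x<n)))

  0<⁻¹ : ∀ x (0<x : 0# < x) → 0# < x ⁻¹⟨ 0<x ⟩
  0<⁻¹ x 0<x = 0<*⇒0< (0≤*-cancel 0<x (<⇒≤ 0<x*x⁻¹)) 0<x*x⁻¹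
    where
    0<x*x⁻¹ : 0# < x * (x ⁻¹⟨ 0<x ⟩)
    0<x*x⁻¹ = <-respʳ-≈ (sym (*-inverseʳ x 0<x)) 0<1

  *-inverseˡ : ∀ x (0<x : 0# < x) → (x ⁻¹⟨ 0<x ⟩) * x ≈ 1#
  *-inverseˡ x 0<x = trans (*-comm _ x) (*-inverseʳ x 0<x)

  *-cancelˡ-< : ∀ {z x y} → 0# < z → z * x < z * y → x < y
  *-cancelˡ-< {z} {x} {y} 0<z lt = <-respʳ-≈ (z⁻¹zx y) (<-respˡ-≈ (z⁻¹zx x) (*-monoʳ-< (0<⁻¹ z 0<z) lt))
    where
    z⁻¹zx : ∀ x → (z ⁻¹⟨ 0<z ⟩) * (z * x) ≈ x
    z⁻¹zx x = trans (sym (*-assoc _ z x)) (trans (*-congʳ (*-inverseˡ z 0<z)) (*-identityˡ x))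

  private
    module exp = MonoidMorphisms.IsMonoidHomomorphism exp-isHomomorphism
  open exp public using () renaming (homo to exp-+; ε-homo to exp-0; ⟦⟧-cong to exp-cong)

  2⁻¹ : Carrier
  2⁻¹ = fromℕ 2 ⁻¹⟨ 0<fromℕ 2 ⟩

  2⁻¹+2⁻¹≈1 : 2⁻¹ + 2⁻¹ ≈ 1#
  2⁻¹+2⁻¹≈1 = trans (solve 1 (λ h → h :+ h := (con 1 :+ (con 1 :+ con 0)) :* h) refl 2⁻¹) (*-inverseʳ (fromℕ 2) (0<fromℕ 2))

  square-nonNeg : ∀ x → 0# ≤ x * x
  square-nonNeg x xx<0 = ¬neg λ x<0 → <-asym xx<0 (<-respʳ-≈ -x*-x≈x*x (*-pos (0<-x x<0) (0<-x x<0)))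
    where
    open import Algebra.Properties.Ring ring using (-‿distribˡ-*; -‿distribʳ-*; -‿involutive)
    0<-x : x < 0# → 0# < - x
    0<-x x<0 = <-respʳ-≈ (+-identityˡ (- x)) (x<y⇒0<y-x x<0)
    -x*-x≈x*x : - x * - x ≈ x * x
    -x*-x≈x*x = trans (sym (-‿distribˡ-* x (- x))) (trans (-‿cong (sym (-‿distribʳ-* x x))) (-‿involutive _))
    ¬neg : ¬ ¬ (x < 0#)
    ¬neg 0≤x = *-nonNeg 0≤x 0≤x xx<0

  exp*exp- : ∀ x → exp x * exp (- x) ≈ 1#
  exp*exp- x = trans (sym (exp-+ x (- x))) (trans (exp-cong (-‿inverseʳ x)) exp-0)

  -- `exp x` is the square of `exp (x / 2)`. Strict positivity then follows because its product with
  -- `exp (- x)` is `1#`.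
  0≤exp : ∀ x → 0# ≤ exp x
  0≤exp x = ≤-trans (square-nonNeg (exp (x * 2⁻¹))) (≤-reflexive
    (trans (sym (exp-+ (x * 2⁻¹) (x * 2⁻¹))) (exp-cong (trans (sym (distribˡ x 2⁻¹ 2⁻¹)) (trans (*-congˡ 2⁻¹+2⁻¹≈1) (*-identityʳ x))))))

  0<exp : ∀ x → 0# < exp x
  0<exp x = 0<*⇒0< (0≤exp x) (<-respʳ-≈ (sym (trans (*-comm _ (exp x)) (exp*exp- x))) 0<1)

  exp-split : ∀ x y → exp y ≈ exp x * exp (y - x)
  exp-split x y = trans (exp-cong (trans (sym (x-y+y≈x y x)) (+-comm (y - x) x))) (exp-+ x (y - x))

  exp-mono-≤ : ∀ {x y} → x ≤ y → exp x ≤ exp y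
  exp-mono-≤ {x} {y} x≤y = begin
    exp x                   ≈⟨ *-identityʳ (exp x) ⟨
    exp x * 1#              ≤⟨ *-monoʳ-≤ (0≤exp x) (≤-trans (x≤x+y 1# (0≤y-x x≤y)) (1+x≤exp (y - x))) ⟩
    exp x * exp (y - x)     ≈⟨ exp-split x y ⟨
    exp y                   ∎
    where open ≤-Reasoning

  exp-mono-< : ∀ {x y} → x < y → exp x < exp y
  exp-mono-< {x} {y} x<y = begin-strict
    exp x                   ≈⟨ *-identityʳ (exp x) ⟨
    exp x * 1#              <⟨ *-monoʳ-< (0<exp x) (<-≤-trans (<-respˡ-≈ (+-identityʳ 1#) (+-monoʳ-< 1# (x<y⇒0<y-x x<y))) (1+x≤exp (y - x))) ⟩
    exp x * exp (y - x)     ≈⟨ exp-split x y ⟨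
    exp y                   ∎
    where open ≤-Reasoning

  exp-cancel-≤ : ∀ {x y} → exp x ≤ exp y → x ≤ y
  exp-cancel-≤ ex≤ey y<x = ex≤ey (exp-mono-< y<x)

  exp-fromℕ* : ∀ n x m → exp x ≈ fromℕ m → exp (fromℕ n * x) ≈ fromℕ (m ℕ.^ n)
  exp-fromℕ* zeroℕ    x m eq = trans (exp-cong (zeroˡ x)) (trans exp-0 (sym fromℕ-1))
  exp-fromℕ* (sucℕ n) x m eq = trans (exp-cong (trans (distribʳ x 1# (fromℕ n)) (+-congʳ (*-identityˡ x))))
    (trans (exp-+ x (fromℕ n * x)) (trans (*-cong eq (exp-fromℕ* n x m eq)) (sym (fromℕ-* m (m ℕ.^ n)))))

  ⊓-≤ˡ : ∀ x y → x ⊓ y ≤ x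
  ⊓-≤ˡ x y = proj₁ (⊓-infimum x y)

  ⊓-≤ʳ : ∀ x y → x ⊓ y ≤ y
  ⊓-≤ʳ x y = proj₁ (proj₂ (⊓-infimum x y))

  ⊓-glb : ∀ {x y z} → z ≤ x → z ≤ y → z ≤ x ⊓ y
  ⊓-glb {x} {y} {z} = proj₂ (proj₂ (⊓-infimum x y)) z

  ⊓-cong : ∀ {x x′ y y′} → x ≈ x′ → y ≈ y′ → x ⊓ y ≈ x′ ⊓ y′
  ⊓-cong {x} {x′} {y} {y′} x≈ y≈ = ≤-antisym
    (⊓-glb (≤-trans (⊓-≤ˡ x y) (≤-reflexive x≈)) (≤-trans (⊓-≤ʳ x y) (≤-reflexive y≈)))
    (⊓-glb (≤-trans (⊓-≤ˡ x′ y′) (≤-reflexive (sym x≈))) (≤-trans (⊓-≤ʳ x′ y′) (≤-reflexive (sym y≈))))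

  ⊓-comm : ∀ x y → x ⊓ y ≈ y ⊓ x
  ⊓-comm x y = ≤-antisym (⊓-glb (⊓-≤ʳ x y) (⊓-≤ˡ x y)) (⊓-glb (⊓-≤ʳ y x) (⊓-≤ˡ y x))

  *-distribˡ-⊓ : ∀ {z} → 0# < z → ∀ x y → z * (x ⊓ y) ≈ (z * x) ⊓ (z * y)
  *-distribˡ-⊓ {z} 0<z x y = ≤-antisym
    (⊓-glb (*-monoʳ-≤ (<⇒≤ 0<z) (⊓-≤ˡ x y)) (*-monoʳ-≤ (<⇒≤ 0<z) (⊓-≤ʳ x y)))
    (≤-trans (≤-reflexive (sym (zz⁻¹ m)))
      (*-monoʳ-≤ (<⇒≤ 0<z) (⊓-glb (below (⊓-≤ˡ (z * x) (z * y))) (below (⊓-≤ʳ (z * x) (z * y))))))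
    where
    m = (z * x) ⊓ (z * y)
    z⁻¹ = z ⁻¹⟨ 0<z ⟩
    zz⁻¹ : ∀ w → z * (z⁻¹ * w) ≈ w
    zz⁻¹ w = trans (sym (*-assoc z z⁻¹ w)) (trans (*-congʳ (*-inverseʳ z 0<z)) (*-identityˡ w))
    below : ∀ {w} → m ≤ z * w → z⁻¹ * m ≤ w
    below m≤zw = *-cancelˡ-≤ 0<z (≤-trans (≤-reflexive (zz⁻¹ m)) m≤zw)

  module _ {a} {A : Set a} where
    ∑-mono-∈ : ∀ (xs : List A) {f g : A → Carrier} → (∀ x → x ∈ xs → f x ≤ g x) → ∑ xs f ≤ ∑ xs g
    ∑-mono-∈ []       f≤g = ≤-refl
    ∑-mono-∈ (x ∷ xs) f≤g = +-mono-≤ (f≤g x (here ≡.refl)) (∑-mono-∈ xs (λ y y∈ → f≤g y (there y∈)))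

    ∑-mono : ∀ (xs : List A) {f g : A → Carrier} → (∀ x → f x ≤ g x) → ∑ xs f ≤ ∑ xs g
    ∑-mono xs f≤g = ∑-mono-∈ xs (λ x _ → f≤g x)

    ∑-nonNeg : ∀ (xs : List A) {f : A → Carrier} → (∀ x → 0# ≤ f x) → 0# ≤ ∑ xs f
    ∑-nonNeg xs 0≤f = ≤-trans (≤-reflexive (sym (∑-0 xs))) (∑-mono xs 0≤f)

    -- Averaging without excluded middle: cotransitivity places the mixed sum `g x + ∑ xs f`
    -- relative to the two sums and so decides whether the head or the tail contains a witness. This
    -- is how the initial pair is found.
    ∑<∑⇒∃ : ∀ (xs : List A) {f g : A → Carrier} → ∑ xs f < ∑ xs g → ∃[ x ] x ∈ xs × f x < g x
    ∑<∑⇒∃ [] lt = ⊥-elim (<-irrefl refl lt)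
    ∑<∑⇒∃ (x ∷ xs) {f} {g} lt with cotransitive lt (g x + ∑ xs f)
    ... | inj₁ p = x , here ≡.refl , +-cancelʳ-< (∑ xs f) p
    ... | inj₂ p with ∑<∑⇒∃ xs (+-cancelˡ-< (g x) p)
    ...   | y , y∈ , fy<gy = y , there y∈ , fy<gy

  if-nonNeg : ∀ (b : Bool) {x} → 0# ≤ x → 0# ≤ (if b then x else 0#)
  if-nonNeg true  0≤x = 0≤x
  if-nonNeg false _   = ≤-refl

  if-mono : ∀ (b : Bool) {x y} → x ≤ y → (if b then x else 0#) ≤ (if b then y else 0#)
  if-mono true  x≤y = x≤y
  if-mono false _   = ≤-refl

-- Escape from a region of a reversible chain through a light boundary.

module Bottleneck {c ℓ} (ℝ : RealField c ℓ) where
  open RealField ℝ hiding (∑)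
  open Reals ℝ
  open import Data.Bool.Base using (Bool; true; false; if_then_else_; not)
  open import Data.List.Base using (List)
  open import Data.List.Membership.Propositional using (_∈_)
  open import Data.Nat.Base as ℕ using (ℕ) renaming (zero to zeroℕ; suc to sucℕ)
  import Data.Nat.Properties as ℕ
  open import Data.Product.Base using (∃-syntax; _×_; _,_)
  open import Relation.Binary.PropositionalEquality.Core as ≡ using (_≡_)
  open import Algebra.Solver.Ring.NaturalCoefficients.Default commutativeSemiring using (solve; _:=_; _:+_; _:*_; con)
  open import Data.Empty using (⊥-elim)
  open ListSum commutativeSemiring
  open ≤-Reasoning

  -- The probability that the next `t` states all lie in `A`. The starting state is not tested.
  stay : ∀ {a} {S : Set a} → List S → (S → S → Carrier) → (S → Bool) → ℕ → S → Carrier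
  stay xs P A zeroℕ    s = 1#
  stay xs P A (sucℕ t) s = ∑ xs (λ s′ → if A s′ then P s s′ * stay xs P A t s′ else 0#)

  if-split : ∀ (b : Bool) x → (if b then x else 0#) + (if not b then x else 0#) ≈ x
  if-split true  x = +-identityʳ x
  if-split false x = +-identityˡ x

  if-≤ : ∀ (b : Bool) {x} → 0# ≤ x → (if b then x else 0#) ≤ x
  if-≤ true  _   = ≤-refl
  if-≤ false 0≤x = 0≤x

  record ReversibleChain {a} {S : Set a} (xs : List S) (P : S → S → Carrier) (π : S → Carrier) : Set (a ⊔ c ⊔ ℓ) where
    field
      P-nonNeg  : ∀ {s} s′ → s ∈ xs → 0# ≤ P s s′
      ∑P≈1      : ∀ {s} → s ∈ xs → ∑ xs (P s) ≈ 1#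
      balance   : ∀ {s s′} → s ∈ xs → s′ ∈ xs → π s * P s s′ ≈ π s′ * P s′ s
      π-pos     : ∀ s → 0# < π s

  module _ {a} {S : Set a} {xs : List S} {P : S → S → Carrier} {π : S → Carrier}
    (chain : ReversibleChain xs P π) (A B : S → Bool)
    (exit : ∀ s s′ → A s ≡ true → A s′ ≡ false → B s′ ≡ false → P s s′ ≈ 0#) where
    open ReversibleChain chain

    private
      u : ℕ → S → Carrier
      u = stay xs P A

      mass : (S → Bool) → Carrier
      mass E = ∑ xs (λ s → if E s then π s else 0#)

      0≤π : ∀ s → 0# ≤ π s
      0≤π s = <⇒≤ (π-pos s)

    stay-nonNeg : ∀ t {s} → s ∈ xs → 0# ≤ u t s
    stay-nonNeg zeroℕ    _  = 0≤1
    stay-nonNeg (sucℕ t) s∈ = ≤-trans (≤-reflexive (sym (∑-0 xs)))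
      (∑-mono-∈ xs (λ s′ s′∈ → if-nonNeg (A s′) (*-nonNeg (P-nonNeg s′ s∈) (stay-nonNeg t s′∈))))

    stay-≤1 : ∀ t {s} → s ∈ xs → u t s ≤ 1#
    stay-≤1 zeroℕ    _  = ≤-refl
    stay-≤1 (sucℕ t) {s} s∈ = ≤-trans (∑-mono-∈ xs (λ s′ s′∈ →
      ≤-trans (if-≤ (A s′) (*-nonNeg (P-nonNeg s′ s∈) (stay-nonNeg t s′∈)))
        (≤-trans (*-monoʳ-≤ (P-nonNeg s′ s∈) (stay-≤1 t s′∈)) (≤-reflexive (*-identityʳ _)))))
      (≤-reflexive (∑P≈1 s∈))

    stay-decreasing : ∀ t {s} → s ∈ xs → u (sucℕ t) s ≤ u t s
    stay-decreasing zeroℕ    s∈ = stay-≤1 1 s∈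
    stay-decreasing (sucℕ t) s∈ = ∑-mono-∈ xs (λ s′ s′∈ → if-mono (A s′) (*-monoʳ-≤ (P-nonNeg s′ s∈) (stay-decreasing t s′∈)))

    stay-antitone : ∀ {t T s} → t ℕ.≤ T → s ∈ xs → u T s ≤ u t s
    stay-antitone {t} {T} {s} t≤T s∈ = ≡.subst (λ T → u T s ≤ u t s) (ℕ.m∸n+n≡m t≤T) (steps (T ℕ.∸ t))
      where
      steps : ∀ d → u (d ℕ.+ t) s ≤ u t s
      steps zeroℕ    = ≤-refl
      steps (sucℕ d) = ≤-trans (stay-decreasing (d ℕ.+ t) s∈) (steps d)

    stayMass : ℕ → Carrier
    stayMass t = ∑ xs (λ s → if A s then π s * u t s else 0#)

    private
      to-A to-Aᶜ : S → Carrier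
      to-A  s = ∑ xs (λ s′ → if A s′ then P s s′ else 0#)
      to-Aᶜ s = ∑ xs (λ s′ → if not (A s′) then P s s′ else 0#)

      to-A+to-Aᶜ : ∀ {s} → s ∈ xs → to-A s + to-Aᶜ s ≈ 1#
      to-A+to-Aᶜ {s} s∈ = trans (sym (∑-+ xs _ _)) (trans (∑-cong xs (λ s′ → if-split (A s′) (P s s′))) (∑P≈1 s∈))

      escape : Carrier
      escape = ∑ xs (λ s → if A s then π s * to-Aᶜ s else 0#)

      -- By detailed balance the chain restricted to `A` is self-adjoint for `π`. The additional
      -- first step can therefore be run backwards, and it becomes a step out of the state at which
      -- the remaining `t` steps begin.
      stayMass-suc : ∀ t → stayMass (sucℕ t) ≈ ∑ xs (λ s′ → if A s′ then π s′ * u t s′ * to-A s′ else 0#)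
      stayMass-suc t = begin-equality
        ∑ xs (λ s → if A s then π s * u (sucℕ t) s else 0#)
          ≈⟨ ∑-cong xs (λ s → trans (if-cong (A s) (sym (∑-*ˡ xs (π s) _))) (if-∑ (A s) xs _)) ⟩
        ∑ xs (λ s → ∑ xs (λ s′ → if A s then π s * (if A s′ then P s s′ * u t s′ else 0#) else 0#))
          ≈⟨ ∑-swap xs xs _ ⟩
        ∑ xs (λ s′ → ∑ xs (λ s → if A s then π s * (if A s′ then P s s′ * u t s′ else 0#) else 0#))
          ≈⟨ ∑-cong-∈ xs (λ s′ s′∈ → trans (∑-cong-∈ xs (λ s s∈ → swapped s s′ s∈ s′∈)) (trans (sym (if-∑ (A s′) xs _)) (if-cong (A s′) (∑-*ˡ xs (π s′ * u t s′) _)))) ⟩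
        ∑ xs (λ s′ → if A s′ then π s′ * u t s′ * to-A s′ else 0#) ∎
        where
        swapped : ∀ s s′ → s ∈ xs → s′ ∈ xs →
          (if A s then π s * (if A s′ then P s s′ * u t s′ else 0#) else 0#) ≈
          (if A s′ then π s′ * u t s′ * (if A s then P s′ s else 0#) else 0#)
        swapped s s′ s∈ s′∈ with A s | A s′
        ... | true  | true  = begin-equality
          π s * (P s s′ * u t s′)     ≈⟨ *-assoc (π s) _ _ ⟨
          π s * P s s′ * u t s′       ≈⟨ *-congʳ (balance s∈ s′∈) ⟩
          π s′ * P s′ s * u t s′      ≈⟨ solve 3 (λ p q u → p :* q :* u := p :* u :* q) refl (π s′) (P s′ s) (u t s′) ⟩
          π s′ * u t s′ * P s′ s      ∎
        ... | true  | false = zeroʳ _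
        ... | false | true  = sym (zeroʳ _)
        ... | false | false = refl

      -- Each step loses `π s * u t s * to-Aᶜ s`. As `u t s ≤ 1`, this is at most the stationary
      -- flow out of `A`, a bound that does not depend on `t`.
      stayMass-step : ∀ t → stayMass t ≤ stayMass (sucℕ t) + escape
      stayMass-step t = begin
        ∑ xs (λ s → if A s then π s * u t s else 0#)
          ≈⟨ ∑-cong-∈ xs (λ s s∈ → trans (if-cong (A s) (trans (sym (*-identityʳ _)) (trans (*-congˡ (sym (to-A+to-Aᶜ s∈))) (distribˡ _ _ _)))) (if-+ (A s) _ _)) ⟩
        ∑ xs (λ s → (if A s then π s * u t s * to-A s else 0#) + (if A s then π s * u t s * to-Aᶜ s else 0#))
          ≈⟨ ∑-+ xs _ _ ⟩
        ∑ xs (λ s → if A s then π s * u t s * to-A s else 0#) + ∑ xs (λ s → if A s then π s * u t s * to-Aᶜ s else 0#)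
          ≤⟨ +-mono-≤ (≤-reflexive (sym (stayMass-suc t))) (∑-mono-∈ xs (λ s s∈ → if-mono (A s) (*-monoˡ-≤ (0≤to-Aᶜ s∈)
              (≤-trans (*-monoʳ-≤ (0≤π s) (stay-≤1 t s∈)) (≤-reflexive (*-identityʳ _)))))) ⟩
        stayMass (sucℕ t) + escape ∎
        where
        if-+ : ∀ (b : Bool) x y → (if b then x + y else 0#) ≈ (if b then x else 0#) + (if b then y else 0#)
        if-+ true  x y = refl
        if-+ false x y = sym (+-identityˡ 0#)
        0≤to-Aᶜ : ∀ {s} → s ∈ xs → 0# ≤ to-Aᶜ s
        0≤to-Aᶜ s∈ = ∑-nonNeg xs (λ s′ → if-nonNeg (not (A s′)) (P-nonNeg s′ s∈))

      -- By reversibility the flow out of A equals the flow into A, which passes through B.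
      escape-≤ : escape ≤ mass B
      escape-≤ = begin
        ∑ xs (λ s → if A s then π s * to-Aᶜ s else 0#)
          ≈⟨ ∑-cong xs (λ s → trans (if-cong (A s) (sym (∑-*ˡ xs (π s) _))) (if-∑ (A s) xs _)) ⟩
        ∑ xs (λ s → ∑ xs (λ s′ → if A s then π s * (if not (A s′) then P s s′ else 0#) else 0#))
          ≈⟨ ∑-swap xs xs _ ⟩
        ∑ xs (λ s′ → ∑ xs (λ s → if A s then π s * (if not (A s′) then P s s′ else 0#) else 0#))
          ≤⟨ ∑-mono-∈ xs (λ s′ s′∈ → ≤-trans (∑-mono-∈ xs (λ s s∈ → through s s′ s∈ s′∈))
              (≤-reflexive (trans (sym (if-∑ (B s′) xs _)) (if-cong (B s′) (trans (∑-*ˡ xs (π s′) _) (trans (*-congˡ (∑P≈1 s′∈)) (*-identityʳ _))))))) ⟩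
        mass B ∎
        where
        through : ∀ s s′ → s ∈ xs → s′ ∈ xs →
          (if A s then π s * (if not (A s′) then P s s′ else 0#) else 0#) ≤ (if B s′ then π s′ * P s′ s else 0#)
        through s s′ s∈ s′∈ with A s in As | A s′ in As′ | B s′ in Bs′
        ... | true  | true  | b     = ≤-trans (≤-reflexive (zeroʳ _)) (if-nonNeg b (*-nonNeg (0≤π s′) (P-nonNeg s s′∈)))
        ... | true  | false | true  = ≤-reflexive (balance s∈ s′∈)
        ... | true  | false | false = ≤-reflexive (trans (*-congˡ (exit s s′ As As′ Bs′)) (zeroʳ _))
        ... | false | _     | b     = if-nonNeg b (*-nonNeg (0≤π s′) (P-nonNeg s s′∈))

    stayMass-≥ : ∀ t → stayMass 0 ≤ stayMass t + fromℕ t * mass B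
    stayMass-≥ zeroℕ    = ≤-reflexive (sym (trans (+-congˡ (zeroˡ _)) (+-identityʳ _)))
    stayMass-≥ (sucℕ t) = begin
      stayMass 0                                    ≤⟨ stayMass-≥ t ⟩
      stayMass t + fromℕ t * b                      ≤⟨ +-monoˡ-≤ _ (≤-trans (stayMass-step t) (+-monoʳ-≤ (stayMass (sucℕ t)) escape-≤)) ⟩
      (stayMass (sucℕ t) + b) + fromℕ t * b         ≈⟨ solve 3 (λ m b t → (m :+ b) :+ t :* b := m :+ (con 1 :+ t) :* b) refl (stayMass (sucℕ t)) b (fromℕ t) ⟩
      stayMass (sucℕ t) + fromℕ (sucℕ t) * b        ∎
      where b = mass B

    -- If B is much lighter than A, the average of u T over A is close to 1; so is one of its values.
    ∃-stay : ∀ T M → T ℕ.* T ℕ.< M → 0# < mass A → fromℕ M * mass B ≤ mass A →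
      ∃[ s ] s ∈ xs × A s ≡ true × fromℕ T < fromℕ T * u T s + 1#
    ∃-stay T M T²<M 0<A MB≤A with ∑<∑⇒∃ xs {λ s → if A s then π s * fromℕ T else 0#} {λ s → if A s then π s * (fromℕ T * u T s + 1#) else 0#} average
      where
      mA mB : Carrier
      mA = mass A
      mB = mass B
      T′ = fromℕ T

      instance
        M≢0 : ℕ.NonZero M
        M≢0 = ℕ.>-nonZero (ℕ.≤-<-trans ℕ.z≤n T²<M)

      -- The loss over `T` steps is at most `T * mB`. To make it less than a fraction `1/T` of `mA`,
      -- the factor `T` is needed a second time, whence `T² < M`.
      T²b<mA : fromℕ (T ℕ.* T) * mB < mA
      T²b<mA = *-cancelˡ-< (0<fromℕ M) (begin-strict
        fromℕ M * (fromℕ (T ℕ.* T) * mB)   ≈⟨ solve 3 (λ m t b → m :* (t :* b) := t :* (m :* b)) refl (fromℕ M) (fromℕ (T ℕ.* T)) mB ⟩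
        fromℕ (T ℕ.* T) * (fromℕ M * mB)   ≤⟨ *-monoʳ-≤ (0≤fromℕ (T ℕ.* T)) MB≤A ⟩
        fromℕ (T ℕ.* T) * mA               ≈⟨ *-comm _ mA ⟩
        mA * fromℕ (T ℕ.* T)               <⟨ *-monoʳ-< 0<A (fromℕ-mono-< T²<M) ⟩
        mA * fromℕ M                       ≈⟨ *-comm mA _ ⟩
        fromℕ M * mA                       ∎)

      stayMass-0 : stayMass 0 ≈ mA
      stayMass-0 = ∑-cong xs (λ s → if-cong (A s) (*-identityʳ (π s)))

      average : ∑ xs (λ s → if A s then π s * T′ else 0#) < ∑ xs (λ s → if A s then π s * (T′ * u T s + 1#) else 0#)
      average = begin-strict
        ∑ xs (λ s → if A s then π s * T′ else 0#)
          ≈⟨ trans (∑-cong xs (λ s → sym (if-*ʳ (A s) (π s) T′))) (trans (∑-*ʳ xs T′ _) (*-comm mA T′)) ⟩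
        T′ * mA
          ≤⟨ *-monoʳ-≤ (0≤fromℕ T) (≤-trans (≤-reflexive (sym stayMass-0)) (stayMass-≥ T)) ⟩
        T′ * (stayMass T + T′ * mB)
          ≈⟨ trans (distribˡ T′ _ _) (+-congˡ (trans (sym (*-assoc T′ T′ mB)) (*-congʳ (sym (fromℕ-* T T))))) ⟩
        T′ * stayMass T + fromℕ (T ℕ.* T) * mB
          <⟨ +-monoʳ-< (T′ * stayMass T) T²b<mA ⟩
        T′ * stayMass T + mA
          ≈⟨ trans (+-congʳ (sym (∑-*ˡ xs T′ _))) (sym (∑-+ xs _ _)) ⟩
        ∑ xs (λ s → T′ * (if A s then π s * u T s else 0#) + (if A s then π s else 0#))
          ≈⟨ ∑-cong xs collect ⟩
        ∑ xs (λ s → if A s then π s * (T′ * u T s + 1#) else 0#) ∎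
        where
        collect : ∀ s → T′ * (if A s then π s * u T s else 0#) + (if A s then π s else 0#) ≈ (if A s then π s * (T′ * u T s + 1#) else 0#)
        collect s with A s
        ... | true  = solve 3 (λ t p u → t :* (p :* u) :+ p := p :* (t :* u :+ con 1)) refl T′ (π s) (u T s)
        ... | false = trans (+-identityʳ _) (zeroʳ T′)
    ... | s , s∈ , lt with A s in As
    ...   | true  = s , s∈ , As , *-cancelˡ-< (π-pos s) lt
    ...   | false = ⊥-elim (<-irrefl refl lt)

-- Neighbour sums, changes of overlap and case lemmas for transition rates.

module Tempering {c ℓ} (ℝ : RealField c ℓ) where
  open RealField ℝ hiding (∑; zero)
  open Reals ℝ
  open Bottleneck ℝ
  open RandomGraph using (Good; cliqueCount; family; ∈-subsets; hasOverlap?)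
  open CliqueCount using (𝟙)
  open import Data.Bool.Base using (Bool; true; false; if_then_else_; T; _∧_)
  open import Data.Bool.Properties using (T-∧)
  import Data.Bool.Properties as Bool
  open import Data.Fin.Base as Fin using (Fin; zero; suc; toℕ; fromℕ<)
  import Data.Fin.Properties as Fin
  open import Data.Fin.Subset using (Subset; inside; outside; _∩_; _─_; ∣_∣) renaming (⊥ to ∅)
  open import Data.Fin.Subset.Properties using (∪-comm; ∣p∣≤n; ∉⊥; ∣p∩q∣≤∣p∣; ∣⊥∣≡0)
  open import Data.List.Base using (List; []; _∷_; filter; allFin)
  open import Data.List.Properties using (map-tabulate)
  open import Data.List.Membership.Propositional using (_∈_)
  open import Data.List.Membership.Propositional.Properties using (∈-filter⁺; ∈-filter⁻; ∈-cartesianProduct⁺; ∈-cartesianProduct⁻; ∈-allFin)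
  open import Data.List.Relation.Unary.Any using (here; there)
  open import Data.List.Relation.Unary.All using ([]; _∷_)
  open import Data.List.Relation.Unary.AllPairs using ([]; _∷_)
  open import Data.List.Relation.Unary.Unique.Propositional using (Unique)
  import Data.List.Relation.Unary.Unique.Propositional.Properties as Unique
  open import Data.Nat.Base using (s≤s; z≤n) renaming (∣_-_∣ to dist)
  open import Data.Product.Base using (∃-syntax; Σ-syntax; _×_; _,_; proj₁; proj₂)
  open import Data.Vec.Base as Vec using (Vec; []; _∷_)
  import Data.Vec.Properties as Vec
  open import Data.Vec.Relation.Unary.All as VecAll using (All; []; _∷_)
  open import Function.Base using (_∘_; id)
  open import Function.Bundles using (module Equivalence; mk⇔)
  open import Relation.Binary.PropositionalEquality.Core as ≡ using (_≡_; _≢_)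
  open import Relation.Nullary.Decidable using (Dec; yes; no; does; _×-dec_; does-⇔)
  open import Relation.Nullary.Negation using (¬_; contradiction)
  open import Algebra.Solver.Ring.NaturalCoefficients.Default commutativeSemiring using (solve; _:=_; _:+_; _:*_; con)
  open ListSum commutativeSemiring
  module ℕ∑ = ListSum ℕ.+-*-commutativeSemiring

  subsets-unique : ∀ n → Unique (subsets n)
  subsets-unique ℕ.zero    = [] ∷ []
  subsets-unique (ℕ.suc n) = Unique.cartesianProductWith⁺ _∷_ Vec.∷-injective
    (((λ ()) ∷ []) ∷ [] ∷ []) (subsets-unique n)

  ∈⇒≤∑ : ∀ {a} {A : Set a} (xs : List A) {f : A → Carrier} {x} → (∀ y → 0# ≤ f y) → x ∈ xs → f x ≤ ∑ xs f
  ∈⇒≤∑ (x ∷ xs) {f} 0≤f (here ≡.refl) = x≤x+y (f x) (∑-nonNeg xs 0≤f)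
  ∈⇒≤∑ (y ∷ xs) {f} 0≤f (there x∈)    = ≤-trans (∈⇒≤∑ xs 0≤f x∈)
    (≤-trans (x≤x+y _ (0≤f y)) (≤-reflexive (+-comm _ (f y))))

  ∑-filter-≤ : ∀ {a p} {A : Set a} {P : A → Set p} (P? : ∀ x → Dec (P x)) (xs : List A) {f : A → Carrier} → (∀ y → 0# ≤ f y) →
    ∑ (filter P? xs) f ≤ ∑ xs f
  ∑-filter-≤ P? xs 0≤f = ≤-trans (≤-reflexive (∑-filter P? xs _)) (∑-mono xs (λ x → if-≤ (does (P? x)) (0≤f x)))

  ∑-distance-0 : ∀ {n} (C : Subset n) x → ∑ (subsets n) (λ D → if ∣ C ∆ D ∣ ℕ.≡ᵇ 0 then x else 0#) ≈ x
  ∑-distance-0 [] x = +-identityʳ x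
  ∑-distance-0 {ℕ.suc n} (inside ∷ C) x = trans (∑-subsets-suc n _) (trans (+-cong (∑-0 (subsets n)) (∑-distance-0 C x)) (+-identityˡ x))
  ∑-distance-0 {ℕ.suc n} (outside ∷ C) x = trans (∑-subsets-suc n _) (trans (+-cong (∑-distance-0 C x) (∑-0 (subsets n))) (+-identityʳ x))

  ∑-distance-1 : ∀ {n} (C : Subset n) x → ∑ (subsets n) (λ D → if ∣ C ∆ D ∣ ℕ.≡ᵇ 1 then x else 0#) ≈ fromℕ n * x
  ∑-distance-1 [] x = trans (+-identityʳ 0#) (sym (zeroˡ x))
  ∑-distance-1 {ℕ.suc n} (inside ∷ C) x = trans (∑-subsets-suc n _) (trans (+-cong (∑-distance-0 C x) (∑-distance-1 C x))
    (solve 2 (λ x n → x :+ n :* x := (con 1 :+ n) :* x) refl x (fromℕ n)))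
  ∑-distance-1 {ℕ.suc n} (outside ∷ C) x = trans (∑-subsets-suc n _) (trans (+-cong (∑-distance-1 C x) (∑-distance-0 C x))
    (solve 2 (λ x n → n :* x :+ x := (con 1 :+ n) :* x) refl x (fromℕ n)))

  ∑-allFin-suc : ∀ m (f : Fin (ℕ.suc m) → Carrier) → ∑ (allFin (ℕ.suc m)) f ≈ f zero + ∑ (allFin m) (f ∘ suc)
  ∑-allFin-suc m f = +-congˡ (trans (reflexive (≡.cong (λ xs → ∑ xs f) (≡.sym (map-tabulate id suc)))) (∑-map suc (allFin m) f))

  ∑-index-0 : ∀ m {x} → 0# ≤ x → ∑ (allFin m) (λ j → if toℕ j ℕ.≡ᵇ 0 then x else 0#) ≤ x
  ∑-index-0 ℕ.zero    0≤x = 0≤x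
  ∑-index-0 (ℕ.suc m) 0≤x = ≤-reflexive (trans (∑-allFin-suc m _) (trans (+-congˡ (∑-0 (allFin m))) (+-identityʳ _)))

  ∑-neighbour-of-0 : ∀ m {x} → 0# ≤ x → ∑ (allFin m) (λ j → if dist 0 (toℕ j) ℕ.≡ᵇ 1 then x else 0#) ≤ x
  ∑-neighbour-of-0 ℕ.zero    0≤x = 0≤x
  ∑-neighbour-of-0 (ℕ.suc m) 0≤x = ≤-trans (≤-reflexive (trans (∑-allFin-suc m _) (+-identityˡ _))) (∑-index-0 m 0≤x)

  ∑-neighbours : ∀ m k {x} → 0# ≤ x → ∑ (allFin m) (λ j → if dist k (toℕ j) ℕ.≡ᵇ 1 then x else 0#) ≤ x + x
  ∑-neighbours m         ℕ.zero            {x} 0≤x = ≤-trans (∑-neighbour-of-0 m 0≤x) (x≤x+y x 0≤x)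
  ∑-neighbours ℕ.zero    (ℕ.suc k)         {x} 0≤x = ≤-trans 0≤x (x≤x+y x 0≤x)
  ∑-neighbours (ℕ.suc m) (ℕ.suc ℕ.zero)    {x} 0≤x =
    ≤-trans (≤-reflexive (∑-allFin-suc m _)) (+-monoʳ-≤ x (∑-neighbour-of-0 m 0≤x))
  ∑-neighbours (ℕ.suc m) (ℕ.suc (ℕ.suc k)) {x} 0≤x =
    ≤-trans (≤-reflexive (trans (∑-allFin-suc m _) (+-identityˡ _))) (∑-neighbours m (ℕ.suc k) 0≤x)

  ∣C∆C∣≡0 : ∀ {n} (C : Subset n) → ∣ C ∆ C ∣ ≡ 0
  ∣C∆C∣≡0 []            = ≡.refl
  ∣C∆C∣≡0 (inside  ∷ C) = ∣C∆C∣≡0 C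
  ∣C∆C∣≡0 (outside ∷ C) = ∣C∆C∣≡0 C

  ∆-comm : ∀ {n} (C D : Subset n) → C ∆ D ≡ D ∆ C
  ∆-comm C D = ∪-comm (C ─ D) (D ─ C)

  ∣D∩S∣≤∣C∩S∣+∣C∆D∣ : ∀ {n} (C D S : Subset n) → ∣ D ∩ S ∣ ℕ.≤ ∣ C ∩ S ∣ ℕ.+ ∣ C ∆ D ∣
  ∣D∩S∣≤∣C∩S∣+∣C∆D∣ [] [] [] = z≤n
  ∣D∩S∣≤∣C∩S∣+∣C∆D∣ (inside  ∷ C) (inside  ∷ D) (inside  ∷ S) = s≤s (∣D∩S∣≤∣C∩S∣+∣C∆D∣ C D S)
  ∣D∩S∣≤∣C∩S∣+∣C∆D∣ (inside  ∷ C) (inside  ∷ D) (outside ∷ S) = ∣D∩S∣≤∣C∩S∣+∣C∆D∣ C D S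
  ∣D∩S∣≤∣C∩S∣+∣C∆D∣ (outside ∷ C) (outside ∷ D) (_       ∷ S) = ∣D∩S∣≤∣C∩S∣+∣C∆D∣ C D S
  ∣D∩S∣≤∣C∩S∣+∣C∆D∣ (inside  ∷ C) (outside ∷ D) (s       ∷ S) =
    ℕ.≤-trans (ℕ.m≤n⇒m≤1+n (∣D∩S∣≤∣C∩S∣+∣C∆D∣ C D S)) (ℕ.≤-trans (ℕ.≤-reflexive (≡.sym (ℕ.+-suc ∣ C ∩ S ∣ _))) (ℕ.+-monoˡ-≤ _ (∣S∣≤∣s∷S∣ s (C ∩ S))))
    where
    ∣S∣≤∣s∷S∣ : ∀ {n} s (S : Subset n) → ∣ S ∣ ℕ.≤ ∣ s ∷ S ∣
    ∣S∣≤∣s∷S∣ inside  S = ℕ.n≤1+n _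
    ∣S∣≤∣s∷S∣ outside S = ℕ.≤-refl
  ∣D∩S∣≤∣C∩S∣+∣C∆D∣ (outside ∷ C) (inside  ∷ D) (inside  ∷ S) =
    ℕ.≤-trans (s≤s (∣D∩S∣≤∣C∩S∣+∣C∆D∣ C D S)) (ℕ.≤-reflexive (≡.sym (ℕ.+-suc ∣ C ∩ S ∣ _)))
  ∣D∩S∣≤∣C∩S∣+∣C∆D∣ (outside ∷ C) (inside  ∷ D) (outside ∷ S) =
    ℕ.≤-trans (ℕ.m≤n⇒m≤1+n (∣D∩S∣≤∣C∩S∣+∣C∆D∣ C D S)) (ℕ.≤-reflexive (≡.sym (ℕ.+-suc ∣ C ∩ S ∣ _)))

  fromℕ-∑ : ∀ {a} {A : Set a} (xs : List A) f → fromℕ (ℕ∑.∑ xs f) ≈ ∑ xs (fromℕ ∘ f)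
  fromℕ-∑ []       f = refl
  fromℕ-∑ (x ∷ xs) f = trans (fromℕ-+ (f x) _) (+-congˡ (fromℕ-∑ xs f))

  fromℕ-𝟙 : ∀ b → fromℕ (𝟙 b) ≈ (if b then 1# else 0#)
  fromℕ-𝟙 true  = fromℕ-1
  fromℕ-𝟙 false = refl

  -- The Metropolis acceptance rule turns the flow into `k * (p ⊓ p′)`, which is symmetric in the
  -- two weights; detailed balance for both kinds of move reduces to this.
  metropolis : ∀ {p p′ ρ} k → 0# < p → p * ρ ≈ p′ → p * (k * (1# ⊓ ρ)) ≈ k * (p ⊓ p′)
  metropolis {p} {p′} {ρ} k 0<p pρ≈p′ = trans (solve 3 (λ p k m → p :* (k :* m) := k :* (p :* m)) refl p k (1# ⊓ ρ))
    (*-congˡ (trans (*-distribˡ-⊓ 0<p 1# ρ) (⊓-cong (*-identityʳ p) pρ≈p′)))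

  balance-if : ∀ {p p′ q q′} {P : Set p} {P′ : Set p′} {Q : Set q} {Q′ : Set q′}
    (P? : Dec P) (P′? : Dec P′) (Q? : Dec Q) (Q′? : Dec Q′) {v v′ x x′ y y′} →
    (P → P′) → (P′ → P) → (Q → Q′) → (Q′ → Q) → (P → v * x ≈ v′ * x′) → (Q → v * y ≈ v′ * y′) →
    v * (if does P? then x else if does Q? then y else 0#) ≈ v′ * (if does P′? then x′ else if does Q′? then y′ else 0#)
  balance-if (yes p) (yes _)  _       _        _  _  _  _  eq _  = eq p
  balance-if (yes p) (no ¬p′) _       _        to _  _  _  _  _  = contradiction (to p) ¬p′
  balance-if (no ¬p) (yes p′) _       _        _  fr _  _  _  _  = contradiction (fr p′) ¬p
  balance-if (no _)  (no _)   (yes q) (yes _)  _  _  _  _  _  eq = eq q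
  balance-if (no _)  (no _)   (yes q) (no ¬q′) _  _  to _  _  _  = contradiction (to q) ¬q′
  balance-if (no _)  (no _)   (no ¬q) (yes q′) _  _  _  fr _  _  = contradiction (fr q′) ¬q
  balance-if (no _)  (no _)   (no _)  (no _)   _  _  _  _  _  _  = trans (zeroʳ _) (sym (zeroʳ _))

  select-nonNeg : ∀ b {x y} → 0# ≤ x → 0# ≤ y → 0# ≤ (if b then x else y)
  select-nonNeg true  0≤x _   = 0≤x
  select-nonNeg false _   0≤y = 0≤y

  neither : ∀ {p q} {P : Set p} {Q : Set q} (P? : Dec P) (Q? : Dec Q) {x y} → ¬ P → ¬ Q →
    (if does P? then x else if does Q? then y else 0#) ≈ 0#
  neither (yes p) _       ¬p _  = contradiction p ¬p
  neither (no _)  (yes q) _  ¬q = contradiction q ¬q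
  neither (no _)  (no _)  _  _  = refl

  select-+ : ∀ {p} {P : Set p} (P? : Dec P) {x y} → (P → y ≈ 0#) →
    (if does P? then x else y) ≈ (if does P? then x else 0#) + y
  select-+ (yes p) y≈0 = sym (trans (+-congˡ (y≈0 p)) (+-identityʳ _))
  select-+ (no _)  _   = sym (+-identityˡ _)

  select-balance : ∀ {p p′} {P : Set p} {P′ : Set p′} (P? : Dec P) (P′? : Dec P′) {v v′ x x′ y y′} →
    (P → P′) → (P′ → P) → (P → v * x ≈ v′ * x′) → v * y ≈ v′ * y′ →
    v * (if does P? then x else y) ≈ v′ * (if does P′? then x′ else y′)
  select-balance (yes p) (yes _)  _  _  eq _  = eq p
  select-balance (yes p) (no ¬p′) to _  _  _  = contradiction (to p) ¬p′
  select-balance (no ¬p) (yes p′) _  fr _  _  = contradiction (fr p′) ¬p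
  select-balance (no _)  (no _)   _  _  _  eq = eq

  -- Reversibility of the tempering dynamics and its trajectory probabilities.

  module Chain {n : ℕ} .{{n≢0 : NonZero n}} (ST : SimulatedTempering ℝ n) (G : Graph n) where
    open SimulatedTempering ST
    open Dynamics G

    private
      Z⁻¹ : Fin m → Carrier
      Z⁻¹ i = Ẑ i ⁻¹⟨ Ẑ-positive i ⟩

      levelRate tempRate : Carrier
      levelRate = a * (fromℕ n ⁻¹⟨ 0<fromℕ n ⟩)
      tempRate = (1# - a) * 2⁻¹

      0≤levelRate : 0# ≤ levelRate
      0≤levelRate = *-nonNeg (<⇒≤ 0<a) (<⇒≤ (0<⁻¹ _ _))

      0≤tempRate : 0# ≤ tempRate
      0≤tempRate = *-nonNeg (0≤y-x (<⇒≤ a<1)) (<⇒≤ (0<⁻¹ _ _))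

      level? : ∀ (C : Subset n) (i : Fin m) (C′ : Subset n) (i′ : Fin m) → Dec (i ≡ i′ × ∣ C ∆ C′ ∣ ≡ 1)
      level? C i C′ i′ = (i Fin.≟ i′) ×-dec (∣ C ∆ C′ ∣ ℕ.≟ 1)

      temp? : ∀ (C : Subset n) (i : Fin m) (C′ : Subset n) (i′ : Fin m) → Dec (C ≡ C′ × dist (toℕ i) (toℕ i′) ≡ 1)
      temp? C i C′ i′ = (C ≟ₛ C′) ×-dec (dist (toℕ i) (toℕ i′) ℕ.≟ 1)

    -- The unnormalised stationary distribution.
    weightAt : Fin m → Fin (ℕ.suc n) → Carrier
    weightAt i q = exp (β i * h q) * Z⁻¹ i

    weight : State → Carrier
    weight (C , i) = weightAt i (fromℕ< (s≤s (∣p∣≤n C)))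

    weightAt-pos : ∀ i q → 0# < weightAt i q
    weightAt-pos i q = *-pos (0<exp _) (0<⁻¹ _ _)

    private
      level-balance : ∀ C C′ i → weight (C , i) * levelMove C C′ i ≈ weight (C′ , i) * levelMove C′ C i
      level-balance C C′ i = trans (metropolis levelRate (weightAt-pos i _) (ratio h∣ C ∣ h∣ C′ ∣))
        (trans (*-congˡ (⊓-comm _ _)) (sym (metropolis levelRate (weightAt-pos i _) (ratio h∣ C′ ∣ h∣ C ∣))))
        where
        ratio : ∀ x y → exp (β i * x) * Z⁻¹ i * exp (β i * (y - x)) ≈ exp (β i * y) * Z⁻¹ i
        ratio x y = trans (solve 3 (λ p z q → p :* z :* q := p :* q :* z) refl (exp (β i * x)) (Z⁻¹ i) _)
          (*-congʳ (trans (sym (exp-+ _ _)) (exp-cong (trans (sym (distribˡ (β i) x _)) (*-congˡ (trans (+-comm x _) (x-y+y≈x y x)))))))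

      temp-balance : ∀ C i i′ → weight (C , i) * temperatureMove C i i′ ≈ weight (C , i′) * temperatureMove C i′ i
      temp-balance C i i′ = trans (metropolis tempRate (weightAt-pos i _) (ratio i i′))
        (trans (*-congˡ (⊓-comm _ _)) (sym (metropolis tempRate (weightAt-pos i′ _) (ratio i′ i))))
        where
        x = h∣ C ∣
        ratio : ∀ i i′ → exp (β i * x) * Z⁻¹ i * (Ẑ i * Z⁻¹ i′ * exp ((β i′ - β i) * x)) ≈ exp (β i′ * x) * Z⁻¹ i′
        ratio i i′ = trans (solve 5 (λ p z Z z′ q → p :* z :* (Z :* z′ :* q) := (Z :* z) :* (p :* q :* z′)) refl (exp (β i * x)) (Z⁻¹ i) (Ẑ i) (Z⁻¹ i′) _)
          (trans (trans (*-congʳ (*-inverseʳ (Ẑ i) (Ẑ-positive i))) (*-identityˡ _))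
            (*-congʳ (trans (sym (exp-+ _ _)) (exp-cong (trans (sym (distribʳ x (β i) _)) (*-congʳ (trans (+-comm (β i) _) (x-y+y≈x (β i′) (β i)))))))))

      move-balance : ∀ s s′ → weight s * move s s′ ≈ weight s′ * move s′ s
      move-balance (C , i) (C′ , i′) = balance-if (level? C i C′ i′) (level? C′ i′ C i) (temp? C i C′ i′) (temp? C′ i′ C i)
        (λ (i≡ , ∆≡1) → ≡.sym i≡ , ≡.trans (≡.cong ∣_∣ (∆-comm C′ C)) ∆≡1)
        (λ (i≡ , ∆≡1) → ≡.sym i≡ , ≡.trans (≡.cong ∣_∣ (∆-comm C C′)) ∆≡1)
        (λ (C≡ , d≡1) → ≡.sym C≡ , ≡.trans (ℕ.∣-∣-comm (toℕ i′) (toℕ i)) d≡1)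
        (λ (C≡ , d≡1) → ≡.sym C≡ , ≡.trans (ℕ.∣-∣-comm (toℕ i) (toℕ i′)) d≡1)
        (λ { (≡.refl , _) → level-balance C C′ i })
        (λ { (≡.refl , _) → temp-balance C i i′ })

      1⊓-≤ : ∀ {k} x → 0# ≤ k → k * (1# ⊓ x) ≤ k
      1⊓-≤ {k} x 0≤k = ≤-trans (*-monoʳ-≤ 0≤k (⊓-≤ˡ 1# x)) (≤-reflexive (*-identityʳ k))

      0≤1⊓ : ∀ {k x} → 0# ≤ k → 0# ≤ x → 0# ≤ k * (1# ⊓ x)
      0≤1⊓ 0≤k 0≤x = *-nonNeg 0≤k (⊓-glb 0≤1 0≤x)

      move-nonNeg : ∀ s s′ → 0# ≤ move s s′
      move-nonNeg (C , i) (C′ , i′) = select-nonNeg (does (level? C i C′ i′)) (0≤1⊓ 0≤levelRate (0≤exp _))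
        (if-nonNeg (does (temp? C i C′ i′))
          (0≤1⊓ 0≤tempRate (*-nonNeg (*-nonNeg (<⇒≤ (Ẑ-positive i)) (<⇒≤ (0<⁻¹ _ _))) (0≤exp _))))

      -- The proposal rates, with acceptance probability replaced by one. The `n` vertex flips at
      -- rate `a/n` and at most two neighbouring temperatures at rate `(1 - a)/2` have total rate at
      -- most one, so the holding probability in `P` is nonnegative.
      levelBound tempBound : State → State → Carrier
      levelBound (C , i) (C′ , i′) = if does (i Fin.≟ i′) then (if ∣ C ∆ C′ ∣ ℕ.≡ᵇ 1 then levelRate else 0#) else 0#
      tempBound  (C , i) (C′ , i′) = if does (C ≟ₛ C′) then (if dist (toℕ i) (toℕ i′) ℕ.≡ᵇ 1 then tempRate else 0#) else 0#

      move-≤ : ∀ s s′ → move s s′ ≤ levelBound s s′ + tempBound s s′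
      move-≤ (C , i) (C′ , i′) = bound (does (i Fin.≟ i′)) (∣ C ∆ C′ ∣ ℕ.≡ᵇ 1) (does (C ≟ₛ C′)) (dist (toℕ i) (toℕ i′) ℕ.≡ᵇ 1)
        (1⊓-≤ _ 0≤levelRate) (1⊓-≤ _ 0≤tempRate)
        where
        bound : ∀ b₁ b₂ b₃ b₄ {x y} → x ≤ levelRate → y ≤ tempRate →
          (if b₁ ∧ b₂ then x else if b₃ ∧ b₄ then y else 0#) ≤
          (if b₁ then (if b₂ then levelRate else 0#) else 0#) + (if b₃ then (if b₄ then tempRate else 0#) else 0#)
        bound true  true  b₃ b₄ x≤ y≤ = ≤-trans x≤ (x≤x+y _ (if-nonNeg b₃ (if-nonNeg b₄ 0≤tempRate)))
        bound true  false b₃ b₄ x≤ y≤ = ≤-trans (only b₃ b₄ y≤) (≤-reflexive (sym (+-identityˡ _)))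
          where
          only : ∀ b₃ b₄ {y} → y ≤ tempRate → (if b₃ ∧ b₄ then y else 0#) ≤ (if b₃ then (if b₄ then tempRate else 0#) else 0#)
          only true  b₄ y≤ = if-mono b₄ y≤
          only false b₄ y≤ = ≤-refl
        bound false b₂ true  b₄ x≤ y≤ = ≤-trans (if-mono b₄ y≤) (≤-reflexive (sym (+-identityˡ _)))
        bound false b₂ false b₄ x≤ y≤ = ≤-reflexive (sym (+-identityˡ _))

      ∑-states : ∀ f → ∑ states f ≈ ∑ (cliques G) (λ C → ∑ (allFin m) (λ i → f (C , i)))
      ∑-states f = ∑-cartesianProductWith _,_ (cliques G) (allFin m) f

      ∑-move-≤1 : ∀ s → ∑ states (move s) ≤ 1#
      ∑-move-≤1 (C , i) = begin
        ∑ states (move (C , i))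
          ≤⟨ ∑-mono states (move-≤ (C , i)) ⟩
        ∑ states (λ s → levelBound (C , i) s + tempBound (C , i) s)
          ≈⟨ ∑-+ states _ _ ⟩
        ∑ states (levelBound (C , i)) + ∑ states (tempBound (C , i))
          ≤⟨ +-mono-≤ levels temps ⟩
        a + (1# - a)
          ≈⟨ trans (+-comm a _) (x-y+y≈x 1# a) ⟩
        1# ∎
        where
        open ≤-Reasoning
        levels : ∑ states (levelBound (C , i)) ≤ a
        levels = begin
          ∑ states (levelBound (C , i))
            ≈⟨ trans (∑-states _) (∑-cong (cliques G) (λ C′ → ∑-if-≡ Fin._≟_ i (allFin m) _ (Unique.allFin⁺ m) (∈-allFin i))) ⟩
          ∑ (cliques G) (λ C′ → if ∣ C ∆ C′ ∣ ℕ.≡ᵇ 1 then levelRate else 0#)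
            ≤⟨ ∑-filter-≤ (isClique? G) (subsets n) (λ C′ → if-nonNeg (∣ C ∆ C′ ∣ ℕ.≡ᵇ 1) 0≤levelRate) ⟩
          ∑ (subsets n) (λ C′ → if ∣ C ∆ C′ ∣ ℕ.≡ᵇ 1 then levelRate else 0#)
            ≈⟨ ∑-distance-1 C levelRate ⟩
          fromℕ n * levelRate
            ≈⟨ trans (solve 3 (λ n a i → n :* (a :* i) := a :* (n :* i)) refl (fromℕ n) a _) (trans (*-congˡ (*-inverseʳ (fromℕ n) (0<fromℕ n))) (*-identityʳ a)) ⟩
          a ∎
        temps : ∑ states (tempBound (C , i)) ≤ 1# - a
        temps = begin
          ∑ states (tempBound (C , i))
            ≈⟨ trans (∑-states _) (∑-cong (cliques G) (λ C′ → sym (if-∑ (does (C ≟ₛ C′)) (allFin m) _))) ⟩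
          ∑ (cliques G) (λ C′ → if does (C ≟ₛ C′) then neighbours else 0#)
            ≤⟨ ∑-filter-≤ (isClique? G) (subsets n) (λ C′ → if-nonNeg (does (C ≟ₛ C′)) (∑-nonNeg (allFin m) (λ j → if-nonNeg (dist (toℕ i) (toℕ j) ℕ.≡ᵇ 1) 0≤tempRate))) ⟩
          ∑ (subsets n) (λ C′ → if does (C ≟ₛ C′) then neighbours else 0#)
            ≈⟨ ∑-if-≡ _≟ₛ_ C (subsets n) (λ _ → neighbours) (subsets-unique n) (∈-subsets C) ⟩
          neighbours
            ≤⟨ ∑-neighbours m (toℕ i) 0≤tempRate ⟩
          tempRate + tempRate
            ≈⟨ trans (sym (distribˡ (1# - a) 2⁻¹ 2⁻¹)) (trans (*-congˡ 2⁻¹+2⁻¹≈1) (*-identityʳ _)) ⟩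
          1# - a ∎
          where
          neighbours = ∑ (allFin m) (λ j → if dist (toℕ i) (toℕ j) ℕ.≡ᵇ 1 then tempRate else 0#)

      move-self : ∀ s → move s s ≈ 0#
      move-self (C , i) = neither (level? C i C i) (temp? C i C i)
        (λ (_ , ∆≡1) → contradiction (≡.trans (≡.sym (∣C∆C∣≡0 C)) ∆≡1) λ ())
        (λ (_ , d≡1) → contradiction (≡.trans (≡.sym (ℕ.∣n-n∣≡0 (toℕ i))) d≡1) λ ())

      states-unique : Unique states
      states-unique = Unique.cartesianProduct⁺ (Unique.filter⁺ (isClique? G) (subsets-unique n)) (Unique.allFin⁺ m)

      P-nonNeg : ∀ s s′ → 0# ≤ P s s′
      P-nonNeg s s′ = select-nonNeg (does (s ≟ s′)) (0≤y-x (∑-move-≤1 s)) (move-nonNeg s s′)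

      ∑P≈1 : ∀ {s} → s ∈ states → ∑ states (P s) ≈ 1#
      ∑P≈1 {s} s∈ = trans (∑-cong states P≈) (trans (∑-+ states _ _)
        (trans (+-congʳ (∑-if-≡ _≟_ s states (λ _ → 1# - ∑ states (move s)) states-unique s∈)) (x-y+y≈x 1# _)))
        where
        P≈ : ∀ s′ → P s s′ ≈ (if does (s ≟ s′) then 1# - ∑ states (move s) else 0#) + move s s′
        P≈ s′ = select-+ (s ≟ s′) (λ { ≡.refl → move-self s })

      P-balance : ∀ s s′ → weight s * P s s′ ≈ weight s′ * P s′ s
      P-balance s s′ = select-balance (s ≟ s′) (s′ ≟ s) ≡.sym ≡.sym (λ { ≡.refl → refl }) (move-balance s s′)

    chain : ReversibleChain states P weight
    chain = record
      { P-nonNeg = λ {s} s′ _ → P-nonNeg s s′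
      ; ∑P≈1     = ∑P≈1
      ; balance  = λ {s} {s′} _ _ → P-balance s s′
      ; π-pos    = λ (C , i) → weightAt-pos i _
      }

    few : Subset n → ℕ → State → Bool
    few S r (C , _) = ∣ C ∩ S ∣ ℕ.<ᵇ r

    exactly : Subset n → ℕ → State → Bool
    exactly S r (C , _) = ∣ C ∩ S ∣ ℕ.≡ᵇ r

    -- A level move changes one vertex and raises the overlap with `S` by at most one, and a
    -- temperature move keeps the clique. No transition can therefore jump over overlap exactly `r`.
    exit : ∀ S r s s′ → few S r s ≡ true → few S r s′ ≡ false → exactly S r s′ ≡ false → P s s′ ≈ 0#
    exit S r s@(C , i) s′@(D , j) inA notA notB = vanish (s ≟ s′)
      (λ { ≡.refl → contradiction (≡.trans (≡.sym inA) notA) λ () })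
      (neither (level? C i D j) (temp? C i D j)
        (λ (_ , ∆≡1) → notB-sound (ℕ.≤-antisym (ℕ.≤-trans (∣D∩S∣≤∣C∩S∣+∣C∆D∣ C D S)
          (ℕ.≤-trans (ℕ.≤-reflexive (≡.trans (≡.cong (∣ C ∩ S ∣ ℕ.+_) ∆≡1) (ℕ.+-comm _ 1))) C∩S<r)) r≤D∩S))
        (λ { (≡.refl , _) → ℕ.<⇒≱ C∩S<r r≤D∩S }))
      where
      true⇒T : ∀ {b} → b ≡ true → T b
      true⇒T ≡.refl = _
      false⇒¬T : ∀ {b} → b ≡ false → ¬ T b
      false⇒¬T ≡.refl ()
      C∩S<r : ∣ C ∩ S ∣ ℕ.< r
      C∩S<r = ℕ.<ᵇ⇒< _ r (true⇒T inA)
      r≤D∩S : r ℕ.≤ ∣ D ∩ S ∣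
      r≤D∩S = ℕ.≮⇒≥ (false⇒¬T notA ∘ ℕ.<⇒<ᵇ)
      notB-sound : ∣ D ∩ S ∣ ≢ r
      notB-sound eq = false⇒¬T notB (ℕ.≡⇒≡ᵇ _ r eq)
      vanish : ∀ {p} {Q : Set p} (Q? : Dec Q) {x y} → ¬ Q → y ≈ 0# → (if does Q? then x else y) ≈ 0#
      vanish (yes q) ¬q _   = contradiction q ¬q
      vanish (no _)  _  y≈0 = y≈0

    module _ (A : State → Bool) where
      allIn : ∀ {t} → Vec State t → Bool
      allIn []       = true
      allIn (s ∷ ss) = A s ∧ allIn ss

      allIn⇒All : ∀ {q} {Q : State → Set q} → (∀ s → T (A s) → Q s) → ∀ {t} (ss : Vec State t) → T (allIn ss) → All Q ss
      allIn⇒All sound []       _ = []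
      allIn⇒All sound (s ∷ ss) t = let (ts , tss) = Equivalence.to (T-∧ {A s}) t in sound s ts ∷ allIn⇒All sound ss tss

      ∑-trajectories : ∀ t s → ∑ (vectors states t) (λ ss → if allIn ss then pathProbability s ss else 0#) ≈ stay states P A t s
      ∑-trajectories ℕ.zero    s = +-identityʳ 1#
      ∑-trajectories (ℕ.suc t) s = trans (∑-cartesianProductWith _∷_ states (vectors states t) _)
        (∑-cong states (λ s′ → begin-equality
          ∑ (vectors states t) (λ ss → if A s′ ∧ allIn ss then P s s′ * pathProbability s′ ss else 0#)
            ≈⟨ ∑-cong (vectors states t) (λ ss → trans (reflexive (≡.sym (if-∧ (A s′) (allIn ss) _))) (if-cong (A s′) (sym (if-*ˡ (allIn ss) _ (P s s′))))) ⟩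
          ∑ (vectors states t) (λ ss → if A s′ then P s s′ * (if allIn ss then pathProbability s′ ss else 0#) else 0#)
            ≈⟨ trans (sym (if-∑ (A s′) (vectors states t) _)) (if-cong (A s′) (trans (∑-*ˡ (vectors states t) (P s s′) _) (*-congˡ (∑-trajectories t s′)))) ⟩
          (if A s′ then P s s′ * stay states P A t s′ else 0#) ∎))
        where open ≤-Reasoning

  -- The bottleneck ratio of the tempering weights and a slow initial pair.

  module _ {n : ℕ} .{{n≢0 : NonZero n}} (ST : SimulatedTempering ℝ n) (G₀ : Graph n) (S : Subset n) where
    open SimulatedTempering ST
    G = plant G₀ S

    open Dynamics G
    open Chain ST G

    private
      size : Subset n → Fin (ℕ.suc n)
      size C = fromℕ< (s≤s (∣p∣≤n C))

      levelMass : Fin m → ℕ → Carrier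
      levelMass i s = ∑ (cliques G) (λ C → if ∣ C ∩ S ∣ ℕ.≡ᵇ s then weightAt i (size C) else 0#)

      -- The weight of a state depends on its clique only through the size.
      levelMass≈ : ∀ i s → levelMass i s ≈ ∑ (allFin (ℕ.suc n)) (λ q → weightAt i q * fromℕ (cliqueCount G₀ S (toℕ q) s))
      levelMass≈ i s = begin-equality
        levelMass i s
          ≈⟨ ∑-filter (isClique? G) (subsets n) _ ⟩
        ∑ (subsets n) (λ C → if clique C then (if meets C then w (size C) else 0#) else 0#)
          ≈⟨ ∑-cong (subsets n) (λ C → trans (if-cong (clique C) (if-cong (meets C)
                (sym (∑-if-≡ Fin._≟_ (size C) (allFin (ℕ.suc n)) w (Unique.allFin⁺ (ℕ.suc n)) (∈-allFin (size C))))))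
              (trans (if-cong (clique C) (if-∑ (meets C) (allFin (ℕ.suc n)) _)) (if-∑ (clique C) (allFin (ℕ.suc n)) _))) ⟩
        ∑ (subsets n) (λ C → ∑ (allFin (ℕ.suc n)) (λ q → if clique C then (if meets C then (if does (size C Fin.≟ q) then w q else 0#) else 0#) else 0#))
          ≈⟨ ∑-swap (subsets n) (allFin (ℕ.suc n)) _ ⟩
        ∑ (allFin (ℕ.suc n)) (λ q → ∑ (subsets n) (λ C → if clique C then (if meets C then (if does (size C Fin.≟ q) then w q else 0#) else 0#) else 0#))
          ≈⟨ ∑-cong (allFin (ℕ.suc n)) (λ q → trans (∑-cong (subsets n) (λ C → regroup C q)) (trans (∑-*ˡ (subsets n) (w q) _) (*-congˡ (sym (count q))))) ⟩
        ∑ (allFin (ℕ.suc n)) (λ q → w q * fromℕ (cliqueCount G₀ S (toℕ q) s)) ∎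
        where
        open ≤-Reasoning
        w : Fin (ℕ.suc n) → Carrier
        w = weightAt i
        clique meets : Subset n → Bool
        clique C = does (isClique? G C)
        meets C = ∣ C ∩ S ∣ ℕ.≡ᵇ s
        count : ∀ q → fromℕ (cliqueCount G₀ S (toℕ q) s) ≈
          ∑ (subsets n) (λ C → if does (hasOverlap? S (toℕ q) s C) then (if clique C then 1# else 0#) else 0#)
        count q = trans (fromℕ-∑ (family S (toℕ q) s) _) (trans (∑-cong (family S (toℕ q) s) (λ C → fromℕ-𝟙 (clique C)))
          (∑-filter (hasOverlap? S (toℕ q) s) (subsets n) _))
        size≟ : ∀ C q → does (size C Fin.≟ q) ≡ (∣ C ∣ ℕ.≡ᵇ toℕ q)
        size≟ C q = does-⇔ (mk⇔ (λ { ≡.refl → ≡.sym (Fin.toℕ-fromℕ< (s≤s (∣p∣≤n C))) }) (λ eq → Fin.toℕ-injective (≡.trans (Fin.toℕ-fromℕ< (s≤s (∣p∣≤n C))) eq)))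
          (size C Fin.≟ q) (∣ C ∣ ℕ.≟ toℕ q)
        regroup : ∀ C q → (if clique C then (if meets C then (if does (size C Fin.≟ q) then w q else 0#) else 0#) else 0#) ≈
          w q * (if does (hasOverlap? S (toℕ q) s C) then (if clique C then 1# else 0#) else 0#)
        regroup C q = trans (reflexive (≡.cong (λ b → if clique C then (if meets C then (if b then w q else 0#) else 0#) else 0#) (size≟ C q)))
          (go (clique C) (meets C) (∣ C ∣ ℕ.≡ᵇ toℕ q))
          where
          go : ∀ b₁ b₂ b₃ → (if b₁ then (if b₂ then (if b₃ then w q else 0#) else 0#) else 0#) ≈ w q * (if b₃ ∧ b₂ then (if b₁ then 1# else 0#) else 0#)
          go true  true  true  = sym (*-identityʳ (w q))
          go true  true  false = sym (zeroʳ (w q))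
          go true  false true  = sym (zeroʳ (w q))
          go true  false false = sym (zeroʳ (w q))
          go false true  true  = sym (zeroʳ (w q))
          go false false true  = sym (zeroʳ (w q))
          go false true  false = sym (zeroʳ (w q))
          go false false false = sym (zeroʳ (w q))

      mass≈ : (E : Subset n → Bool) → ∑ states (λ s → if E (proj₁ s) then weight s else 0#) ≈
        ∑ (allFin m) (λ i → ∑ (cliques G) (λ C → if E C then weight (C , i) else 0#))
      mass≈ E = trans (∑-cartesianProductWith _,_ (cliques G) (allFin m) _) (∑-swap (cliques G) (allFin m) _)

    mass-≤ : ∀ r → Good G₀ S r → 0 ℕ.< r →
      fromℕ (2 ℕ.^ (r ℕ.* r)) * ∑ states (λ s → if exactly S r s then weight s else 0#) ≤
      ∑ states (λ s → if few S r s then weight s else 0#)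
    mass-≤ r good 0<r = begin
      fromℕ M * ∑ states (λ s → if exactly S r s then weight s else 0#)
        ≈⟨ *-congˡ (mass≈ (λ C → ∣ C ∩ S ∣ ℕ.≡ᵇ r)) ⟩
      fromℕ M * ∑ (allFin m) (λ i → levelMass i r)
        ≈⟨ ∑-*ˡ (allFin m) (fromℕ M) _ ⟨
      ∑ (allFin m) (λ i → fromℕ M * levelMass i r)
        ≤⟨ ∑-mono (allFin m) each ⟩
      ∑ (allFin m) (λ i → ∑ (cliques G) (λ C → if ∣ C ∩ S ∣ ℕ.<ᵇ r then weight (C , i) else 0#))
        ≈⟨ mass≈ (λ C → ∣ C ∩ S ∣ ℕ.<ᵇ r) ⟨
      ∑ states (λ s → if few S r s then weight s else 0#) ∎
      where
      open ≤-Reasoning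
      M = 2 ℕ.^ (r ℕ.* r)
      each : ∀ i → fromℕ M * levelMass i r ≤ ∑ (cliques G) (λ C → if ∣ C ∩ S ∣ ℕ.<ᵇ r then weight (C , i) else 0#)
      each i = begin
        fromℕ M * levelMass i r
          ≈⟨ trans (*-congˡ (levelMass≈ i r)) (sym (∑-*ˡ (allFin (ℕ.suc n)) (fromℕ M) _)) ⟩
        ∑ (allFin (ℕ.suc n)) (λ q → fromℕ M * (w q * fromℕ (cliqueCount G₀ S (toℕ q) r)))
          ≤⟨ ∑-mono (allFin (ℕ.suc n)) (λ q → ≤-trans (≤-reflexive (trans (solve 3 (λ M w y → M :* (w :* y) := w :* (M :* y)) refl (fromℕ M) (w q) _)
                (*-congˡ (sym (fromℕ-* M _))))) (*-monoʳ-≤ (<⇒≤ (weightAt-pos i q)) (fromℕ-mono-≤ (good q)))) ⟩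
        ∑ (allFin (ℕ.suc n)) (λ q → w q * fromℕ (cliqueCount G₀ S (toℕ q) 0))
          ≈⟨ levelMass≈ i 0 ⟨
        levelMass i 0
          -- The cliques disjoint from `S` already outweigh the bottleneck; those with overlap
          -- strictly between `0` and `r` only add mass.
          ≤⟨ ∑-mono (cliques G) (λ C → widen (∣ C ∩ S ∣) 0<r (<⇒≤ (weightAt-pos i (size C)))) ⟩
        ∑ (cliques G) (λ C → if ∣ C ∩ S ∣ ℕ.<ᵇ r then weight (C , i) else 0#) ∎
        where
        w = weightAt i
        widen : ∀ x {r y} → 0 ℕ.< r → 0# ≤ y → (if x ℕ.≡ᵇ 0 then y else 0#) ≤ (if x ℕ.<ᵇ r then y else 0#)
        widen ℕ.zero    {ℕ.suc r} _ 0≤y = ≤-refl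
        widen (ℕ.suc x) {r}       _ 0≤y = if-nonNeg (ℕ.suc x ℕ.<ᵇ r) 0≤y

    0<mass-few : ∀ r → 0 ℕ.< r → 0# < ∑ states (λ s → if few S r s then weight s else 0#)
    0<mass-few r 0<r = <-≤-trans (<-≤-trans (weightAt-pos i₀ (size ∅)) (≤-reflexive (sym ∅-few)))
      (∈⇒≤∑ states (λ (C , i) → if-nonNeg (∣ C ∩ S ∣ ℕ.<ᵇ r) (<⇒≤ (weightAt-pos i _)))
        (∈-cartesianProduct⁺ (∈-filter⁺ (isClique? G) (∈-subsets ∅) (λ _ _ u∈∅ → contradiction u∈∅ ∉⊥)) (∈-allFin i₀)))
      where
      i₀ : Fin m
      i₀ = fromℕ< 1≤m
      ∅-few : (if ∣ ∅ ∩ S ∣ ℕ.<ᵇ r then weight (∅ , i₀) else 0#) ≈ weight (∅ , i₀)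
      ∅-few = reflexive (≡.cong (λ b → if b then weight (∅ , i₀) else 0#)
        (T⇒true (ℕ.<⇒<ᵇ (ℕ.≤-<-trans (ℕ.≤-trans (∣p∩q∣≤∣p∣ ∅ S) (ℕ.≤-reflexive (∣⊥∣≡0 n))) 0<r))))
        where
        T⇒true : ∀ {b} → T b → b ≡ true
        T⇒true {true} _ = ≡.refl

    -- One initial pair serves all shorter times `t`, since staying probabilities decrease in time,
    -- and all properties `Q` implied by a small overlap. Both conclusions of the theorem are
    -- instances that differ only in `t` and `Q`.
    slow-start : ∀ {ℓ′} r T′ → Good G₀ S r → 0 ℕ.< r → T′ ℕ.* T′ ℕ.< 2 ℕ.^ (r ℕ.* r) →
      Σ[ C ∈ Subset n ] Σ[ i ∈ Fin m ] IsClique (plant G₀ S) C ×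
      (∀ t → t ℕ.≤ T′ → ∀ x → exp x ≤ fromℕ T′ → (Q : State → Set ℓ′) → (∀ C i → ∣ C ∩ S ∣ ℕ.< r → Q (C , i)) →
        TrajectoryProbAtLeast (C , i) t (All Q) (1# - exp (- x)))
    slow-start {ℓ′} r T′ good 0<r T²<M = start
      (∃-stay chain A (exactly S r) leaves T′ (2 ℕ.^ (r ℕ.* r)) T²<M (0<mass-few r 0<r) (mass-≤ r good 0<r))
      where
      A = few S r
      leaves = exit S r
      sound-A : ∀ {Q : State → Set ℓ′} → (∀ C i → ∣ C ∩ S ∣ ℕ.< r → Q (C , i)) → ∀ s → T (A s) → Q s
      sound-A sound (C , i) tA = sound C i (ℕ.<ᵇ⇒< _ r tA)
      true⇒T : ∀ {b} → b ≡ true → T b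
      true⇒T ≡.refl = _
      bound : ∀ s → s ∈ states → fromℕ T′ < fromℕ T′ * stay states P A T′ s + 1# →
        ∀ t → t ℕ.≤ T′ → ∀ x → exp x ≤ fromℕ T′ → 1# - exp (- x) ≤ stay states P A t s
      bound s s∈ lt t t≤T x eˣ≤T u<1-e = <-irrefl refl (begin-strict
        fromℕ T′                            <⟨ lt ⟩
        fromℕ T′ * stay states P A T′ s + 1#
          -- The summand `1#` is written as `exp x * exp (- x)` and bounded by `T′ * exp (- x)`, so
          -- that the failure probability `1/T′` becomes `exp (- x)`.
          ≤⟨ +-mono-≤ (*-monoʳ-≤ (<⇒≤ 0<T) (stay-antitone chain A (exactly S r) leaves t≤T s∈))
             (≤-trans (≤-reflexive (sym (exp*exp- x))) (*-monoˡ-≤ (0≤exp (- x)) eˣ≤T)) ⟩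
        fromℕ T′ * u + fromℕ T′ * e         ≈⟨ distribˡ (fromℕ T′) u e ⟨
        fromℕ T′ * (u + e)                  <⟨ *-monoʳ-< 0<T (+-monoˡ-< e u<1-e) ⟩
        fromℕ T′ * ((1# - e) + e)           ≈⟨ *-congˡ (x-y+y≈x 1# e) ⟩
        fromℕ T′ * 1#                       ≈⟨ *-identityʳ _ ⟩
        fromℕ T′                            ∎)
        where
        open ≤-Reasoning
        u = stay states P A t s
        e = exp (- x)
        0<T : 0# < fromℕ T′
        0<T = <-≤-trans (0<exp x) eˣ≤T
      start : ∃[ s ] s ∈ states × A s ≡ true × fromℕ T′ < fromℕ T′ * stay states P A T′ s + 1# → _
      start ((C , i) , s∈ , sA , lt) = C , i ,
        proj₂ (∈-filter⁻ (isClique? G) {xs = subsets n} (proj₁ (∈-cartesianProduct⁻ (cliques G) (allFin m) s∈))) ,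
        λ t t≤T x eˣ≤T Q sound → allIn A ,
          (λ ss tss → sound-A {Q} sound (C , i) (true⇒T sA) ∷ allIn⇒All A (sound-A {Q} sound) ss tss) ,
          ≤-trans (bound (C , i) s∈ lt t t≤T x eˣ≤T) (≤-reflexive (sym (∑-trajectories A t (C , i))))

-- Choice of the scale.

module Regimes where
  open Arithmetic
  open RandomGraph using (Regime)
  open import Data.Nat.Base
  open import Data.Nat.Properties
  open import Data.Nat.Solver using (module +-*-Solver)
  open import Relation.Binary.PropositionalEquality
  open +-*-Solver using (solve; _:=_; _:+_; _:*_; _:^_; con)
  open ≤-Reasoning

  module Scale (D : ℕ) .{{D≢0 : NonZero D}} where
    -- `w * e` approximates `log n` from below. The factor in `R = 4 * D` is chosen to give
    -- `4 * radius e * D = w * e`, so that `2^(4r)` is at most the `D`-th root of `n`. `v` is the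
    -- proportion of `w` left after removing the slack `e` from `w * e`.
    R w v : ℕ
    R = 4 * D
    w = 2 * (R * R)
    v = pred w

    -- These are `r`, `h` and `K`. The last is what the union bound over sizes demands for an
    -- overall failure probability of `1/e`.
    radius height samples : ℕ → ℕ
    radius e = 2 * R * e
    height e = e * v
    samples e = (6 * suc (2 * height e) + 1) * e

    4≤R : 4 ≤ R
    4≤R = m≤m*n 4 D

    R≤w : 2 * R ≤ w
    R≤w = *-monoʳ-≤ 2 (m≤m*n R R {{>-nonZero (≤-trans (s≤s z≤n) 4≤R)}})

    8≤w : 8 ≤ w
    8≤w = ≤-trans (*-monoʳ-≤ 2 4≤R) R≤w

    suc-v : suc v ≡ w
    suc-v = suc-pred w {{>-nonZero (≤-trans (s≤s z≤n) 8≤w)}}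

    height+ : ∀ e → height e + e ≡ w * e
    height+ e = trans (+-comm (e * v) e) (trans (sym (*-suc e v)) (trans (cong (e *_) suc-v) (*-comm e w)))

    4rD≡we : ∀ e → 4 * radius e * D ≡ w * e
    4rD≡we e = solve 2 (λ D e → con 4 :* (con 2 :* (con 4 :* D) :* e) :* D := con 2 :* ((con 4 :* D) :* (con 4 :* D)) :* e) refl D e

    r²≡2we² : ∀ e → radius e * radius e ≡ 2 * w * (e * e)
    r²≡2we² e = solve 2 (λ R e → (con 2 :* R :* e) :* (con 2 :* R :* e) := con 2 :* (con 2 :* (R :* R)) :* (e :* e)) refl R e

    e≤radius : ∀ e → e ≤ radius e
    e≤radius e = m≤n*m e (2 * R) {{>-nonZero (≤-trans (s≤s z≤n) (*-monoʳ-≤ 2 4≤R))}}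

    -- Comparison of `D`-th powers: that of `2^(4r)` is `2^(we) ≤ n`, and `k ^ D` is smaller than
    -- `n ^ D` by at least a factor `n`.
    k*2^4r≤n : ∀ n k e → k ^ D * n ≤ n ^ D → 2 ^ (w * e) ≤ n → k * 2 ^ (4 * radius e) ≤ n
    k*2^4r≤n n k e k-small n≥ = ^-cancelʳ-≤ D _ n (begin
      (k * 2 ^ (4 * radius e)) ^ D        ≡⟨ ^-distribʳ-* k (2 ^ (4 * radius e)) D ⟩
      k ^ D * (2 ^ (4 * radius e)) ^ D    ≡⟨ cong (k ^ D *_) (trans (^-*-assoc 2 (4 * radius e) D) (cong (2 ^_) (4rD≡we e))) ⟩
      k ^ D * 2 ^ (w * e)                 ≤⟨ *-monoʳ-≤ (k ^ D) n≥ ⟩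
      k ^ D * n                           ≤⟨ k-small ⟩
      n ^ D                               ∎)

    -- The hypothesis e¹⁸ ≤ 2ᵉ absorbs all polynomial factors; the largest is 304 e⁹ ≤ e¹⁸.
    regime : ∀ n k e → k ^ D * n ≤ n ^ D → 2 ^ (w * e) ≤ n → n ≤ 2 ^ (w * suc e) →
      w ≤ e → e ^ 18 ≤ 2 ^ e → Regime n k (height e) e w (radius e) (samples e)
    regime n k e k-small n≥ n≤ w≤e e¹⁸≤ = record
      { K>0     = >-nonZero⁻¹ K
      ; r≤2h+1  = m≤n⇒m≤1+n (≤-trans r≤ev (m≤n*m h 2))
      ; k-small = k-small′
      ; n≥      = ≤-trans (≤-reflexive (cong (2 ^_) (height+ e))) n≥
      ; n≤      = ≤-trans n≤ (≤-reflexive (cong (2 ^_) (trans (*-suc w e) (trans (+-comm w (w * e)) (cong (_+ w) (sym (height+ e)))))))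
      ; room    = *-cancelˡ-≤ 2 (begin
          2 * (2 * k + 4 * h)   ≡⟨ solve 2 (λ k h → con 2 :* (con 2 :* k :+ con 4 :* h) := k :* con 4 :+ con 2 :* (con 4 :* h)) refl k h ⟩
          k * 4 + 2 * (4 * h)   ≤⟨ +-mono-≤ (≤-trans (*-monoʳ-≤ k (^-monoʳ-≤ 2 2≤4r)) k-small′) (≤-trans (*-monoʳ-≤ 2 4h≤2^r) (≤-trans (^-monoʳ-≤ 2 1+r≤we) n≥)) ⟩
          n + n                 ≡⟨ cong (n +_) (+-identityʳ n) ⟨
          2 * n                 ∎)
      ; K-small = begin
          2 * (2 * h * (2 * h) * (2 * h * K))
            ≤⟨ *-monoʳ-≤ 2 (*-mono-≤ (*-mono-≤ 2h≤ 2h≤) (*-mono-≤ 2h≤ K≤19e³)) ⟩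
          2 * (2 * (e * e) * (2 * (e * e)) * (2 * (e * e) * (19 * e ^ 3)))
            ≡⟨ solve 1 (λ e → con 2 :* (con 2 :* (e :* e) :* (con 2 :* (e :* e)) :* (con 2 :* (e :* e) :* (con 19 :* e :^ 3))) := con 304 :* e :^ 9) refl e ⟩
          304 * e ^ 9
            ≤⟨ *-monoˡ-≤ (e ^ 9) (≤-trans (m≤m+n 304 208) (^-monoˡ-≤ 9 2≤e)) ⟩
          e ^ 9 * e ^ 9
            ≡⟨ ^-distribˡ-+-* e 9 9 ⟨
          e ^ 18
            ≤⟨ e¹⁸≤ ⟩
          2 ^ e ∎
      ; h-small = 4h≤2^r
      -- With `w ≤ e` the left side is at most `2e * 2we`, which is exactly `2r²`; the factor `2` in
      -- `radius` comes from here.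
      ; e-small = begin
          (e + w) * suc (2 * h)
            ≤⟨ *-mono-≤ (+-monoʳ-≤ e w≤e) (≤-trans (≤-reflexive (+-comm 1 (2 * h))) (+-monoʳ-≤ (2 * h) (≤-trans (s≤s z≤n) (*-monoʳ-≤ 2 1≤e)))) ⟩
          (e + e) * (2 * h + 2 * e)
            ≡⟨ trans (cong ((e + e) *_) (trans (sym (*-distribˡ-+ 2 h e)) (cong (2 *_) (height+ e)))) (solve 2 (λ e w → (e :+ e) :* (con 2 :* (w :* e)) := con 2 :* (con 2 :* w :* (e :* e))) refl e w) ⟩
          2 * (2 * w * (e * e))
            ≡⟨ cong (2 *_) (r²≡2we² e) ⟨
          2 * (r * r) ∎
      ; K≤      = begin
          K             ≤⟨ K≤19e³ ⟩
          19 * e ^ 3    ≤⟨ *-monoˡ-≤ (e ^ 3) (≤-trans (m≤m+n 19 13) (^-monoˡ-≤ 5 2≤e)) ⟩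
          e ^ 5 * e ^ 3 ≡⟨ ^-distribˡ-+-* e 5 3 ⟨
          e ^ 8         ≤⟨ ^-monoʳ-≤ e (m≤m+n 8 10) ⟩
          e ^ 18        ≤⟨ e¹⁸≤ ⟩
          2 ^ e         ≤⟨ ^-monoʳ-≤ 2 (≤-trans (e≤radius e) (m≤m*n r r)) ⟩
          2 ^ (r * r)   ∎
      }
      where
      h = height e
      r = radius e
      K = samples e
      2≤e : 2 ≤ e
      2≤e = ≤-trans (m≤m+n 2 6) (≤-trans 8≤w w≤e)
      1≤e : 1 ≤ e
      1≤e = ≤-trans (n≤1+n 1) 2≤e
      instance
        e≢0 : NonZero e
        e≢0 = >-nonZero 1≤e
        r≢0 : NonZero r
        r≢0 = >-nonZero (≤-trans 1≤e (e≤radius e))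
        K≢0 : NonZero K
        K≢0 = m*n≢0 (6 * suc (2 * h) + 1) e {{>-nonZero (m≤n+m 1 (6 * suc (2 * h)))}}
      k-small′ = k*2^4r≤n n k e k-small n≥
      2R≤v : 2 * R ≤ v
      2R≤v = s≤s⁻¹ (begin-strict
        2 * R           <⟨ m<m*n (2 * R) R {{>-nonZero (≤-trans (s≤s z≤n) (*-monoʳ-≤ 2 4≤R))}} (≤-trans (m≤m+n 2 2) 4≤R) ⟩
        2 * R * R       ≡⟨ *-assoc 2 R R ⟩
        w               ≡⟨ suc-v ⟨
        suc v           ∎)
      r≤ev : r ≤ h
      r≤ev = ≤-trans (*-monoˡ-≤ e 2R≤v) (≤-reflexive (*-comm v e))
      h≤e² : h ≤ e * e
      h≤e² = *-monoʳ-≤ e (≤-trans (n≤1+n v) (≤-trans (≤-reflexive suc-v) w≤e))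
      2h≤ : 2 * h ≤ 2 * (e * e)
      2h≤ = *-monoʳ-≤ 2 h≤e²
      1≤e² : 1 ≤ e * e
      1≤e² = *-mono-≤ 1≤e 1≤e
      K≤19e³ : K ≤ 19 * e ^ 3
      K≤19e³ = begin
        (6 * suc (2 * h) + 1) * e
          ≤⟨ *-monoˡ-≤ e (+-mono-≤ (*-monoʳ-≤ 6 (+-mono-≤ 1≤e² 2h≤)) 1≤e²) ⟩
        (6 * (e * e + 2 * (e * e)) + e * e) * e
          ≡⟨ solve 1 (λ e → (con 6 :* (e :* e :+ con 2 :* (e :* e)) :+ e :* e) :* e := con 19 :* e :^ 3) refl e ⟩
        19 * e ^ 3 ∎
      4h≤2^r : 4 * h ≤ 2 ^ r
      4h≤2^r = begin
        4 * h           ≤⟨ *-mono-≤ (*-mono-≤ 2≤e 2≤e) h≤e² ⟩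
        e * e * (e * e) ≡⟨ solve 1 (λ e → e :* e :* (e :* e) := e :^ 4) refl e ⟩
        e ^ 4           ≤⟨ ^-monoʳ-≤ e (m≤m+n 4 14) ⟩
        e ^ 18          ≤⟨ e¹⁸≤ ⟩
        2 ^ e           ≤⟨ ^-monoʳ-≤ 2 (e≤radius e) ⟩
        2 ^ r           ∎
      2≤4r : 2 ≤ 4 * r
      2≤4r = ≤-trans (m≤m+n 2 2) (m≤m*n 4 r)
      1+r≤we : suc r ≤ w * e
      1+r≤we = begin
        suc r   ≤⟨ s≤s r≤ev ⟩
        suc h   ≡⟨ +-comm 1 h ⟩
        h + 1   ≤⟨ +-monoʳ-≤ h 1≤e ⟩
        h + e   ≡⟨ height+ e ⟩
        w * e   ∎

    -- Its square has exponent `2e²`, below `r² = 2we²`, while `e²` is still a constant multiple of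
    -- `log² n` up to rounding.
    horizon : ℕ → ℕ
    horizon e = 2 ^ (e * e)

    horizon²< : ∀ e → 1 ≤ e → horizon e * horizon e < 2 ^ (radius e * radius e)
    horizon²< e 1≤e = begin-strict
      horizon e * horizon e       ≡⟨ ^-distribˡ-+-* 2 (e * e) (e * e) ⟨
      2 ^ (e * e + e * e)         <⟨ ^-monoʳ-< 2 (n<1+n 1) (begin-strict
        e * e + e * e   ≡⟨ cong (e * e +_) (+-identityʳ (e * e)) ⟨
        2 * (e * e)                 <⟨ *-monoˡ-< (e * e) {{>-nonZero (*-mono-≤ 1≤e 1≤e)}} (*-monoʳ-< 2 (≤-trans (m≤m+n 2 6) 8≤w)) ⟩
        2 * w * (e * e)             ≡⟨ r²≡2we² e ⟨
        radius e * radius e         ∎) ⟩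
      2 ^ (radius e * radius e)   ∎

    n^d≤horizon : ∀ n d e → n ≤ 2 ^ (w * suc e) → 1 ≤ e → 2 * w * d ≤ e → n ^ d ≤ horizon e
    n^d≤horizon n d e n≤ 1≤e 2wd≤e = begin
      n ^ d                     ≤⟨ ^-monoˡ-≤ d n≤ ⟩
      (2 ^ (w * suc e)) ^ d     ≡⟨ ^-*-assoc 2 (w * suc e) d ⟩
      2 ^ (w * suc e * d)       ≤⟨ ^-monoʳ-≤ 2 (*-monoˡ-≤ d (*-monoʳ-≤ w (+-monoˡ-≤ e 1≤e))) ⟩
      2 ^ (w * (e + e) * d)     ≡⟨ cong (2 ^_) (solve 3 (λ w e d → w :* (e :+ e) :* d := e :* (con 2 :* w :* d)) refl w e d) ⟩
      2 ^ (e * (2 * w * d))     ≤⟨ ^-monoʳ-≤ 2 (*-monoʳ-≤ e 2wd≤e) ⟩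
      horizon e                 ∎

    -- Makes a visit to the planted clique itself count as overlap at least `r`. If `k < r`, then
    -- `n ≤ r ^ D < 2 ^ (r D) ≤ 2 ^ (w e) ≤ n`.
    radius≤k : ∀ n k e → n ≤ suc k ^ D → 2 ^ (w * e) ≤ n → radius e ≤ k
    radius≤k n k e n≤ n≥ = ≮⇒≥ λ k<r → n≮n n (begin-strict
      n                     ≤⟨ n≤ ⟩
      suc k ^ D             ≤⟨ ^-monoˡ-≤ D k<r ⟩
      radius e ^ D          <⟨ ^-monoˡ-< D (n<2^n (radius e)) ⟩
      (2 ^ radius e) ^ D    ≡⟨ ^-*-assoc 2 (radius e) D ⟩
      2 ^ (radius e * D)    ≤⟨ ^-monoʳ-≤ 2 (≤-trans (*-monoˡ-≤ D (m≤n*m (radius e) 4)) (≤-reflexive (4rD≡we e))) ⟩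
      2 ^ (w * e)           ≤⟨ n≥ ⟩
      n                     ∎)

-- From real exponents to integer inequalities, and from counts to probabilities.

module Asymptotics {c ℓ} (ℝ : RealField c ℓ) where
  open RealField ℝ hiding (∑; zero)
  open Reals ℝ
  open Tempering ℝ using (fromℕ-∑; fromℕ-𝟙; slow-start)
  open RandomGraph using (Good; good?; Regime; #bad-≤; does-yes)
  open CliqueCount using (𝟙; #graphs)
  open Arithmetic using (floor-log; floor-log-≥; n^j≤2^n)
  open import Data.Bool.Base using (Bool; true; false; if_then_else_; not; T; _∧_)
  open import Data.Bool.Properties using (T-∧; ∧-identityʳ)
  open import Data.Fin.Subset using (Subset; _∩_; ∣_∣)
  open import Data.Fin.Subset.Properties using (∩-idem)
  open import Data.List.Base using (List; length; cartesianProduct)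
  open import Data.List.Membership.Propositional using (_∈_)
  open import Data.List.Membership.Propositional.Properties using (∈-filter⁻)
  open import Data.Product.Base using (∃-syntax; _×_; _,_; proj₂)
  open import Function.Base using (_∘_)
  open import Function.Bundles using (module Equivalence)
  open import Relation.Binary.PropositionalEquality.Core as ≡ using (_≡_; _≢_)
  open import Relation.Nullary.Decidable using (does; dec-true)
  open import Relation.Nullary.Negation using (¬_)
  open import Algebra.Solver.Ring.NaturalCoefficients.Default commutativeSemiring using (solve; _:=_; _:+_; _:*_; con)
  open ListSum commutativeSemiring using (∑; ∑-cong)
  module ℕ∑ = ListSum ℕ.+-*-commutativeSemiring

  exp-lnℕ : ∀ n → .{{_ : NonZero n}} → exp (lnℕ n) ≈ fromℕ n
  exp-lnℕ n = exp-ln (fromℕ n) (0<fromℕ n)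

  exp-*ln2 : ∀ a → exp (fromℕ a * ln2) ≈ fromℕ (2 ℕ.^ a)
  exp-*ln2 a = exp-fromℕ* a ln2 2 (exp-ln (fromℕ 2) (0<fromℕ 2))

  private
    ln2⁻¹ : Carrier
    ln2⁻¹ = ln2 ⁻¹⟨ 0<ln2 ⟩

    x*ln2*ln2⁻¹ : ∀ x → x * ln2 * ln2⁻¹ ≈ x
    x*ln2*ln2⁻¹ x = trans (*-assoc x ln2 ln2⁻¹) (trans (*-congˡ (*-inverseʳ ln2 0<ln2)) (*-identityʳ x))

  lnℕ-≥ : ∀ a n → .{{_ : NonZero n}} → 2 ℕ.^ a ℕ.≤ n → fromℕ a * ln2 ≤ lnℕ n
  lnℕ-≥ a n 2ᵃ≤n = exp-cancel-≤ (≤-trans (≤-reflexive (exp-*ln2 a)) (≤-trans (fromℕ-mono-≤ 2ᵃ≤n) (≤-reflexive (sym (exp-lnℕ n)))))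

  lnℕ-≤ : ∀ a n → .{{_ : NonZero n}} → n ℕ.≤ 2 ℕ.^ a → lnℕ n ≤ fromℕ a * ln2
  lnℕ-≤ a n n≤2ᵃ = exp-cancel-≤ (≤-trans (≤-reflexive (exp-lnℕ n)) (≤-trans (fromℕ-mono-≤ n≤2ᵃ) (≤-reflexive (sym (exp-*ln2 a)))))

  log-≥ : ∀ a n → .{{_ : NonZero n}} → 2 ℕ.^ a ℕ.≤ n → fromℕ a ≤ log n
  log-≥ a n 2ᵃ≤n = ≤-trans (≤-reflexive (sym (x*ln2*ln2⁻¹ (fromℕ a)))) (*-monoˡ-≤ (<⇒≤ (0<⁻¹ ln2 0<ln2)) (lnℕ-≥ a n 2ᵃ≤n))

  log-≤ : ∀ a n → .{{_ : NonZero n}} → n ℕ.≤ 2 ℕ.^ a → log n ≤ fromℕ a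
  log-≤ a n n≤2ᵃ = ≤-trans (*-monoˡ-≤ (<⇒≤ (0<⁻¹ ln2 0<ln2)) (lnℕ-≤ a n n≤2ᵃ)) (≤-reflexive (x*ln2*ln2⁻¹ (fromℕ a)))

  0≤lnℕ : ∀ n → .{{_ : NonZero n}} → 0# ≤ lnℕ n
  0≤lnℕ n = ≤-trans (≤-reflexive (sym (zeroˡ ln2))) (lnℕ-≥ 0 n (ℕ.>-nonZero⁻¹ n))

  0≤log : ∀ n → .{{_ : NonZero n}} → 0# ≤ log n
  0≤log n = log-≥ 0 n (ℕ.>-nonZero⁻¹ n)

  exp-suc* : ∀ d x → exp (fromℕ (ℕ.suc d) * x) ≈ exp x * exp (fromℕ d * x)
  exp-suc* d x = trans (exp-cong (trans (distribʳ x 1# (fromℕ d)) (+-congʳ (*-identityˡ x)))) (exp-+ x (fromℕ d * x))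

  exp-0* : ∀ x → exp (0# * x) ≈ fromℕ 1
  exp-0* x = trans (exp-cong (zeroˡ x)) (trans exp-0 (sym fromℕ-1))

  ^-≤-exp : ∀ d k x → fromℕ k ≤ exp x → fromℕ (k ℕ.^ d) ≤ exp (fromℕ d * x)
  ^-≤-exp ℕ.zero    k x k≤eˣ = ≤-reflexive (sym (exp-0* x))
  ^-≤-exp (ℕ.suc d) k x k≤eˣ = ≤-trans (≤-reflexive (fromℕ-* k _))
    (≤-trans (*-mono-≤ (0≤fromℕ k) k≤eˣ (0≤fromℕ (k ℕ.^ d)) (^-≤-exp d k x k≤eˣ)) (≤-reflexive (sym (exp-suc* d x))))

  exp-≤-^ : ∀ d k x → exp x ≤ fromℕ k → exp (fromℕ d * x) ≤ fromℕ (k ℕ.^ d)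
  exp-≤-^ ℕ.zero    k x eˣ≤k = ≤-reflexive (exp-0* x)
  exp-≤-^ (ℕ.suc d) k x eˣ≤k = ≤-trans (≤-reflexive (exp-suc* d x))
    (≤-trans (*-mono-≤ (0≤exp x) eˣ≤k (0≤exp (fromℕ d * x)) (exp-≤-^ d k x eˣ≤k)) (≤-reflexive (sym (fromℕ-* k _))))

  -- An integer form of `k ≤ n^(1 - 1/D)`: raising to the power `D` removes the real exponent `α`,
  -- and one factor `n` remains to spare. The next lemma is the matching lower bound on `k`.
  k^D*n≤n^D : ∀ {α} D k n → .{{_ : NonZero n}} → fromℕ D * α + 1# ≤ fromℕ D → fromℕ k ≤ n ^ℝ α → k ℕ.^ D ℕ.* n ℕ.≤ n ℕ.^ D
  k^D*n≤n^D {α} D k n Dα+1≤D k≤nᵅ = fromℕ-cancel-≤ (begin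
    fromℕ (k ℕ.^ D ℕ.* n)                     ≈⟨ fromℕ-* (k ℕ.^ D) n ⟩
    fromℕ (k ℕ.^ D) * fromℕ n                 ≤⟨ *-monoˡ-≤ (0≤fromℕ n) (^-≤-exp D k (α * L) k≤nᵅ) ⟩
    exp (fromℕ D * (α * L)) * fromℕ n         ≈⟨ *-congˡ (exp-lnℕ n) ⟨
    exp (fromℕ D * (α * L)) * exp L           ≈⟨ exp-+ _ L ⟨
    exp (fromℕ D * (α * L) + L)               ≈⟨ exp-cong (solve 3 (λ d a l → d :* (a :* l) :+ l := (d :* a :+ con 1) :* l) refl (fromℕ D) α L) ⟩
    exp ((fromℕ D * α + 1#) * L)              ≤⟨ exp-mono-≤ (*-monoˡ-≤ (0≤lnℕ n) Dα+1≤D) ⟩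
    exp (fromℕ D * L)                         ≤⟨ exp-≤-^ D n L (≤-reflexive (exp-lnℕ n)) ⟩
    fromℕ (n ℕ.^ D)                           ∎)
    where
    open ≤-Reasoning
    L = lnℕ n

  n≤[1+k]^D : ∀ {α} D k n → .{{_ : NonZero n}} → 1# ≤ fromℕ D * α → n ^ℝ α < fromℕ (ℕ.suc k) → n ℕ.≤ ℕ.suc k ℕ.^ D
  n≤[1+k]^D {α} D k n 1≤Dα nᵅ<1+k = fromℕ-cancel-≤ (begin
    fromℕ n                         ≈⟨ exp-lnℕ n ⟨
    exp L                           ≤⟨ exp-mono-≤ (≤-trans (≤-reflexive (sym (*-identityˡ L))) (≤-trans (*-monoˡ-≤ (0≤lnℕ n) 1≤Dα) (≤-reflexive (*-assoc _ α L)))) ⟩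
    exp (fromℕ D * (α * L))         ≤⟨ exp-≤-^ D (ℕ.suc k) (α * L) (<⇒≤ nᵅ<1+k) ⟩
    fromℕ (ℕ.suc k ℕ.^ D)           ∎)
    where
    open ≤-Reasoning
    L = lnℕ n

  -- A single Archimedean bound on the sum of the reciprocals of `1 - α`, `α` and `γ` meets three
  -- needs: `k` is polynomially smaller than `n`, `k` is at least polynomial in `n`, and the
  -- bottleneck lies below overlap `γ log n`.
  ∃-exponent : ∀ {α γ} → 0# < α → α < 1# → 0# < γ →
    ∃[ D ] NonZero D × fromℕ D * α + 1# ≤ fromℕ D × 1# ≤ fromℕ D * α × 1# ≤ γ * fromℕ D
  ∃-exponent {α} {γ} 0<α α<1 0<γ with archimedean (x + (y + z))
    where
    x = (1# - α) ⁻¹⟨ x<y⇒0<y-x α<1 ⟩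
    y = α ⁻¹⟨ 0<α ⟩
    z = γ ⁻¹⟨ 0<γ ⟩
  ... | D , x+y+z<D = D , ℕ.>-nonZero (fromℕ-cancel-< {0} (≤-<-trans 0≤x x<D)) ,
    ≤-trans (+-monoʳ-≤ _ (large 0<1-α x<D)) (≤-reflexive D≈) ,
    ≤-trans (large 0<α y<D) (≤-reflexive (*-comm α _)) , large 0<γ z<D
    where
    0<1-α = x<y⇒0<y-x α<1
    x = (1# - α) ⁻¹⟨ 0<1-α ⟩
    y = α ⁻¹⟨ 0<α ⟩
    z = γ ⁻¹⟨ 0<γ ⟩
    0≤x = <⇒≤ (0<⁻¹ _ 0<1-α)
    0≤y = <⇒≤ (0<⁻¹ α 0<α)
    0≤z = <⇒≤ (0<⁻¹ γ 0<γ)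
    x<D : x < fromℕ D
    x<D = ≤-<-trans (x≤x+y x (≤-trans 0≤y (x≤x+y y 0≤z))) x+y+z<D
    y+z<D : y + z < fromℕ D
    y+z<D = ≤-<-trans (≤-trans (x≤x+y (y + z) 0≤x) (≤-reflexive (+-comm (y + z) x))) x+y+z<D
    y<D : y < fromℕ D
    y<D = ≤-<-trans (x≤x+y y 0≤z) y+z<D
    z<D : z < fromℕ D
    z<D = ≤-<-trans (≤-trans (x≤x+y z 0≤y) (≤-reflexive (+-comm z y))) y+z<D
    large : ∀ {v} (0<v : 0# < v) → v ⁻¹⟨ 0<v ⟩ < fromℕ D → 1# ≤ v * fromℕ D
    large {v} 0<v v⁻¹<D = ≤-trans (≤-reflexive (sym (*-inverseʳ v 0<v))) (<⇒≤ (*-monoʳ-< 0<v v⁻¹<D))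
    D≈ : fromℕ D * α + (1# - α) * fromℕ D ≈ fromℕ D
    D≈ = trans (+-comm _ _) (trans (+-congˡ (*-comm (fromℕ D) α)) (trans (sym (distribʳ (fromℕ D) (1# - α) α)) (trans (*-congʳ (x-y+y≈x 1# α)) (*-identityˡ _))))

  few-bad⇒likely : ∀ {a e} {A : Set a} (xs : List A) {E : A → Set e} (χ : A → Bool) → (∀ x → T (χ x) → E x) →
    ∀ t {ε} → 0# < ε → 1# ≤ fromℕ t * ε → t ℕ.* ℕ∑.∑ xs (λ x → 𝟙 (not (χ x))) ℕ.≤ length xs →
    UniformProbAtLeast ℝ xs E (1# - ε)
  few-bad⇒likely xs χ sound t {ε} 0<ε 1≤tε few = χ , sound , ≤-trans (+-cancelʳ-≤ (ε * L) (begin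
    (1# - ε) * L + ε * L              ≈⟨ trans (sym (distribʳ L (1# - ε) ε)) (trans (*-congʳ (x-y+y≈x 1# ε)) (*-identityˡ L)) ⟩
    L                                 ≈⟨ trans (reflexive (≡.cong fromℕ (≡.sym split))) (fromℕ-+ #good #bad) ⟩
    fromℕ #good + fromℕ #bad          ≤⟨ +-monoʳ-≤ (fromℕ #good) bad≤ ⟩
    fromℕ #good + ε * L               ∎)) (≤-reflexive good≈)
    where
    open ≤-Reasoning
    L = fromℕ (length xs)
    #good = ℕ∑.∑ xs (λ x → 𝟙 (χ x))
    #bad = ℕ∑.∑ xs (λ x → 𝟙 (not (χ x)))
    split : #good ℕ.+ #bad ≡ length xs
    split = ≡.trans (≡.sym (ℕ∑.∑-+ xs _ _)) (≡.trans (ℕ∑.∑-cong xs (λ x → 𝟙+𝟙 (χ x))) (≡.trans (RandomGraph.∑-const xs 1) (ℕ.*-identityʳ (length xs))))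
      where
      𝟙+𝟙 : ∀ b → 𝟙 b ℕ.+ 𝟙 (not b) ≡ 1
      𝟙+𝟙 true  = ≡.refl
      𝟙+𝟙 false = ≡.refl
    good≈ : fromℕ #good ≈ ∑ xs (λ x → if χ x then 1# else 0#)
    good≈ = trans (fromℕ-∑ xs _) (∑-cong xs (λ x → fromℕ-𝟙 (χ x)))
    bad≤ : fromℕ #bad ≤ ε * L
    bad≤ = begin
      fromℕ #bad                      ≈⟨ *-identityˡ _ ⟨
      1# * fromℕ #bad                 ≤⟨ *-monoˡ-≤ (0≤fromℕ #bad) 1≤tε ⟩
      fromℕ t * ε * fromℕ #bad        ≈⟨ solve 3 (λ t e b → t :* e :* b := e :* (t :* b)) refl (fromℕ t) ε (fromℕ #bad) ⟩
      ε * (fromℕ t * fromℕ #bad)      ≈⟨ *-congˡ (fromℕ-* t #bad) ⟨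
      ε * fromℕ (t ℕ.* #bad)          ≤⟨ *-monoʳ-≤ (<⇒≤ 0<ε) (fromℕ-mono-≤ few) ⟩
      ε * L                           ∎

  -- The size test holds on every sample. It is included because `MassAtLeast` asks for soundness at
  -- all pairs, not only the listed ones, and recovering the planted clique is ruled out by means of
  -- its size.
  isGood : ∀ {n} → ℕ → ℕ → Graph n × Subset n → Bool
  isGood k r (G , S) = does (good? G S r) ∧ (∣ S ∣ ℕ.≡ᵇ k)

  few-bad : ∀ {n k h e c r K} → Regime n k h e c r K → ∀ t → (6 ℕ.* ℕ.suc (2 ℕ.* h) ℕ.+ 1) ℕ.* t ℕ.≤ K →
    t ℕ.* ℕ∑.∑ (cartesianProduct (graphs n) (subsetsOfSize n k)) (λ x → 𝟙 (not (isGood k r x))) ℕ.≤ length (cartesianProduct (graphs n) (subsetsOfSize n k))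
  few-bad {n} {k} {r = r} R t t≤ = begin
    t ℕ.* ℕ∑.∑ Ω bad
      ≡⟨ ≡.cong (t ℕ.*_) (≡.trans (ℕ∑.∑-cartesianProductWith _,_ (graphs n) Ss bad) (ℕ∑.∑-swap (graphs n) Ss _)) ⟩
    t ℕ.* ℕ∑.∑ Ss (λ S → ℕ∑.∑ (graphs n) (λ G → bad (G , S)))
      ≡⟨ ℕ∑.∑-*ˡ Ss t _ ⟨
    ℕ∑.∑ Ss (λ S → t ℕ.* ℕ∑.∑ (graphs n) (λ G → bad (G , S)))
      ≤⟨ RandomGraph.∑-mono-∈ Ss each ⟩
    ℕ∑.∑ Ss (λ _ → #graphs n)
      ≡⟨ ≡.trans (ℕ∑.∑-swap Ss (graphs n) (λ _ _ → 1)) (≡.sym (ℕ∑.∑-cartesianProductWith _,_ (graphs n) Ss (λ _ → 1))) ⟩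
    ℕ∑.∑ Ω (λ _ → 1)
      ≡⟨ ≡.trans (RandomGraph.∑-const Ω 1) (ℕ.*-identityʳ (length Ω)) ⟩
    length Ω ∎
    where
    open ℕ.≤-Reasoning
    Ss = subsetsOfSize n k
    Ω = cartesianProduct (graphs n) Ss
    bad : Graph n × Subset n → ℕ
    bad x = 𝟙 (not (isGood k r x))
    each : ∀ S → S ∈ Ss → t ℕ.* ℕ∑.∑ (graphs n) (λ G → bad (G , S)) ℕ.≤ #graphs n
    each S S∈ = ℕ.≤-trans (ℕ.≤-reflexive (≡.cong (t ℕ.*_) (ℕ∑.∑-cong (graphs n) (λ G → ≡.cong (𝟙 ∘ not)
        (≡.trans (≡.cong (does (good? G S r) ∧_) (dec-true (∣ S ∣ ℕ.≟ k) ∣S∣≡k)) (∧-identityʳ _))))))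
      (#bad-≤ R t t≤ S ∣S∣≡k)
      where
      ∣S∣≡k : ∣ S ∣ ≡ k
      ∣S∣≡k = proj₂ (∈-filter⁻ (λ S → ∣ S ∣ ℕ.≟ k) {xs = subsets n} S∈)

  isGood-sound : ∀ {n} k r (G : Graph n) S → T (isGood k r (G , S)) → Good G S r × ∣ S ∣ ≡ k
  isGood-sound k r G S t = let (tg , tk) = Equivalence.to (T-∧ {does (good? G S r)}) t in does-yes (good? G S r) tg , ℕ.≡ᵇ⇒≡ _ k tk

  -- Slow dynamics with high probability.

  module _ {α γ : Carrier} (D : ℕ) {{D≢0 : NonZero D}}
    (Dα+1≤D : fromℕ D * α + 1# ≤ fromℕ D) (1≤Dα : 1# ≤ fromℕ D * α) (1≤γD : 1# ≤ γ * fromℕ D) where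
    open Regimes.Scale D

    private
      instance
        4ww≢0 : NonZero (4 ℕ.* (w ℕ.* w))
        4ww≢0 = ℕ.m*n≢0 4 (w ℕ.* w) {{_}} {{ℕ.m*n≢0 w w {{w≢0}} {{w≢0}}}}
          where
          w≢0 : NonZero w
          w≢0 = ℕ.>-nonZero (ℕ.≤-trans (ℕ.s≤s ℕ.z≤n) 8≤w)

    -- From `log n ≤ w (e + 1) ≤ 2we` follows `log² n ≤ 4w²e²`; dividing by `4w²` and multiplying by
    -- `ln2` gives an exponent of at most `e² ln 2`, the logarithm of the horizon.
    rate : Carrier
    rate = ln2 * (fromℕ (4 ℕ.* (w ℕ.* w)) ⁻¹⟨ 0<fromℕ (4 ℕ.* (w ℕ.* w)) ⟩)

    0<rate : 0# < rate
    0<rate = *-pos 0<ln2 (0<⁻¹ _ _)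

    exp-rate-≤ : ∀ n e → .{{_ : NonZero n}} → 1 ℕ.≤ e → n ℕ.≤ 2 ℕ.^ (w ℕ.* ℕ.suc e) → exp (rate * log² n) ≤ fromℕ (horizon e)
    exp-rate-≤ n e 1≤e n≤ = ≤-trans (exp-mono-≤ (begin
      rate * log² n                                 ≤⟨ *-monoʳ-≤ (<⇒≤ 0<rate) (*-mono-≤ (0≤log n) log≤ (0≤log n) log≤) ⟩
      rate * (fromℕ (2we) * fromℕ (2we))            ≈⟨ *-congˡ (trans (sym (fromℕ-* 2we 2we)) (trans (reflexive (≡.cong fromℕ square)) (fromℕ-* W (e ℕ.* e)))) ⟩
      ln2 * W⁻¹ * (fromℕ W * fromℕ (e ℕ.* e))       ≈⟨ solve 4 (λ l i w x → l :* i :* (w :* x) := (w :* i) :* (x :* l)) refl ln2 W⁻¹ (fromℕ W) (fromℕ (e ℕ.* e)) ⟩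
      (fromℕ W * W⁻¹) * (fromℕ (e ℕ.* e) * ln2)     ≈⟨ trans (*-congʳ (*-inverseʳ (fromℕ W) (0<fromℕ W))) (*-identityˡ _) ⟩
      fromℕ (e ℕ.* e) * ln2                         ∎)) (≤-reflexive (exp-*ln2 (e ℕ.* e)))
      where
      open ≤-Reasoning
      W = 4 ℕ.* (w ℕ.* w)
      W⁻¹ = fromℕ W ⁻¹⟨ 0<fromℕ W ⟩
      2we = w ℕ.* (e ℕ.+ e)
      log≤ : log n ≤ fromℕ 2we
      log≤ = log-≤ 2we n (ℕ.≤-trans n≤ (ℕ.^-monoʳ-≤ 2 (ℕ.*-monoʳ-≤ w (ℕ.+-monoˡ-≤ e 1≤e))))
      open import Data.Nat.Solver using (module +-*-Solver)
      square : 2we ℕ.* 2we ≡ W ℕ.* (e ℕ.* e)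
      square = NS.solve 2 (λ w e → w NS.:* (e NS.:+ e) NS.:* (w NS.:* (e NS.:+ e)) NS.:= NS.con 4 NS.:* (w NS.:* w) NS.:* (e NS.:* e)) ≡.refl w e
        where module NS = +-*-Solver

    -- Here `R * radius e = w * e ≤ log n`, and `γ * R ≥ γ * D ≥ 1`.
    radius-≤ : ∀ n e → .{{_ : NonZero n}} → 0# < γ → 2 ℕ.^ (w ℕ.* e) ℕ.≤ n → fromℕ (radius e) ≤ γ * log n
    radius-≤ n e 0<γ n≥ = begin
      fromℕ (radius e)                        ≈⟨ *-identityˡ _ ⟨
      1# * fromℕ (radius e)                   ≤⟨ *-monoˡ-≤ (0≤fromℕ (radius e)) (≤-trans 1≤γD (*-monoʳ-≤ (<⇒≤ 0<γ) (fromℕ-mono-≤ (ℕ.m≤n*m D 4)))) ⟩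
      γ * fromℕ R * fromℕ (radius e)          ≈⟨ trans (*-assoc γ _ _) (*-congˡ (trans (sym (fromℕ-* R (radius e))) (reflexive (≡.cong fromℕ Rr≡we)))) ⟩
      γ * fromℕ (w ℕ.* e)                     ≤⟨ *-monoʳ-≤ (<⇒≤ 0<γ) (log-≥ (w ℕ.* e) n n≥) ⟩
      γ * log n                               ∎
      where
      open ≤-Reasoning
      open import Data.Nat.Solver using (module +-*-Solver)
      Rr≡we : R ℕ.* radius e ≡ w ℕ.* e
      Rr≡we = NS.solve 2 (λ R e → R NS.:* (NS.con 2 NS.:* R NS.:* e) NS.:= NS.con 2 NS.:* (R NS.:* R) NS.:* e) ≡.refl R e
        where module NS = +-*-Solver

    whp : ∀ {ℓ′} e₁ (E : ∀ n → .{{NonZero n}} → Graph n → Subset n → Set ℓ′) →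
      (∀ n k e → .{{_ : NonZero n}} → n ℕ.≤ ℕ.suc k ℕ.^ D → e₁ ℕ.≤ e → 1 ℕ.≤ e → 2 ℕ.^ (w ℕ.* e) ℕ.≤ n → n ℕ.≤ 2 ℕ.^ (w ℕ.* ℕ.suc e) →
        ∀ G S → ∣ S ∣ ≡ k → Good G S (radius e) → E n (plant G S) S) →
      WithHighProbability ℝ α E
    whp {ℓ′} e₁ E sound ε 0<ε = eventually (archimedean (ε ⁻¹⟨ 0<ε ⟩)) (n^j≤2^n 18)
      where
      eventually : ∃[ t ] ε ⁻¹⟨ 0<ε ⟩ < fromℕ t → ∃[ e₀ ] (∀ e → e₀ ℕ.≤ e → e ℕ.^ 18 ℕ.≤ 2 ℕ.^ e) →
        ∃[ n₀ ] ∀ n → .{{_ : NonZero n}} → n₀ ℕ.≤ n → ∀ k → IsFloor k (n ^ℝ α) →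
        UniformProbAtLeast ℝ (cartesianProduct (graphs n) (subsetsOfSize n k)) (λ (G , S) → E n (plant G S) S) (1# - ε)
      eventually (t , ε⁻¹<t) (e₀ , e¹⁸≤) = (2 ℕ.^ w) ℕ.^ e-min , λ n n≥n₀ k (k≤ , <k) → at n n≥n₀ k k≤ <k
       where
       -- The sum dominates four thresholds: `w` and `e₀` for the regime, `e₁` for the caller, and
       -- `t`, which exceeds `1/ε`, to bring the failure probability `1/e` below `ε`.
       e-min = w ℕ.+ (e₀ ℕ.+ (e₁ ℕ.+ t))
       at : ∀ n → .{{_ : NonZero n}} → (2 ℕ.^ w) ℕ.^ e-min ℕ.≤ n → ∀ k → fromℕ k ≤ n ^ℝ α → n ^ℝ α < fromℕ (ℕ.suc k) →
         UniformProbAtLeast ℝ (cartesianProduct (graphs n) (subsetsOfSize n k)) (λ (G , S) → E n (plant G S) S) (1# - ε)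
       at n n≥n₀ k k≤ <k = at-scale (floor-log (2 ℕ.^ w) (ℕ.^-monoʳ-< 2 (ℕ.n<1+n 1) (ℕ.≤-trans (ℕ.s≤s ℕ.z≤n) 8≤w)) n)
         where
         at-scale : ∃[ e ] (2 ℕ.^ w) ℕ.^ e ℕ.≤ n × n ℕ.< (2 ℕ.^ w) ℕ.^ ℕ.suc e →
           UniformProbAtLeast ℝ (cartesianProduct (graphs n) (subsetsOfSize n k)) (λ (G , S) → E n (plant G S) S) (1# - ε)
         at-scale (e , lo , hi) = few-bad⇒likely (cartesianProduct (graphs n) (subsetsOfSize n k)) (isGood k (radius e)) (λ (G , S) good → let (g , ∣S∣≡k) = isGood-sound k (radius e) G S good in
             sound n k e (n≤[1+k]^D D k n 1≤Dα <k) e₁≤e (ℕ.≤-trans (ℕ.≤-trans (ℕ.s≤s ℕ.z≤n) 8≤w) w≤e) n≥ n≤ G S ∣S∣≡k g) e 0<ε 1≤eε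
             (few-bad (regime n k e (k^D*n≤n^D D k n Dα+1≤D k≤) n≥ n≤ w≤e (e¹⁸≤ e e₀≤e)) e ℕ.≤-refl)
           where
           n≥ : 2 ℕ.^ (w ℕ.* e) ℕ.≤ n
           n≥ = ℕ.≤-trans (ℕ.≤-reflexive (≡.sym (ℕ.^-*-assoc 2 w e))) lo
           n≤ : n ℕ.≤ 2 ℕ.^ (w ℕ.* ℕ.suc e)
           n≤ = ℕ.≤-trans (ℕ.<⇒≤ hi) (ℕ.≤-reflexive (ℕ.^-*-assoc 2 w (ℕ.suc e)))
           e-min≤e : e-min ℕ.≤ e
           e-min≤e = floor-log-≥ (2 ℕ.^ w) {{ℕ.m^n≢0 2 w}} n≥n₀ hi
           w≤e = ℕ.≤-trans (ℕ.m≤m+n w _) e-min≤e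
           rest≤e = ℕ.≤-trans (ℕ.m≤n+m (e₀ ℕ.+ (e₁ ℕ.+ t)) w) e-min≤e
           e₀≤e = ℕ.≤-trans (ℕ.m≤m+n e₀ _) rest≤e
           rest′≤e = ℕ.≤-trans (ℕ.m≤n+m (e₁ ℕ.+ t) e₀) rest≤e
           e₁≤e = ℕ.≤-trans (ℕ.m≤m+n e₁ t) rest′≤e
           t≤e = ℕ.≤-trans (ℕ.m≤n+m t e₁) rest′≤e
           1≤eε : 1# ≤ fromℕ e * ε
           1≤eε = ≤-trans (≤-reflexive (sym (*-inverseˡ ε 0<ε))) (*-monoˡ-≤ (<⇒≤ 0<ε) (≤-trans (<⇒≤ ε⁻¹<t) (fromℕ-mono-≤ t≤e)))

    slow : 0# < γ → WithHighProbability ℝ α (λ n G S → (ST : SimulatedTempering ℝ n) → SlowToReachOverlap ℝ γ rate n G S ST)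
    slow 0<γ = whp 0 (λ n G S → (ST : SimulatedTempering ℝ n) → SlowToReachOverlap ℝ γ rate n G S ST) λ n k e _ _ 1≤e n≥ n≤ G S _ good ST →
      let (C , i , clique , prob) = slow-start ST G S (radius e) (horizon e) good (ℕ.≤-trans 1≤e (e≤radius e)) (horizon²< e 1≤e)
      in C , i , clique , λ t t<exp → prob t (ℕ.<⇒≤ (fromℕ-cancel-< (<-≤-trans t<exp (exp-rate-≤ n e 1≤e n≤)))) (rate * log² n) (exp-rate-≤ n e 1≤e n≤)
        (λ (X , _) → ¬ (γ * log n ≤ fromℕ ∣ X ∩ S ∣))
        (λ C _ C∩S<r reached → reached (<-≤-trans (fromℕ-mono-< C∩S<r) (radius-≤ n e 0<γ n≥)))

    fails : ∀ d → WithHighProbability ℝ α (λ n G S → (ST : SimulatedTempering ℝ n) → FailsToRecoverWithin ℝ d rate n G S ST)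
    -- From `e ≥ 2wd` on, `n ^ d` steps fit into the horizon. The degree `d` influences only how
    -- large `n` must be, so one rate serves every `d`.
    fails d = whp (2 ℕ.* w ℕ.* d) (λ n G S → (ST : SimulatedTempering ℝ n) → FailsToRecoverWithin ℝ d rate n G S ST) λ n k e n≤[1+k]ᴰ 2wd≤e 1≤e n≥ n≤ G S ∣S∣≡k good ST →
      let (C , i , clique , prob) = slow-start ST G S (radius e) (horizon e) good (ℕ.≤-trans 1≤e (e≤radius e)) (horizon²< e 1≤e)
      in C , i , clique , prob (n ℕ.^ d) (n^d≤horizon n d e n≤ 1≤e 2wd≤e) (rate * log² n) (exp-rate-≤ n e 1≤e n≤)
        (λ (X , _) → X ≢ S)
        -- If `X` were the planted clique, its overlap would be `k`, which is at least the radius.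
        (λ { C _ C∩S<r ≡.refl → ℕ.<⇒≱ C∩S<r (ℕ.≤-trans (radius≤k n k e n≤[1+k]ᴰ n≥)
          (ℕ.≤-reflexive (≡.sym (≡.trans (≡.cong ∣_∣ (∩-idem C)) ∣S∣≡k)))) })

open RealField using (Carrier; _<_; 0#; 1#)

theorem8p3 : ∀ {c ℓ} (ℝ : RealField c ℓ) (α γ : Carrier ℝ) →
    _<_ ℝ (0# ℝ) α → _<_ ℝ α (1# ℝ) → _<_ ℝ (0# ℝ) γ →
    Σ[ κ ∈ Carrier ℝ ] _<_ ℝ (0# ℝ) κ ×
    WithHighProbability ℝ α (λ n G PC →
    (S : SimulatedTempering ℝ n) → SlowToReachOverlap ℝ γ κ n G PC S) ×
    ((d : ℕ) → WithHighProbability ℝ α (λ n G PC →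
    (S : SimulatedTempering ℝ n) → FailsToRecoverWithin ℝ d κ n G PC S))
theorem8p3 ℝ α γ 0<α α<1 0<γ =
  let open Asymptotics ℝ
      (D , D≢0 , Dα+1≤D , 1≤Dα , 1≤γD) = ∃-exponent 0<α α<1 0<γ
  in rate D {{D≢0}} Dα+1≤D 1≤Dα 1≤γD , 0<rate D {{D≢0}} Dα+1≤D 1≤Dα 1≤γD ,
     slow D {{D≢0}} Dα+1≤D 1≤Dα 1≤γD 0<γ , fails D {{D≢0}} Dα+1≤D 1≤Dα 1≤γD
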